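{- Let $K=\mathbb{Q}(\sqrt{d})$ be a real quadratic field, where $d>1$ is a square-free positive integer. Then $n_K=1$ if and only if $d$ is of one of the following types: (T1) $d=m^2+1$ with $m\in\mathbb{N}$ odd; (T2) $d=m^2-1$ with $m\in\mathbb{N}$ even; (T3) $d=m^2+4$ with $m\in\mathbb{N}$ odd; (T4) $d=m^2-4$ with $m\in\mathbb{N}$ odd and $m>3$.
   Context: For a totally real number field $K$ with ring of integers $\mathcal{O}_K$ and unit group $\mathcal{O}_K^\times$, let $K_{>>0}$ be the set of totally positive elements of $K$. For $a\in K_{>>0}$ the unary (quadratic) form $ax^2$ has trace minimum $\mu(a)=\min_{x\in\mathcal{O}_K\setminus\{0\}}\mathrm{Tr}_{K/\mathbb{Q}}(ax^2)$ and set of minimal vectors $\mathcal{M}(a)=\{x\in\mathcal{O}_K:\mathrm{Tr}_{K/\mathbb{Q}}(ax^2)=\mu(a)\}$. The form $ax^2$ is perfect if $a$ is uniquely determined by $\mu(a)$ and $\mathcal{M}(a)$, i.e. $a$ is the only $b\in K_{>>0}$ with $\mathrm{Tr}_{K/\mathbb{Q}}(bv^2)=\mu(a)$ for all $v\in\mathcal{M}(a)$. Two forms $ax^2,bx^2$ are equivalent if $b=au^2$ for some $u\in\mathcal{O}_K^\times$, and homothetic if $b=\lambda a$ for some rational $\lambda>0$. $n_K$ denotes the number of classes of perfect unary forms over $K$ up to equivalence and homothety. -}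

module Defs where

open import Data.Fin using (Fin)
open import Data.Integer using (ℤ; +_)
open import Data.List using (List; []; _∷_)
open import Data.Nat as ℕ using (ℕ)
open import Data.Nat.Divisibility using (_∣_)
open import Data.Product using (Σ; ∃; ∃₂; _×_; proj₁)
open import Data.Rational using (ℚ; 0ℚ; 1ℚ; _+_; _*_; -_; _<_; _≤_)
open import Data.Rational.Literals using (fromℤ)
open import Data.Sum using (_⊎_)
open import Function.Bundles using (Bijection)
open import Level using (0ℓ)
open import Relation.Binary.Bundles using (Setoid)
open import Relation.Binary.Core using (Rel)
import Relation.Binary.Construct.Closure.Equivalence as Closure
open import Relation.Binary.Construct.Union using (_∪_)
open import Relation.Binary.PropositionalEquality as ≡ using (_≡_; _≢_)

SquareFree : ℕ → Set
SquareFree d = ∀ n → n ℕ.* n ∣ d → n ≡ 1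

HasCardinality : Setoid 0ℓ 0ℓ → ℕ → Set
HasCardinality S n = Bijection (≡.setoid (Fin n)) S

-- K = ℚ(√d), a field of degree 2 only when d is not a square.
module RealQuadratic (d : ℕ) where

  infixl 6 _+ᴷ_
  infixl 7 _*ᴷ_
  infix  4 _<√d √d<_

  -- The element re + im √d.
  record K : Set where
    constructor _+√d_
    field
      re im : ℚ
  open K public

  dℚ : ℚ
  dℚ = fromℤ (+ d)

  fromℚ : ℚ → K
  fromℚ r = r +√d 0ℚ

  0ᴷ 1ᴷ √d : K
  0ᴷ = fromℚ 0ℚ
  1ᴷ = fromℚ 1ℚ
  √d = 0ℚ +√d 1ℚ

  _+ᴷ_ _*ᴷ_ : K → K → K
  x +ᴷ y = (re x + re y) +√d (im x + im y)
  x *ᴷ y = (re x * re y + dℚ * (im x * im y)) +√d (re x * im y + im x * re y)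

  conj : K → K
  conj x = re x +√d (- im x)

  -- Trace of the ℚ-linear map y ↦ x y, computed in the basis 1, √d.
  Tr : K → ℚ
  Tr x = re (x *ᴷ 1ᴷ) + im (x *ᴷ √d)

  -- evalMonic (c₀ ∷ … ∷ cₙ₋₁ ∷ []) x = c₀ + c₁ x + … + cₙ₋₁ xⁿ⁻¹ + xⁿ
  evalMonic : List ℤ → K → K
  evalMonic []       x = 1ᴷ
  evalMonic (c ∷ cs) x = fromℚ (fromℤ c) +ᴷ x *ᴷ evalMonic cs x

  -- Membership in the ring of integers 𝒪_K.
  Integral : K → Set
  Integral x = ∃ λ cs → evalMonic cs x ≡ 0ᴷ

  -- Membership in 𝒪_K^×.
  IsUnit : K → Set
  IsUnit u = Integral u × ∃ λ v → Integral v × u *ᴷ v ≡ 1ᴷ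

  -- The two sides of the Dedekind cut of the positive real number √d.
  _<√d : ℚ → Set
  l <√d = l < 0ℚ ⊎ l * l < dℚ

  √d<_ : ℚ → Set
  √d< u = 0ℚ < u × dℚ < u * u

  -- The real number re x + im x · √d (with √d > 0) is positive.  As t ↦ re x + im x · t
  -- is affine and continuous, it is positive at √d exactly when it is positive at both
  -- endpoints of some rational interval around √d.
  Positive : K → Set
  Positive x = ∃₂ λ l u → l <√d × √d< u × 0ℚ < re x + im x * l × 0ℚ < re x + im x * u

  -- The real embeddings of K send √d to the positive and to the negative square root of
  -- d; the second is the first one composed with conj.
  TotallyPositive : K → Set
  TotallyPositive x = Positive x × Positive (conj x)

  -- The value at x of the ℚ-quadratic form attached to the unary form a x².
  trForm : K → K → ℚ
  trForm a x = Tr (a *ᴷ (x *ᴷ x))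

  -- m = μ(a).
  IsTraceMinimum : K → ℚ → Set
  IsTraceMinimum a m =
    (∃ λ x → Integral x × x ≢ 0ᴷ × trForm a x ≡ m) ×
    (∀ x → Integral x → x ≢ 0ᴷ → m ≤ trForm a x)

  -- v ∈ ℳ(a), where m = μ(a).
  IsMinimalVector : K → ℚ → K → Set
  IsMinimalVector a m v = Integral v × trForm a v ≡ m

  Perfect : K → Set
  Perfect a = TotallyPositive a × ∃ λ m → IsTraceMinimum a m ×
    (∀ b → TotallyPositive b → (∀ v → IsMinimalVector a m v → trForm b v ≡ m) → b ≡ a)

  PerfectForm : Set
  PerfectForm = Σ K Perfect

  Equivalent Homothetic : Rel K 0ℓ
  Equivalent a b = ∃ λ u → IsUnit u × b ≡ a *ᴷ (u *ᴷ u)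
  Homothetic a b = ∃ λ r → 0ℚ < r × b ≡ fromℚ r *ᴷ a

  -- Equality in this setoid is the equivalence relation generated by equivalence and
  -- homothety of forms.
  PerfectClasses : Setoid 0ℓ 0ℓ
  PerfectClasses = Closure.setoid {A = PerfectForm} λ f g →
    (Equivalent ∪ Homothetic) (proj₁ f) (proj₁ g)

  -- n_K = n.
  NumberOfPerfectClasses : ℕ → Set
  NumberOfPerfectClasses = HasCardinality PerfectClasses

{-# OPTIONS --safe #-}
-- Write 𝒪_K = ℤ + ℤω with ω² = t ω + n.  For a suitable k, the value of the trace form of some a₀ at
-- x + y (k + ω) is, up to scaling, a binary form P x² + 2 c x y + P y² with |2 c| ≤ P.  Hence 1 and
-- ε = k + ω are minimal vectors of a₀, every minimal vector is x + y ε with |y| ≤ 1, and the values at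
-- 1 and ε determine a₀, which is therefore perfect; so is its conjugate.
-- If n_K = 1, then conj a₀ = r a₀ u² with a unit u, and comparing norms gives r = 1.  So u is a minimal
-- vector of a₀, and it is not rational, for otherwise a₀ would be rational.  Thus ±u = A + ω for an integer
-- A, and the equation A² + t A - n = ±1 yields the four types.
-- Conversely, for d of one of these types k can be chosen such that ε is a unit.  Replacing a perfect
-- form by a y² with a unit y, one can assume that its value at 1 is at most its values at ε and conj ε.
-- It then lies in the cone spanned by a₀ and conj a₀.  A form in this cone that is not a multiple of
-- conj a₀ takes its minimum only at minimal vectors of a₀, so that it is a multiple of a₀ if it is perfect;
-- finally a₀ = conj a₀ (conj ε)².
module Submission where

open import Defs

-- The trace of `ε` is `P = 2 k + t` and its norm is `c - 1`, so `ε² = P ε - (c - 1)`. Equal values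
-- at 1 and `ε`, that is Tr a = Tr (a ε²), therefore force Tr (a ε) : Tr a = c : P; this is the
-- origin of the binary form. A `k` with `|c| ≤ k` exists for every positive `n`: raising `n` by one
-- lowers `c` by one, and raising both `n` and `k` sends `c = - k` to `k + t`. `a₀` and `conj a₀`
-- have the same minimum, attained by both at 1, and are told apart by `ε` and `conj ε`. Hence
-- comparing the value at 1 with those at `ε` and `conj ε` gives exactly the two walls of their
-- cone. Two notions are first made computable. An integral element comes with a monic equation,
-- which combines badly under sums; it is replaced by one nonzero integer clearing the denominators
-- of all powers, and this makes trace and norm integers. Total positivity, stated by rational
-- intervals around the root of d, is replaced by positive `re` and positive norm.

module PerfectUnaryForms where

  open import Algebra.Bundles using (CommutativeRing)
  import Algebra.Solver.Ring.NaturalCoefficients.Default as NaturalCoefficients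
  open import Data.Fin as Fin using (Fin)
  open import Data.Integer as ℤ using (ℤ; +_; -[1+_]; 0ℤ; 1ℤ; -1ℤ)
  import Data.Integer.DivMod as ℤ
  open import Data.Integer.Divisibility.Signed using (divides; ∣ᵤ⇒∣)
  import Data.Integer.Properties as ℤₚ
  import Data.Integer.Tactic.RingSolver as ℤ-Solver
  open import Data.List using (List; []; _∷_; length; reverse; _ʳ++_)
  open import Data.List.Properties using (length-ʳ++; reverse-involutive)
  open import Data.Nat as ℕ using (ℕ; zero; suc; s≤s; z≤n)
  open import Data.Nat.Coprimality as Coprimality using (Coprime; coprime-divisor)
  import Data.Nat.DivMod as ℕ
  import Data.Nat.Divisibility as ℕᵈ
  import Data.Nat.Properties as ℕₚ
  import Data.Nat.Tactic.RingSolver as ℕ-Solver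
  open import Data.Product using (∃; ∃₂; _×_; _,_; proj₁; proj₂)
  open import Data.Rational as ℚ using (ℚ; mkℚ; 0ℚ; 1ℚ; ½; _+_; _*_; -_; _-_; 1/_; _<_; _≤_; ↥_; ↧_; ↧ₙ_; *<*; *≤*)
  open import Data.Rational.Literals using (fromℤ)
  import Data.Rational.Properties as ℚ
  import Data.Rational.Unnormalised as ℚᵘ
  import Data.Rational.Unnormalised.Properties as ℚᵘₚ
  open import Data.Sum using (_⊎_; inj₁; inj₂)
  open import Function using (_∘_)
  open import Function.Bundles using (Bijection; _⇔_; mk⇔)
  open import Level using (0ℓ)
  open import Relation.Binary.Bundles using (Setoid)
  import Relation.Binary.Construct.Closure.Equivalence as Closure
  open import Relation.Binary.Definitions using (tri<; tri≈; tri>)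
  open import Relation.Binary.PropositionalEquality
  open import Relation.Binary.Structures using (IsEquivalence)
  open import Relation.Nullary using (¬_; Dec; yes; no; contradiction)
  open import Relation.Nullary.Decidable.Core using (dec⇒maybe)
  open import Tactic.RingSolver using (solve-∀)
  import Tactic.RingSolver.Core.AlmostCommutativeRing as ACR

  -- Ordered field arithmetic in ℚ.

  ℚ-ring : ACR.AlmostCommutativeRing 0ℓ 0ℓ
  ℚ-ring = ACR.fromCommutativeRing ℚ.+-*-commutativeRing λ p → dec⇒maybe (0ℚ ℚ.≟ p)

  private variable
    p q r : ℚ
    i j : ℤ

  2ℚ 4ℚ : ℚ
  2ℚ = 1ℚ + 1ℚ
  4ℚ = 2ℚ + 2ℚ

  p<q⇒0<q-p : p < q → 0ℚ < q - p
  p<q⇒0<q-p {p} {q} p<q = subst (_< q - p) (ℚ.+-inverseʳ p) (ℚ.+-monoˡ-< (- p) p<q)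

  p≤q⇒0≤q-p : p ≤ q → 0ℚ ≤ q - p
  p≤q⇒0≤q-p {p} {q} p≤q = subst (_≤ q - p) (ℚ.+-inverseʳ p) (ℚ.+-monoˡ-≤ (- p) p≤q)

  0<q-p⇒p<q : 0ℚ < q - p → p < q
  0<q-p⇒p<q {q} {p} 0<q-p = subst₂ _<_ (ℚ.+-identityʳ p) (eq p q) (ℚ.+-monoʳ-< p 0<q-p)
    where
    eq : ∀ p q → p + (q - p) ≡ q
    eq = solve-∀ ℚ-ring

  0≤q-p⇒p≤q : 0ℚ ≤ q - p → p ≤ q
  0≤q-p⇒p≤q {q} {p} 0≤q-p = subst₂ _≤_ (ℚ.+-identityʳ p) (eq p q) (ℚ.+-monoʳ-≤ p 0≤q-p)
    where
    eq : ∀ p q → p + (q - p) ≡ q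
    eq = solve-∀ ℚ-ring

  <-by : 0ℚ < r → q - p ≡ r → p < q
  <-by 0<r eq = 0<q-p⇒p<q (subst (0ℚ <_) (sym eq) 0<r)

  0<p+q : 0ℚ < p → 0ℚ < q → 0ℚ < p + q
  0<p+q = ℚ.+-mono-<

  0<p+q′ : 0ℚ < p → 0ℚ ≤ q → 0ℚ < p + q
  0<p+q′ = ℚ.+-mono-<-≤

  0≤p+q : 0ℚ ≤ p → 0ℚ ≤ q → 0ℚ ≤ p + q
  0≤p+q = ℚ.+-mono-≤

  0<p*q : 0ℚ < p → 0ℚ < q → 0ℚ < p * q
  0<p*q {p} {q} 0<p 0<q = subst (_< p * q) (ℚ.*-zeroʳ p) (ℚ.*-monoʳ-<-pos p {{ℚ.positive 0<p}} 0<q)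

  0≤p*q : 0ℚ ≤ p → 0ℚ ≤ q → 0ℚ ≤ p * q
  0≤p*q {p} {q} 0≤p 0≤q = subst (_≤ p * q) (ℚ.*-zeroʳ p) (ℚ.*-monoˡ-≤-nonNeg p {{ℚ.nonNegative 0≤p}} 0≤q)

  0≤p² : ∀ p → 0ℚ ≤ p * p
  0≤p² p with ℚ.≤-total 0ℚ p
  ... | inj₁ 0≤p = 0≤p*q 0≤p 0≤p
  ... | inj₂ p≤0 = subst (0ℚ ≤_) (eq p) (0≤p*q (ℚ.neg-antimono-≤ p≤0) (ℚ.neg-antimono-≤ p≤0))
    where
    eq : ∀ p → (- p) * (- p) ≡ p * p
    eq = solve-∀ ℚ-ring

  <⇒≱ : p < q → ¬ q ≤ p
  <⇒≱ p<q q≤p = ℚ.<-irrefl refl (ℚ.<-≤-trans p<q q≤p)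

  0<p*q⇒0<q : 0ℚ ≤ p → 0ℚ < p * q → 0ℚ < q
  0<p*q⇒0<q {p} {q} 0≤p 0<pq with 0ℚ ℚ.<? q
  ... | yes 0<q = 0<q
  ... | no 0≮q = contradiction 0≤-pq (<⇒≱ (ℚ.neg-antimono-< 0<pq))
    where
    eq : ∀ p q → p * (- q) ≡ - (p * q)
    eq = solve-∀ ℚ-ring
    0≤-pq = subst (0ℚ ≤_) (eq p q) (0≤p*q 0≤p (ℚ.neg-antimono-≤ (ℚ.≮⇒≥ 0≮q)))

  0≤p*q⇒0≤q : 0ℚ < p → 0ℚ ≤ p * q → 0ℚ ≤ q
  0≤p*q⇒0≤q {p} {q} 0<p 0≤pq with 0ℚ ℚ.≤? q
  ... | yes 0≤q = 0≤q
  ... | no 0≰q = contradiction 0≤pq (<⇒≱ (0<q-p⇒p<q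
    (subst (0ℚ <_) (eq p q) (0<p*q 0<p (ℚ.neg-antimono-< (ℚ.≰⇒> 0≰q))))))
    where
    eq : ∀ p q → p * (- q) ≡ 0ℚ - p * q
    eq = solve-∀ ℚ-ring

  quotient : ∀ p {q} → q ≢ 0ℚ → ∃ λ r → r * q ≡ p
  quotient p {q} q≢0 = p * 1/ q , trans (ℚ.*-assoc p (1/ q) q)
    (trans (cong (p *_) (ℚ.*-inverseˡ q)) (ℚ.*-identityʳ p))
    where instance _ = ℚ.≢-nonZero q≢0

  p*q≡0⇒q≡0 : p ≢ 0ℚ → p * q ≡ 0ℚ → q ≡ 0ℚ
  p*q≡0⇒q≡0 {p} {q} p≢0 pq≡0 =
    let r , rp≡1 = quotient 1ℚ p≢0 in begin
      q           ≡⟨ ℚ.*-identityˡ q ⟨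
      1ℚ * q      ≡⟨ cong (_* q) rp≡1 ⟨
      r * p * q   ≡⟨ ℚ.*-assoc r p q ⟩
      r * (p * q) ≡⟨ cong (r *_) pq≡0 ⟩
      r * 0ℚ      ≡⟨ ℚ.*-zeroʳ r ⟩
      0ℚ          ∎
    where open ≡-Reasoning

  *-cancelˡ : p ≢ 0ℚ → p * q ≡ p * r → q ≡ r
  *-cancelˡ {p} {q} {r} p≢0 eq = begin
    q           ≡⟨ split q r ⟩
    (q - r) + r ≡⟨ cong (_+ r) (p*q≡0⇒q≡0 p≢0 (trans (distrib p q r)
      (trans (cong (_- p * r) eq) (ℚ.+-inverseʳ (p * r))))) ⟩
    0ℚ + r      ≡⟨ ℚ.+-identityˡ r ⟩
    r           ∎
    where
    open ≡-Reasoning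
    split : ∀ q r → q ≡ (q - r) + r
    split = solve-∀ ℚ-ring
    distrib : ∀ p q r → p * (q - r) ≡ p * q - p * r
    distrib = solve-∀ ℚ-ring

  0<⇒≢0 : 0ℚ < p → p ≢ 0ℚ
  0<⇒≢0 0<p p≡0 = ℚ.<-irrefl (sym p≡0) 0<p

  ≢0⇒0<p² : p ≢ 0ℚ → 0ℚ < p * p
  ≢0⇒0<p² {p} p≢0 with ℚ.<-cmp 0ℚ (p * p)
  ... | tri< 0<p² _ _ = 0<p²
  ... | tri≈ _ 0≡p² _ = contradiction (p*q≡0⇒q≡0 p≢0 (sym 0≡p²)) p≢0
  ... | tri> _ _ p²<0 = contradiction (0≤p² p) (<⇒≱ p²<0)

  -- If `q + p ≤ 0`, then `q - p = 2 q - (q + p)` is nonnegative, and `q² - p²` would be at most 0.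
  p²<q²⇒0<q+p : 0ℚ ≤ q → p * p < q * q → 0ℚ < q + p
  p²<q²⇒0<q+p {q} {p} 0≤q p²<q² with 0ℚ ℚ.<? q + p
  ... | yes 0<q+p = 0<q+p
  ... | no  0≮q+p = contradiction (0≤p*q 0≤-[q+p] 0≤q-p) (<⇒≱ (0<q-p⇒p<q (subst (0ℚ <_) (eq₂ p q) (p<q⇒0<q-p p²<q²))))
    where
    eq₁ : ∀ p q → q + q + - (q + p) ≡ q - p
    eq₁ = solve-∀ ℚ-ring
    eq₂ : ∀ p q → q * q - p * p ≡ 0ℚ - (- (q + p)) * (q - p)
    eq₂ = solve-∀ ℚ-ring
    0≤-[q+p] = ℚ.neg-antimono-≤ (ℚ.≮⇒≥ 0≮q+p)
    0≤q-p = subst (0ℚ ≤_) (eq₁ p q) (0≤p+q (0≤p+q 0≤q 0≤q) 0≤-[q+p])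

  -- The embedding of ℤ in ℚ, opaque so that conversion checking never normalises fractions.

  opaque
    ⟦_⟧ : ℤ → ℚ
    ⟦_⟧ = fromℤ

    ⟦⟧≡fromℤ : ∀ i → ⟦ i ⟧ ≡ fromℤ i
    ⟦⟧≡fromℤ _ = refl

    ⟦⟧-injective : ⟦ i ⟧ ≡ ⟦ j ⟧ → i ≡ j
    ⟦⟧-injective = cong ↥_

    ⟦⟧-+ : ∀ i j → ⟦ i ℤ.+ j ⟧ ≡ ⟦ i ⟧ + ⟦ j ⟧
    ⟦⟧-+ i j = ℚ.toℚᵘ-injective (ℚᵘₚ.≃-trans (ℚᵘ.*≡* (eq i j)) (ℚᵘₚ.≃-sym (ℚ.toℚᵘ-homo-+ (fromℤ i) (fromℤ j))))
      where
      eq : ∀ i j → (i ℤ.+ j) ℤ.* 1ℤ ≡ (i ℤ.* 1ℤ ℤ.+ j ℤ.* 1ℤ) ℤ.* 1ℤ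
      eq = ℤ-Solver.solve-∀

    ⟦⟧-* : ∀ i j → ⟦ i ℤ.* j ⟧ ≡ ⟦ i ⟧ * ⟦ j ⟧
    ⟦⟧-* i j = ℚ.toℚᵘ-injective (ℚᵘₚ.≃-sym (ℚ.toℚᵘ-homo-* (fromℤ i) (fromℤ j)))

    ⟦⟧-neg : ∀ i → ⟦ ℤ.- i ⟧ ≡ - ⟦ i ⟧
    ⟦⟧-neg -[1+ _ ]  = refl
    ⟦⟧-neg (+ zero)  = refl
    ⟦⟧-neg (+ suc _) = refl

    ⟦0⟧ : ⟦ 0ℤ ⟧ ≡ 0ℚ
    ⟦0⟧ = refl

    ⟦1⟧ : ⟦ 1ℤ ⟧ ≡ 1ℚ
    ⟦1⟧ = refl

    ⟦2⟧ : ⟦ + 2 ⟧ ≡ 2ℚ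
    ⟦2⟧ = refl

    ⟦4⟧ : ⟦ + 4 ⟧ ≡ 4ℚ
    ⟦4⟧ = refl

    ⟦⟧-mono-≤ : i ℤ.≤ j → ⟦ i ⟧ ≤ ⟦ j ⟧
    ⟦⟧-mono-≤ i≤j = *≤* (subst₂ ℤ._≤_ (sym (ℤₚ.*-identityʳ _)) (sym (ℤₚ.*-identityʳ _)) i≤j)

    ⟦⟧-mono-< : i ℤ.< j → ⟦ i ⟧ < ⟦ j ⟧
    ⟦⟧-mono-< i<j = *<* (subst₂ ℤ._<_ (sym (ℤₚ.*-identityʳ _)) (sym (ℤₚ.*-identityʳ _)) i<j)

    ⟦⟧-cancel-< : ⟦ i ⟧ < ⟦ j ⟧ → i ℤ.< j
    ⟦⟧-cancel-< (*<* i<j) = subst₂ ℤ._<_ (ℤₚ.*-identityʳ _) (ℤₚ.*-identityʳ _) i<j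

    ↧*p≡↥ : ∀ p → ⟦ ↧ p ⟧ * p ≡ ⟦ ↥ p ⟧
    ↧*p≡↥ p@record{} = ℚ.toℚᵘ-injective (ℚᵘₚ.≃-trans (ℚ.toℚᵘ-homo-* (fromℤ (↧ p)) p) (ℚᵘ.*≡* (eq (↥ p) (↧ p))))
      where
      eq : ∀ a b → b ℤ.* a ℤ.* 1ℤ ≡ a ℤ.* (1ℤ ℤ.* b)
      eq = ℤ-Solver.solve-∀

  IsInteger : ℚ → Set
  IsInteger p = ∃ λ i → ⟦ i ⟧ ≡ p

  -- Combined along the structure of an integer expression, these compute its image in ℚ.
  infixl 6 _⊹_ _⊟_
  infixl 7 _⊠_

  _⊹_ : ⟦ i ⟧ ≡ p → ⟦ j ⟧ ≡ q → ⟦ i ℤ.+ j ⟧ ≡ p + q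
  _⊹_ {i = i} {j = j} eq₁ eq₂ = trans (⟦⟧-+ i j) (cong₂ _+_ eq₁ eq₂)

  _⊠_ : ⟦ i ⟧ ≡ p → ⟦ j ⟧ ≡ q → ⟦ i ℤ.* j ⟧ ≡ p * q
  _⊠_ {i = i} {j = j} eq₁ eq₂ = trans (⟦⟧-* i j) (cong₂ _*_ eq₁ eq₂)

  _⊟_ : ⟦ i ⟧ ≡ p → ⟦ j ⟧ ≡ q → ⟦ i ℤ.- j ⟧ ≡ p - q
  _⊟_ {j = j} eq₁ eq₂ = eq₁ ⊹ trans (⟦⟧-neg j) (cong -_ eq₂)

  integer : ∀ i → IsInteger ⟦ i ⟧
  integer i = i , refl

  integer-+ : IsInteger p → IsInteger q → IsInteger (p + q)
  integer-+ (i , eq₁) (j , eq₂) = i ℤ.+ j , eq₁ ⊹ eq₂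

  integer-* : IsInteger p → IsInteger q → IsInteger (p * q)
  integer-* (i , eq₁) (j , eq₂) = i ℤ.* j , eq₁ ⊠ eq₂

  integer-neg : IsInteger p → IsInteger (- p)
  integer-neg (i , eq) = ℤ.- i , trans (⟦⟧-neg i) (cong -_ eq)

  -- Rational numbers whose powers have a common denominator.

  infixr 8 _^_

  _^_ : ℚ → ℕ → ℚ
  p ^ zero  = 1ℚ
  p ^ suc n = p * p ^ n

  coprime : ∀ p → Coprime (↧ₙ p) ℤ.∣ ↥ p ∣
  coprime (mkℚ _ _ c) = Coprimality.sym (Coprimality.recompute c)

  ↧≡1⇒integer : ∀ p → ↧ₙ p ≡ 1 → IsInteger p
  ↧≡1⇒integer p eq = ↥ p , sym (begin
    p                ≡⟨ ℚ.*-identityˡ p ⟨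
    1ℚ * p           ≡⟨ cong (_* p) ⟦1⟧ ⟨
    ⟦ 1ℤ ⟧ * p       ≡⟨ cong (λ n → ⟦ + n ⟧ * p) eq ⟨
    ⟦ ↧ p ⟧ * p      ≡⟨ ↧*p≡↥ p ⟩
    ⟦ ↥ p ⟧          ∎)
    where open ≡-Reasoning

  -- The descent step on a common denominator: `D x = n (D′ x)`, and a factor `n` of this integer
  -- cancels.
  divide-out : ∀ {D x} D′ n .{{_ : ℕ.NonZero n}} → D ≡ D′ ℕ.* n → (int : IsInteger (⟦ + D ⟧ * x)) →
               n ℕᵈ.∣ ℤ.∣ proj₁ int ∣ → IsInteger (⟦ + D′ ⟧ * x)
  divide-out {D} {x} D′ n D≡D′n (z , eq) n∣z with ∣ᵤ⇒∣ {+ n} {z} n∣z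
  ... | divides w z≡wn = w , *-cancelˡ ⟦n⟧≢0 (begin
    ⟦ + n ⟧ * ⟦ w ⟧            ≡⟨ ℚ.*-comm ⟦ + n ⟧ ⟦ w ⟧ ⟩
    ⟦ w ⟧ * ⟦ + n ⟧            ≡⟨ ⟦⟧-* w (+ n) ⟨
    ⟦ w ℤ.* + n ⟧              ≡⟨ cong ⟦_⟧ z≡wn ⟨
    ⟦ z ⟧                      ≡⟨ eq ⟩
    ⟦ + D ⟧ * x                ≡⟨ cong (λ m → ⟦ m ⟧ * x) (trans (cong +_ D≡D′n) (ℤₚ.pos-* D′ n)) ⟩
    ⟦ + D′ ℤ.* + n ⟧ * x       ≡⟨ cong (_* x) (⟦⟧-* (+ D′) (+ n)) ⟩
    ⟦ + D′ ⟧ * ⟦ + n ⟧ * x     ≡⟨ shift ⟦ + D′ ⟧ ⟦ + n ⟧ x ⟩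
    ⟦ + n ⟧ * (⟦ + D′ ⟧ * x)   ∎)
    where
    open ≡-Reasoning
    shift : ∀ a b x → a * b * x ≡ b * (a * x)
    shift = solve-∀ ℚ-ring
    ⟦n⟧≢0 : ⟦ + n ⟧ ≢ 0ℚ
    ⟦n⟧≢0 = 0<⇒≢0 (subst (_< ⟦ + n ⟧) ⟦0⟧ (⟦⟧-mono-< (ℤ.+<+ (ℕ.>-nonZero⁻¹ n))))

  -- If D pʲ is an integer for all j, then so is (D / ↧ p) pʲ: hence ↧ p = 1, by descent on D.
  bounded-powers⇒integer : ∀ p D → D ≢ 0 → (∀ j → IsInteger (⟦ + D ⟧ * p ^ j)) → IsInteger p
  bounded-powers⇒integer p D = descent D D ℕₚ.≤-refl
    where
    -- With `z = D pʲ`, the next power gives `(D pʲ⁺¹) ↧p = ↥p z`; so `↧p` divides `↥p z` and, being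
    -- coprime to `↥p`, divides `z`.
    ↧∣ : ∀ D → (∀ j → IsInteger (⟦ + D ⟧ * p ^ j)) → ∀ j z → ⟦ z ⟧ ≡ ⟦ + D ⟧ * p ^ j → ↧ₙ p ℕᵈ.∣ ℤ.∣ z ∣
    ↧∣ D int j z eq with int (suc j)
    ... | z′ , eq′ = coprime-divisor (coprime p) (ℕᵈ.divides ℤ.∣ z′ ∣
      (trans (sym (ℤₚ.abs-* (↥ p) z)) (trans (cong ℤ.∣_∣ (sym z′↧≡↥z)) (ℤₚ.abs-* z′ (↧ p)))))
      where
      open ≡-Reasoning
      shift : ∀ a b c x → a * (b * x) * c ≡ (c * b) * (a * x)
      shift = solve-∀ ℚ-ring
      z′↧≡↥z : z′ ℤ.* ↧ p ≡ ↥ p ℤ.* z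
      z′↧≡↥z = ⟦⟧-injective (begin
        ⟦ z′ ℤ.* ↧ p ⟧                         ≡⟨ eq′ ⊠ refl ⟩
        ⟦ + D ⟧ * (p * p ^ j) * ⟦ ↧ p ⟧        ≡⟨ shift ⟦ + D ⟧ p ⟦ ↧ p ⟧ (p ^ j) ⟩
        ⟦ ↧ p ⟧ * p * (⟦ + D ⟧ * p ^ j)        ≡⟨ cong₂ _*_ (↧*p≡↥ p) (sym eq) ⟩
        ⟦ ↥ p ⟧ * ⟦ z ⟧                        ≡⟨ ⟦⟧-* (↥ p) z ⟨
        ⟦ ↥ p ℤ.* z ⟧                          ∎)

    descent : ∀ fuel D → D ℕ.≤ fuel → D ≢ 0 → (∀ j → IsInteger (⟦ + D ⟧ * p ^ j)) → IsInteger p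
    divide-↧ : ∀ fuel D → D ℕ.≤ suc fuel → D ≢ 0 → (∀ j → IsInteger (⟦ + D ⟧ * p ^ j)) →
               Dec (↧ₙ p ≡ 1) → ↧ₙ p ℕᵈ.∣ D → IsInteger p

    descent zero       .zero z≤n   D≢0 _   = contradiction refl D≢0
    descent (suc fuel) D     D≤1+f D≢0 int =
      divide-↧ fuel D D≤1+f D≢0 int (↧ₙ p ℕ.≟ 1) (↧∣ D int 0 (+ D) (sym (ℚ.*-identityʳ ⟦ + D ⟧)))

    divide-↧ fuel D D≤1+f D≢0 int (yes ↧≡1) _                       = ↧≡1⇒integer p ↧≡1
    divide-↧ fuel D D≤1+f D≢0 int (no ↧≢1)  (ℕᵈ.divides D′ D≡D′↧) =
      descent fuel D′ (ℕ.s≤s⁻¹ (ℕₚ.≤-trans D′<D D≤1+f)) D′≢0 λ j →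
        divide-out D′ (↧ₙ p) D≡D′↧ (int j) (↧∣ D int j (proj₁ (int j)) (proj₂ (int j)))
      where
      D′≢0 : D′ ≢ 0
      D′≢0 D′≡0 = D≢0 (trans D≡D′↧ (cong (ℕ._* ↧ₙ p) D′≡0))

      D′<D : D′ ℕ.< D
      D′<D = subst (D′ ℕ.<_) (sym D≡D′↧) (ℕₚ.m<m*n D′ (↧ₙ p) {{ℕ.≢-nonZero D′≢0}} (ℕₚ.≤∧≢⇒< (s≤s z≤n) (↧≢1 ∘ sym)))

  -- The field K, and integrality of traces and norms.

  module Field (d : ℕ) where
    open RealQuadratic d public

    D : ℚ
    D = ⟦ + d ⟧

    dℚ≡D : dℚ ≡ D
    dℚ≡D = sym (⟦⟧≡fromℤ (+ d))

    infix 4 _∈ℤ[√d]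
    infix 8 -ᴷ_

    -ᴷ_ : K → K
    -ᴷ x = (- re x) +√d (- im x)

    K-commutativeRing : CommutativeRing 0ℓ 0ℓ
    K-commutativeRing = record
      { Carrier = K ; _≈_ = _≡_ ; _+_ = _+ᴷ_ ; _*_ = _*ᴷ_ ; -_ = -ᴷ_ ; 0# = 0ᴷ ; 1# = 1ᴷ
      ; isCommutativeRing = record
        { isRing = record
          { +-isAbelianGroup = record
            { isGroup = record
              { isMonoid = record
                { isSemigroup = record
                  { isMagma = isMagma _+ᴷ_
                  ; assoc = λ { (a +√d b) (p +√d q) (r +√d s) → cong₂ _+√d_ (ℚ.+-assoc a p r) (ℚ.+-assoc b q s) }
                  }
                ; identity = (λ { (a +√d b) → cong₂ _+√d_ (ℚ.+-identityˡ a) (ℚ.+-identityˡ b) })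
                           , (λ { (a +√d b) → cong₂ _+√d_ (ℚ.+-identityʳ a) (ℚ.+-identityʳ b) })
                }
              ; inverse = (λ { (a +√d b) → cong₂ _+√d_ (ℚ.+-inverseˡ a) (ℚ.+-inverseˡ b) })
                        , (λ { (a +√d b) → cong₂ _+√d_ (ℚ.+-inverseʳ a) (ℚ.+-inverseʳ b) })
              ; ⁻¹-cong = cong -ᴷ_
              }
            ; comm = λ { (a +√d b) (p +√d q) → cong₂ _+√d_ (ℚ.+-comm a p) (ℚ.+-comm b q) }
            }
          ; *-cong = cong₂ _*ᴷ_
          ; *-assoc = λ { (a +√d b) (p +√d q) (r +√d s) →
            cong₂ _+√d_ (assoc-re dℚ a b p q r s) (assoc-im dℚ a b p q r s) }
          ; *-identity = (λ { (a +√d b) → cong₂ _+√d_ (idˡ-re dℚ a b) (idˡ-im b a) })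
                       , (λ { (a +√d b) → cong₂ _+√d_ (idʳ-re dℚ a b) (idʳ-im a b) })
          ; distrib = (λ { (a +√d b) (p +√d q) (r +√d s) →
            cong₂ _+√d_ (distˡ-re dℚ a b p q r s) (distˡ-im a b p q r s) })
                    , (λ { (a +√d b) (p +√d q) (r +√d s) →
                      cong₂ _+√d_ (distʳ-re dℚ a b p q r s) (distʳ-im a b p q r s) })
          }
        ; *-comm = λ { (a +√d b) (p +√d q) → cong₂ _+√d_ (comm-re dℚ a b p q) (comm-im a b p q) }
        }
      }
      where

      assoc-re : ∀ D a b p q r s → (a * p + D * (b * q)) * r + D * ((a * q + b * p) * s) ≡ a * (p * r + D * (q * s)) +
        D * (b * (p * s + q * r))
      assoc-re = solve-∀ ℚ-ring
      assoc-im : ∀ D a b p q r s → (a * p + D * (b * q)) * s + (a * q + b * p) * r ≡ a * (p * s + q * r) + b *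
        (p * r + D * (q * s))
      assoc-im = solve-∀ ℚ-ring
      idˡ-re : ∀ D a b → 1ℚ * a + D * (0ℚ * b) ≡ a
      idˡ-re = solve-∀ ℚ-ring
      idˡ-im : ∀ b a → 1ℚ * b + 0ℚ * a ≡ b
      idˡ-im = solve-∀ ℚ-ring
      idʳ-re : ∀ D a b → a * 1ℚ + D * (b * 0ℚ) ≡ a
      idʳ-re = solve-∀ ℚ-ring
      idʳ-im : ∀ a b → a * 0ℚ + b * 1ℚ ≡ b
      idʳ-im = solve-∀ ℚ-ring
      distˡ-re : ∀ D a b p q r s → a * (p + r) + D * (b * (q + s)) ≡ (a * p + D * (b * q)) + (a * r + D * (b * s))
      distˡ-re = solve-∀ ℚ-ring
      distˡ-im : ∀ a b p q r s → a * (q + s) + b * (p + r) ≡ (a * q + b * p) + (a * s + b * r)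
      distˡ-im = solve-∀ ℚ-ring
      distʳ-re : ∀ D a b p q r s → (p + r) * a + D * ((q + s) * b) ≡ (p * a + D * (q * b)) + (r * a + D * (s * b))
      distʳ-re = solve-∀ ℚ-ring
      distʳ-im : ∀ a b p q r s → (p + r) * b + (q + s) * a ≡ (p * b + q * a) + (r * b + s * a)
      distʳ-im = solve-∀ ℚ-ring
      comm-re : ∀ D a b p q → a * p + D * (b * q) ≡ p * a + D * (q * b)
      comm-re = solve-∀ ℚ-ring
      comm-im : ∀ a b p q → a * q + b * p ≡ p * b + q * a
      comm-im = solve-∀ ℚ-ring

    open CommutativeRing K-commutativeRing public
      using () renaming (commutativeSemiring to K-commutativeSemiring; *-assoc to *ᴷ-assoc; +-identityʳ to
        +ᴷ-identityʳ; -‿inverseʳ to +ᴷ-inverseʳ; distribˡ to distribˡᴷ; *-comm to *ᴷ-comm; *-identityˡ to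
        *ᴷ-identityˡ; *-identityʳ to *ᴷ-identityʳ; zeroˡ to *ᴷ-zeroˡ; zeroʳ to *ᴷ-zeroʳ)
    module K-Solver = NaturalCoefficients K-commutativeSemiring
    open K-Solver using (_:=_; _:+_; _:*_; con)

    conj-* : ∀ x y → conj (x *ᴷ y) ≡ conj x *ᴷ conj y
    conj-* x y = cong₂ _+√d_ (eq-re dℚ (re x) (im x) (re y) (im y)) (eq-im (re x) (im x) (re y) (im y))
      where
      eq-re : ∀ D a b p q → a * p + D * (b * q) ≡ a * p + D * ((- b) * (- q))
      eq-re = solve-∀ ℚ-ring
      eq-im : ∀ a b p q → - (a * q + b * p) ≡ a * (- q) + (- b) * p
      eq-im = solve-∀ ℚ-ring

    conj-involutive : ∀ x → conj (conj x) ≡ x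
    conj-involutive x = cong (re x +√d_) (eq (im x))
      where
      eq : ∀ p → - (- p) ≡ p
      eq = solve-∀ ℚ-ring

    Tr≡2re : ∀ x → Tr x ≡ re x + re x
    Tr≡2re x = eq dℚ (re x) (im x)
      where
      eq : ∀ D a b → (a * 1ℚ + D * (b * 0ℚ)) + (a * 1ℚ + b * 0ℚ) ≡ a + a
      eq = solve-∀ ℚ-ring

    trForm≡ : ∀ a x → trForm a x ≡ 2ℚ * (re a * (re x * re x + dℚ * (im x * im x)) + dℚ *
      (im a * (2ℚ * (re x * im x))))
    trForm≡ a x = trans (Tr≡2re (a *ᴷ (x *ᴷ x))) (eq dℚ (re a) (im a) (re x) (im x))
      where
      eq : ∀ D a b p q → (a * (p * p + D * (q * q)) + D * (b * (p * q + q * p))) +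
        (a * (p * p + D * (q * q)) + D * (b * (p * q + q * p)))
                       ≡ 2ℚ * (a * (p * p + D * (q * q)) + D * (b * (2ℚ * (p * q))))
      eq = solve-∀ ℚ-ring

    trForm-* : ∀ a u x → trForm (a *ᴷ (u *ᴷ u)) x ≡ trForm a (u *ᴷ x)
    trForm-* a u x = cong Tr (eq a u x)
      where
      eq : ∀ a u x → (a *ᴷ (u *ᴷ u)) *ᴷ (x *ᴷ x) ≡ a *ᴷ ((u *ᴷ x) *ᴷ (u *ᴷ x))
      eq = K-Solver.solve 3 (λ a u x → (a :* (u :* u)) :* (x :* x) := a :* ((u :* x) :* (u :* x))) refl

    trForm-conj : ∀ a x → trForm (conj a) (conj x) ≡ trForm a x
    trForm-conj a x = begin
      Tr (conj a *ᴷ (conj x *ᴷ conj x))   ≡⟨ cong (λ y → Tr (conj a *ᴷ y)) (conj-* x x) ⟨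
      Tr (conj a *ᴷ conj (x *ᴷ x))        ≡⟨ cong Tr (conj-* a (x *ᴷ x)) ⟨
      Tr (conj (a *ᴷ (x *ᴷ x)))           ≡⟨ Tr≡2re (conj (a *ᴷ (x *ᴷ x))) ⟩
      _                                   ≡⟨ Tr≡2re (a *ᴷ (x *ᴷ x)) ⟨
      Tr (a *ᴷ (x *ᴷ x))                  ∎
      where open ≡-Reasoning

    N : K → ℚ
    N x = re x * re x - dℚ * (im x * im x)

    x*conj-x≡N : ∀ x → x *ᴷ conj x ≡ fromℚ (N x)
    x*conj-x≡N x = cong₂ _+√d_ (eq-re dℚ (re x) (im x)) (eq-im (re x) (im x))
      where
      eq-re : ∀ D a b → a * a + D * (b * (- b)) ≡ a * a - D * (b * b)
      eq-re = solve-∀ ℚ-ring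
      eq-im : ∀ a b → a * (- b) + b * a ≡ 0ℚ
      eq-im = solve-∀ ℚ-ring

    N-* : ∀ x y → N (x *ᴷ y) ≡ N x * N y
    N-* x y = eq dℚ (re x) (im x) (re y) (im y)
      where
      eq : ∀ D a b p q → (a * p + D * (b * q)) * (a * p + D * (b * q)) - D * ((a * q + b * p) * (a * q + b * p))
                       ≡ (a * a - D * (b * b)) * (p * p - D * (q * q))
      eq = solve-∀ ℚ-ring

    N-conj : ∀ x → N (conj x) ≡ N x
    N-conj x = eq dℚ (re x) (im x)
      where
      eq : ∀ D a b → a * a - D * ((- b) * (- b)) ≡ a * a - D * (b * b)
      eq = solve-∀ ℚ-ring

    fromℚ-* : ∀ p q → fromℚ p *ᴷ fromℚ q ≡ fromℚ (p * q)
    fromℚ-* p q = cong₂ _+√d_ (eq-re dℚ p q) (eq-im p q)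
      where
      eq-re : ∀ D p q → p * q + D * (0ℚ * 0ℚ) ≡ p * q
      eq-re = solve-∀ ℚ-ring
      eq-im : ∀ p q → p * 0ℚ + 0ℚ * q ≡ 0ℚ
      eq-im = solve-∀ ℚ-ring

    fromℚ*≡ : ∀ r x → fromℚ r *ᴷ x ≡ (r * re x) +√d (r * im x)
    fromℚ*≡ r x = cong₂ _+√d_ (eq-re dℚ r (re x) (im x)) (eq-im r (re x) (im x))
      where
      eq-re : ∀ D r a b → r * a + D * (0ℚ * b) ≡ r * a
      eq-re = solve-∀ ℚ-ring
      eq-im : ∀ r a b → r * b + 0ℚ * a ≡ r * b
      eq-im = solve-∀ ℚ-ring

    _∈ℤ[√d] : K → Set
    x ∈ℤ[√d] = IsInteger (re x) × IsInteger (im x)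

    integer-fromℤ : ∀ i → IsInteger (fromℤ i)
    integer-fromℤ i = i , ⟦⟧≡fromℤ i

    integer-0 : IsInteger 0ℚ
    integer-0 = 0ℤ , ⟦0⟧

    ∈-fromℚ : ∀ {r} → IsInteger r → fromℚ r ∈ℤ[√d]
    ∈-fromℚ r∈ℤ = r∈ℤ , integer-0

    ∈-+ : ∀ {x y} → x ∈ℤ[√d] → y ∈ℤ[√d] → x +ᴷ y ∈ℤ[√d]
    ∈-+ (a , b) (p , q) = integer-+ a p , integer-+ b q

    ∈-* : ∀ {x y} → x ∈ℤ[√d] → y ∈ℤ[√d] → x *ᴷ y ∈ℤ[√d]
    ∈-* (a , b) (p , q) = integer-+ (integer-* a p) (integer-* (integer-fromℤ (+ d)) (integer-* b q))
                        , integer-+ (integer-* a q) (integer-* b p)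

    ∈-conj : ∀ {x} → x ∈ℤ[√d] → conj x ∈ℤ[√d]
    ∈-conj (a , b) = a , integer-neg b

    infixr 8 _^ᴷ_

    _^ᴷ_ : K → ℕ → K
    x ^ᴷ zero  = 1ᴷ
    x ^ᴷ suc n = x *ᴷ x ^ᴷ n

    κ : ℕ → K
    κ n = fromℚ ⟦ + n ⟧

    κ-* : ∀ m n → κ (m ℕ.* n) ≡ κ m *ᴷ κ n
    κ-* m n = begin
      fromℚ ⟦ + (m ℕ.* n) ⟧     ≡⟨ cong (fromℚ ∘ ⟦_⟧) (ℤₚ.pos-* m n) ⟩
      fromℚ ⟦ + m ℤ.* + n ⟧     ≡⟨ cong fromℚ (⟦⟧-* (+ m) (+ n)) ⟩
      fromℚ (⟦ + m ⟧ * ⟦ + n ⟧) ≡⟨ fromℚ-* ⟦ + m ⟧ ⟦ + n ⟧ ⟨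
      κ m *ᴷ κ n                ∎
      where open ≡-Reasoning

    ∈-κ : ∀ n → κ n ∈ℤ[√d]
    ∈-κ n = ∈-fromℚ (integer (+ n))

    -- Almost integrality: all powers lie in one fractional ideal of ℤ[√d]. Unlike a monic equation,
    -- this passes directly to sums, products and conjugates.
    BoundedPowers : K → Set
    BoundedPowers x = ∃ λ n → n ≢ 0 × ∀ j → κ n *ᴷ x ^ᴷ j ∈ℤ[√d]

    denominator : ∀ x → ∃ λ n → n ≢ 0 × κ n *ᴷ x ∈ℤ[√d]
    denominator x@(a +√d b) = ↧ₙ a ℕ.* ↧ₙ b , (λ ()) , subst _∈ℤ[√d] (sym eq)
        (integer-* (↥ a , sym (↧*p≡↥ a)) (integer (↧ b)) , integer-* (integer (↧ a)) (↥ b , sym (↧*p≡↥ b)))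
      where
      eq-re : ∀ p q a → p * q * a ≡ (p * a) * q
      eq-re = solve-∀ ℚ-ring
      eq : κ (↧ₙ a ℕ.* ↧ₙ b) *ᴷ x ≡ (⟦ ↧ a ⟧ * a * ⟦ ↧ b ⟧) +√d (⟦ ↧ a ⟧ * (⟦ ↧ b ⟧ * b))
      eq = begin
        κ (↧ₙ a ℕ.* ↧ₙ b) *ᴷ x
          ≡⟨ cong (_*ᴷ x) (trans (κ-* (↧ₙ a) (↧ₙ b)) (fromℚ-* ⟦ ↧ a ⟧ ⟦ ↧ b ⟧)) ⟩
        fromℚ (⟦ ↧ a ⟧ * ⟦ ↧ b ⟧) *ᴷ x                ≡⟨ fromℚ*≡ (⟦ ↧ a ⟧ * ⟦ ↧ b ⟧) x ⟩
        (⟦ ↧ a ⟧ * ⟦ ↧ b ⟧ * a) +√d (⟦ ↧ a ⟧ * ⟦ ↧ b ⟧ * b)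
          ≡⟨ cong₂ _+√d_ (eq-re ⟦ ↧ a ⟧ ⟦ ↧ b ⟧ a) (ℚ.*-assoc ⟦ ↧ a ⟧ ⟦ ↧ b ⟧ b) ⟩
        (⟦ ↧ a ⟧ * a * ⟦ ↧ b ⟧) +√d (⟦ ↧ a ⟧ * (⟦ ↧ b ⟧ * b)) ∎
        where open ≡-Reasoning

    module _ (x : K) (δ : ℕ) (δx∈ : κ δ *ᴷ x ∈ℤ[√d]) where

      -- Each factor `x` costs one factor `δ`, so `δⁿ` clears a polynomial of degree at most `n`.
      ∈-evalMonic : ∀ n cs → length cs ℕ.≤ n → κ (δ ℕ.^ n) *ᴷ evalMonic cs x ∈ℤ[√d]
      ∈-evalMonic n       []       _            = subst _∈ℤ[√d] (sym (*ᴷ-identityʳ _)) (∈-κ (δ ℕ.^ n))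
      ∈-evalMonic (suc n) (c ∷ cs) (s≤s |cs|≤n) = subst _∈ℤ[√d] eq
        (∈-+ (∈-* (∈-κ (δ ℕ.^ suc n)) (∈-fromℚ (integer-fromℤ c))) (∈-* δx∈ (∈-evalMonic n cs |cs|≤n)))
        where
        open ≡-Reasoning
        E = evalMonic cs x
        cᴷ = fromℚ (fromℤ c)
        shift : ∀ δ Δ c x E → (δ *ᴷ Δ) *ᴷ c +ᴷ (δ *ᴷ x) *ᴷ (Δ *ᴷ E) ≡ (δ *ᴷ Δ) *ᴷ (c +ᴷ x *ᴷ E)
        shift = K-Solver.solve 5 (λ δ Δ c x E → (δ :* Δ) :* c :+ (δ :* x) :* (Δ :* E) := (δ :* Δ) :* (c :+ x :* E))
          refl
        eq : κ (δ ℕ.^ suc n) *ᴷ cᴷ +ᴷ (κ δ *ᴷ x) *ᴷ (κ (δ ℕ.^ n) *ᴷ E) ≡ κ (δ ℕ.^ suc n) *ᴷ (cᴷ +ᴷ x *ᴷ E)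
        eq = begin
          κ (δ ℕ.^ suc n) *ᴷ cᴷ +ᴷ (κ δ *ᴷ x) *ᴷ (κ (δ ℕ.^ n) *ᴷ E)
            ≡⟨ cong (λ y → y *ᴷ cᴷ +ᴷ (κ δ *ᴷ x) *ᴷ (κ (δ ℕ.^ n) *ᴷ E)) (κ-* δ (δ ℕ.^ n)) ⟩
          (κ δ *ᴷ κ (δ ℕ.^ n)) *ᴷ cᴷ +ᴷ (κ δ *ᴷ x) *ᴷ (κ (δ ℕ.^ n) *ᴷ E)
            ≡⟨ shift (κ δ) (κ (δ ℕ.^ n)) cᴷ x E ⟩
          (κ δ *ᴷ κ (δ ℕ.^ n)) *ᴷ (cᴷ +ᴷ x *ᴷ E)
            ≡⟨ cong (_*ᴷ (cᴷ +ᴷ x *ᴷ E)) (κ-* δ (δ ℕ.^ n)) ⟨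
          κ (δ ℕ.^ suc n) *ᴷ (cᴷ +ᴷ x *ᴷ E) ∎

      module _ (cs : List ℤ) (root : evalMonic cs x ≡ 0ᴷ) where

        Δ : K
        Δ = κ (δ ℕ.^ length cs)

        -- The values at x of the tails of the polynomial span a lattice that is stable under
        -- multiplication by x, since x p = (c + x p) - c for the tail p following c.
        ∈-tails : ∀ j pre ts → pre ʳ++ ts ≡ cs → Δ *ᴷ (x ^ᴷ j *ᴷ evalMonic ts x) ∈ℤ[√d]
        ∈-tails zero pre ts refl = subst _∈ℤ[√d] (cong (Δ *ᴷ_) (sym (*ᴷ-identityˡ (evalMonic ts x))))
          (∈-evalMonic (length cs) ts (subst (length ts ℕ.≤_) (sym (length-ʳ++ pre))
            (ℕₚ.m≤n+m (length ts) (length pre))))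
        -- The reversed prefix is used up, so `ts` is the whole polynomial and vanishes at `x`.
        ∈-tails (suc j) [] ts refl = subst _∈ℤ[√d] (sym eq) (∈-fromℚ integer-0)
          where
          eq : Δ *ᴷ (x ^ᴷ suc j *ᴷ evalMonic ts x) ≡ 0ᴷ
          eq = trans (cong (λ y → Δ *ᴷ (x ^ᴷ suc j *ᴷ y)) root)
            (trans (cong (Δ *ᴷ_) (*ᴷ-zeroʳ (x ^ᴷ suc j))) (*ᴷ-zeroʳ Δ))
        -- The longer tail `c ∷ ts` supplies `c + x p`; the correction `- c` multiplies `xʲ`, which
        -- is covered by the empty tail, whose value is 1.
        ∈-tails (suc j) (c ∷ pre) ts eq = subst _∈ℤ[√d] telescope
          (∈-+ (∈-tails j pre (c ∷ ts) eq) (∈-* (∈-fromℚ (integer-neg (integer-fromℤ c)))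
            (∈-tails j (reverse cs) [] (reverse-involutive cs))))
          where
          open ≡-Reasoning
          E = evalMonic ts x
          cᴷ = fromℚ (fromℤ c)
          -- `expand` is a semiring identity, so the negative enters it as an independent variable
          -- and is cancelled afterwards.
          -cᴷ = fromℚ (- fromℤ c)
          expand : ∀ Δ X c x E m → Δ *ᴷ (X *ᴷ (c +ᴷ x *ᴷ E)) +ᴷ m *ᴷ (Δ *ᴷ (X *ᴷ 1ᴷ)) ≡ Δ *ᴷ ((x *ᴷ X) *ᴷ E) +ᴷ
            (c +ᴷ m) *ᴷ (Δ *ᴷ X)
          expand = K-Solver.solve 6 (λ Δ X c x E m →
            Δ :* (X :* (c :+ x :* E)) :+ m :* (Δ :* (X :* con 1)) := Δ :* ((x :* X) :* E) :+ (c :+ m) :* (Δ :* X))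
            refl
          cancel : cᴷ +ᴷ -cᴷ ≡ 0ᴷ
          cancel = cong₂ _+√d_ (ℚ.+-inverseʳ (fromℤ c)) refl
          telescope : Δ *ᴷ (x ^ᴷ j *ᴷ (cᴷ +ᴷ x *ᴷ E)) +ᴷ -cᴷ *ᴷ (Δ *ᴷ (x ^ᴷ j *ᴷ 1ᴷ)) ≡ Δ *ᴷ (x ^ᴷ suc j *ᴷ E)
          telescope = begin
            Δ *ᴷ (x ^ᴷ j *ᴷ (cᴷ +ᴷ x *ᴷ E)) +ᴷ -cᴷ *ᴷ (Δ *ᴷ (x ^ᴷ j *ᴷ 1ᴷ)) ≡⟨ expand Δ (x ^ᴷ j) cᴷ x E -cᴷ ⟩
            Δ *ᴷ (x ^ᴷ suc j *ᴷ E) +ᴷ (cᴷ +ᴷ -cᴷ) *ᴷ (Δ *ᴷ x ^ᴷ j)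
              ≡⟨ cong (λ y → Δ *ᴷ (x ^ᴷ suc j *ᴷ E) +ᴷ y *ᴷ (Δ *ᴷ x ^ᴷ j)) cancel ⟩
            Δ *ᴷ (x ^ᴷ suc j *ᴷ E) +ᴷ 0ᴷ *ᴷ (Δ *ᴷ x ^ᴷ j)
              ≡⟨ cong (Δ *ᴷ (x ^ᴷ suc j *ᴷ E) +ᴷ_) (*ᴷ-zeroˡ (Δ *ᴷ x ^ᴷ j)) ⟩
            Δ *ᴷ (x ^ᴷ suc j *ᴷ E) +ᴷ 0ᴷ ≡⟨ +ᴷ-identityʳ (Δ *ᴷ (x ^ᴷ suc j *ᴷ E)) ⟩
            Δ *ᴷ (x ^ᴷ suc j *ᴷ E) ∎

    -- The lattice of tails contains every power of `x`, because the empty tail has value 1.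
    integral⇒boundedPowers : ∀ {x} → Integral x → BoundedPowers x
    integral⇒boundedPowers {x} (cs , root) =
      let δ , δ≢0 , δx∈ = denominator x in
      δ ℕ.^ length cs , ℕ.≢-nonZero⁻¹ _ {{ℕₚ.m^n≢0 δ (length cs) {{ℕ.≢-nonZero δ≢0}}}} , λ j →
      subst _∈ℤ[√d] (cong (κ (δ ℕ.^ length cs) *ᴷ_) (*ᴷ-identityʳ (x ^ᴷ j)))
        (∈-tails x δ δx∈ cs root j (reverse cs) [] (reverse-involutive cs))

    ^ᴷ-distribʳ-* : ∀ x y j → (x *ᴷ y) ^ᴷ j ≡ x ^ᴷ j *ᴷ y ^ᴷ j
    ^ᴷ-distribʳ-* x y zero    = sym (*ᴷ-identityˡ 1ᴷ)
    ^ᴷ-distribʳ-* x y (suc j) = trans (cong ((x *ᴷ y) *ᴷ_) (^ᴷ-distribʳ-* x y j)) (interchange x y (x ^ᴷ j) (y ^ᴷ j))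
      where
      interchange : ∀ x y X Y → (x *ᴷ y) *ᴷ (X *ᴷ Y) ≡ (x *ᴷ X) *ᴷ (y *ᴷ Y)
      interchange = K-Solver.solve 4 (λ x y X Y → (x :* y) :* (X :* Y) := (x :* X) :* (y :* Y)) refl

    conj-^ : ∀ x j → conj (x ^ᴷ j) ≡ conj x ^ᴷ j
    conj-^ x zero    = refl
    conj-^ x (suc j) = trans (conj-* x (x ^ᴷ j)) (cong (conj x *ᴷ_) (conj-^ x j))

    boundedPowers-conj : ∀ {x} → BoundedPowers x → BoundedPowers (conj x)
    boundedPowers-conj {x} (n , n≢0 , nx∈) = n , n≢0 , λ j →
      subst _∈ℤ[√d] (trans (conj-* (κ n) (x ^ᴷ j)) (cong (κ n *ᴷ_) (conj-^ x j))) (∈-conj (nx∈ j))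

    module _ {x y : K} (bx : BoundedPowers x) (by : BoundedPowers y) where

      private
        m = proj₁ bx
        n = proj₁ by

        mn≢0 : m ℕ.* n ≢ 0
        mn≢0 = ℕ.≢-nonZero⁻¹ _ {{ℕₚ.m*n≢0 m n {{ℕ.≢-nonZero (proj₁ (proj₂ bx))}} {{ℕ.≢-nonZero (proj₁ (proj₂ by))}}}}

        ∈-products : ∀ i j → κ (m ℕ.* n) *ᴷ (x ^ᴷ i *ᴷ y ^ᴷ j) ∈ℤ[√d]
        ∈-products i j = subst _∈ℤ[√d] (trans (interchange (κ m) (x ^ᴷ i) (κ n) (y ^ᴷ j))
          (cong (_*ᴷ (x ^ᴷ i *ᴷ y ^ᴷ j)) (sym (κ-* m n))))
          (∈-* (proj₂ (proj₂ bx) i) (proj₂ (proj₂ by) j))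
          where
          interchange : ∀ m X n Y → (m *ᴷ X) *ᴷ (n *ᴷ Y) ≡ (m *ᴷ n) *ᴷ (X *ᴷ Y)
          interchange = K-Solver.solve 4 (λ m X n Y → (m :* X) :* (n :* Y) := (m :* n) :* (X :* Y)) refl

        -- Peeling one factor `x + y` off the power raises either `i` or `j`; carrying the monomial
        -- along replaces the binomial theorem.
        ∈-sums : ∀ k i j → κ (m ℕ.* n) *ᴷ ((x ^ᴷ i *ᴷ y ^ᴷ j) *ᴷ (x +ᴷ y) ^ᴷ k) ∈ℤ[√d]
        ∈-sums zero    i j = subst _∈ℤ[√d] (cong (κ (m ℕ.* n) *ᴷ_) (sym (*ᴷ-identityʳ (x ^ᴷ i *ᴷ y ^ᴷ j))))
          (∈-products i j)
        ∈-sums (suc k) i j = subst _∈ℤ[√d] (expand (κ (m ℕ.* n)) (x ^ᴷ i) (y ^ᴷ j) x y ((x +ᴷ y) ^ᴷ k))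
          (∈-+ (∈-sums k (suc i) j) (∈-sums k i (suc j)))
          where
          expand : ∀ c X Y x y S → c *ᴷ (((x *ᴷ X) *ᴷ Y) *ᴷ S) +ᴷ c *ᴷ ((X *ᴷ (y *ᴷ Y)) *ᴷ S) ≡ c *ᴷ
            ((X *ᴷ Y) *ᴷ ((x +ᴷ y) *ᴷ S))
          expand = K-Solver.solve 6 (λ c X Y x y S →
            c :* (((x :* X) :* Y) :* S) :+ c :* ((X :* (y :* Y)) :* S) := c :* ((X :* Y) :* ((x :+ y) :* S))) refl

      boundedPowers-* : BoundedPowers (x *ᴷ y)
      boundedPowers-* = m ℕ.* n , mn≢0 , λ j → subst _∈ℤ[√d] (cong (κ (m ℕ.* n) *ᴷ_) (sym (^ᴷ-distribʳ-* x y j)))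
        (∈-products j j)

      boundedPowers-+ : BoundedPowers (x +ᴷ y)
      boundedPowers-+ = m ℕ.* n , mn≢0 , λ k → subst _∈ℤ[√d] (cong (κ (m ℕ.* n) *ᴷ_) (unit ((x +ᴷ y) ^ᴷ k)))
        (∈-sums k 0 0)
        where
        unit : ∀ S → (1ᴷ *ᴷ 1ᴷ) *ᴷ S ≡ S
        unit = K-Solver.solve 1 (λ S → (con 1 :* con 1) :* S := S) refl

    fromℚ-^ : ∀ r j → fromℚ r ^ᴷ j ≡ fromℚ (r ^ j)
    fromℚ-^ r zero    = refl
    fromℚ-^ r (suc j) = trans (cong (fromℚ r *ᴷ_) (fromℚ-^ r j)) (fromℚ-* r (r ^ j))

    boundedPowers⇒integer : ∀ {r} → BoundedPowers (fromℚ r) → IsInteger r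
    boundedPowers⇒integer {r} (n , n≢0 , nr∈) = bounded-powers⇒integer r n n≢0 λ j →
      subst IsInteger (cong re (trans (cong (κ n *ᴷ_) (fromℚ-^ r j)) (fromℚ-* ⟦ + n ⟧ (r ^ j)))) (proj₁ (nr∈ j))

    -- `x` and `conj x` have bounded powers, hence so has their sum, and a rational number with
    -- bounded powers is an integer.
    integral⇒integer-trace : ∀ {x} → Integral x → IsInteger (re x + re x)
    integral⇒integer-trace {x} int = boundedPowers⇒integer
      (subst BoundedPowers (cong₂ _+√d_ refl (ℚ.+-inverseʳ (im x)))
      (boundedPowers-+ bx (boundedPowers-conj bx)))
      where bx = integral⇒boundedPowers int

    integral⇒integer-norm : ∀ {x} → Integral x → IsInteger (N x)
    integral⇒integer-norm {x} int = boundedPowers⇒integer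
      (subst BoundedPowers (x*conj-x≡N x) (boundedPowers-* bx (boundedPowers-conj bx)))
      where bx = integral⇒boundedPowers int

  -- The ring of integers in coordinates.

  squareFree⇒↧≡1 : ∀ {d m a b} .{{_ : ℕ.NonZero b}} → SquareFree d → Coprime b a → d ℕ.* (a ℕ.* a) ≡ m ℕ.* b ℕ.* b →
    b ≡ 1
  squareFree⇒↧≡1 {d} {m} {a} {b} sqf b⊥a eq = helper b∣d
    where
    -- `b` divides `d a²` and is coprime to `a`.
    b∣d : b ℕᵈ.∣ d
    b∣d = coprime-divisor b⊥a (coprime-divisor b⊥a (ℕᵈ.divides (m ℕ.* b) (trans (swap a d) eq)))
      where
      swap : ∀ a d → a ℕ.* (a ℕ.* d) ≡ d ℕ.* (a ℕ.* a)
      swap = ℕ-Solver.solve-∀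
    helper : b ℕᵈ.∣ d → b ≡ 1
    -- Cancelling `b` from the equation leaves `d′ a² = m b`, so `b` divides `d′` as well, and `b²`
    -- divides `d`.
    helper (ℕᵈ.divides d′ d≡d′b) = sqf b (subst (b ℕ.* b ℕᵈ.∣_) (sym d≡d′b)
      (ℕᵈ.*-monoˡ-∣ b (coprime-divisor b⊥a (coprime-divisor b⊥a (ℕᵈ.divides m (ℕₚ.*-cancelʳ-≡ _ _ b
        (trans (swap a d′ b) (trans (cong (ℕ._* (a ℕ.* a)) (sym d≡d′b)) eq))))))))
      where
      swap : ∀ a d b → a ℕ.* (a ℕ.* d) ℕ.* b ≡ d ℕ.* b ℕ.* (a ℕ.* a)
      swap = ℕ-Solver.solve-∀

  squareFree⇒integer : ∀ {d} → SquareFree d → ∀ q → IsInteger (⟦ + d ⟧ * (q * q)) → IsInteger q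
  squareFree⇒integer {d} sqf q (M , eq) = ↧≡1⇒integer q (squareFree⇒↧≡1 {d} {ℤ.∣ M ∣} sqf (coprime q) (begin
    d ℕ.* (ℤ.∣ a ∣ ℕ.* ℤ.∣ a ∣)  ≡⟨ cong (d ℕ.*_) (ℤₚ.abs-* a a) ⟨
    d ℕ.* ℤ.∣ a ℤ.* a ∣          ≡⟨ ℤₚ.abs-* (+ d) (a ℤ.* a) ⟨
    ℤ.∣ + d ℤ.* (a ℤ.* a) ∣      ≡⟨ cong ℤ.∣_∣ cleared ⟩
    ℤ.∣ M ℤ.* b ℤ.* b ∣          ≡⟨ trans (ℤₚ.abs-* (M ℤ.* b) b) (cong (ℕ._* ↧ₙ q) (ℤₚ.abs-* M b)) ⟩
    ℤ.∣ M ∣ ℕ.* ↧ₙ q ℕ.* ↧ₙ q    ∎))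
    where
    open ≡-Reasoning
    a = ↥ q
    b = ↧ q
    shift : ∀ d q b → d * ((b * q) * (b * q)) ≡ d * (q * q) * b * b
    shift = solve-∀ ℚ-ring
    cleared : + d ℤ.* (a ℤ.* a) ≡ M ℤ.* b ℤ.* b
    cleared = ⟦⟧-injective (begin
      ⟦ + d ℤ.* (a ℤ.* a) ⟧                  ≡⟨ _⊠_ {i = + d} refl
        (_⊠_ {i = a} {j = a} (sym (↧*p≡↥ q)) (sym (↧*p≡↥ q))) ⟩
      ⟦ + d ⟧ * ((⟦ b ⟧ * q) * (⟦ b ⟧ * q))  ≡⟨ shift ⟦ + d ⟧ q ⟦ b ⟧ ⟩
      ⟦ + d ⟧ * (q * q) * ⟦ b ⟧ * ⟦ b ⟧      ≡⟨ eq ⊠ refl ⊠ refl ⟨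
      ⟦ M ℤ.* b ℤ.* b ⟧                      ∎)

  -- 1 and ω = (t + h √d) / 2 form an integral basis, and ω² = t ω + n; by complete, every (T + B √d) / 2
  -- with an integral norm is an integral combination of them.
  record IntegralBasis (d : ℕ) : Set where
    field
      t h n : ℤ
      t,h : (t ≡ 0ℤ × h ≡ + 2) ⊎ (t ≡ 1ℤ × h ≡ 1ℤ)
      h²d≡t²+4n : h ℤ.* h ℤ.* + d ≡ t ℤ.* t ℤ.+ + 4 ℤ.* n
      0<n : 0ℤ ℤ.< n
      complete : ∀ T B M → T ℤ.* T ℤ.- + d ℤ.* (B ℤ.* B) ≡ + 4 ℤ.* M → ∃₂ λ A C →
        T ≡ + 2 ℤ.* A ℤ.+ t ℤ.* C × B ≡ h ℤ.* C

  -- The norm of `A + B ω`, kept as a polynomial in `t` and `n` so that it can be stated without a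
  -- chosen basis.
  normForm : ℤ → ℤ → ℤ → ℤ → ℤ
  normForm t n A B = A ℤ.* A ℤ.+ t ℤ.* (A ℤ.* B) ℤ.- n ℤ.* (B ℤ.* B)

  module Order {d : ℕ} (squareFree : SquareFree d) (basis : IntegralBasis d) where
    open Field d public
    open IntegralBasis basis public

    -- `A + B ω` in the coordinates 1, √d.
    ι : ℤ → ℤ → K
    ι A B = (⟦ A ⟧ + ⟦ B ⟧ * (½ * ⟦ t ⟧)) +√d (⟦ B ⟧ * (½ * ⟦ h ⟧))

    ω : K
    ω = (½ * ⟦ t ⟧) +√d (½ * ⟦ h ⟧)

    dh²≡t²+4n : dℚ * (⟦ h ⟧ * ⟦ h ⟧) ≡ ⟦ t ⟧ * ⟦ t ⟧ + 4ℚ * ⟦ n ⟧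
    dh²≡t²+4n = begin
      dℚ * (⟦ h ⟧ * ⟦ h ⟧)          ≡⟨ cong (_* (⟦ h ⟧ * ⟦ h ⟧)) dℚ≡D ⟩
      D * (⟦ h ⟧ * ⟦ h ⟧)           ≡⟨ ℚ.*-comm D (⟦ h ⟧ * ⟦ h ⟧) ⟩
      ⟦ h ⟧ * ⟦ h ⟧ * D             ≡⟨ _⊠_ {i = h ℤ.* h} (_⊠_ {i = h} {j = h} refl refl) refl ⟨
      ⟦ h ℤ.* h ℤ.* + d ⟧           ≡⟨ cong ⟦_⟧ h²d≡t²+4n ⟩
      ⟦ t ℤ.* t ℤ.+ + 4 ℤ.* n ⟧     ≡⟨ _⊹_ {i = t ℤ.* t} (_⊠_ {i = t} {j = t} refl refl)
        (_⊠_ {i = + 4} {j = n} ⟦4⟧ refl) ⟩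
      ⟦ t ⟧ * ⟦ t ⟧ + 4ℚ * ⟦ n ⟧    ∎
      where open ≡-Reasoning

    ι-* : ∀ A B C E → ι A B *ᴷ ι C E ≡ ι (A ℤ.* C ℤ.+ n ℤ.* (B ℤ.* E)) (A ℤ.* E ℤ.+ B ℤ.* C ℤ.+ t ℤ.* (B ℤ.* E))
    ι-* A B C E = cong₂ _+√d_
      (begin
        re (ι A B *ᴷ ι C E)
          ≡⟨ eq₁ dℚ ⟦ t ⟧ ⟦ h ⟧ ⟦ A ⟧ ⟦ B ⟧ ⟦ C ⟧ ⟦ E ⟧ ⟩
        f (dℚ * (⟦ h ⟧ * ⟦ h ⟧))
          ≡⟨ cong f dh²≡t²+4n ⟩
        f (⟦ t ⟧ * ⟦ t ⟧ + 4ℚ * ⟦ n ⟧)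
          ≡⟨ eq₂ ⟦ t ⟧ ⟦ n ⟧ ⟦ A ⟧ ⟦ B ⟧ ⟦ C ⟧ ⟦ E ⟧ ⟩
        (⟦ A ⟧ * ⟦ C ⟧ + ⟦ n ⟧ * (⟦ B ⟧ * ⟦ E ⟧)) + (⟦ A ⟧ * ⟦ E ⟧ + ⟦ B ⟧ * ⟦ C ⟧ + ⟦ t ⟧ * (⟦ B ⟧ * ⟦ E ⟧)) *
          (½ * ⟦ t ⟧)
          ≡⟨ cong₂ (λ x y → x + y * (½ * ⟦ t ⟧)) cast₁ cast₂ ⟨
        _ ∎)
      (trans (eq₃ ⟦ t ⟧ ⟦ h ⟧ ⟦ A ⟧ ⟦ B ⟧ ⟦ C ⟧ ⟦ E ⟧) (cong (_* (½ * ⟦ h ⟧)) (sym cast₂)))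
      where
      open ≡-Reasoning
      f : ℚ → ℚ
      f x = ⟦ A ⟧ * ⟦ C ⟧ + (⟦ A ⟧ * ⟦ E ⟧ + ⟦ B ⟧ * ⟦ C ⟧) * (½ * ⟦ t ⟧) + ½ * ½ * ⟦ B ⟧ * ⟦ E ⟧ *
        (⟦ t ⟧ * ⟦ t ⟧ + x)
      eq₁ : ∀ D t h A B C E → (A + B * (½ * t)) * (C + E * (½ * t)) + D * ((B * (½ * h)) * (E * (½ * h)))
                            ≡ A * C + (A * E + B * C) * (½ * t) + ½ * ½ * B * E * (t * t + D * (h * h))
      eq₁ = solve-∀ ℚ-ring
      eq₂ : ∀ t n A B C E → A * C + (A * E + B * C) * (½ * t) + ½ * ½ * B * E * (t * t + (t * t + 4ℚ * n))
                          ≡ (A * C + n * (B * E)) + (A * E + B * C + t * (B * E)) * (½ * t)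
      eq₂ = solve-∀ ℚ-ring
      eq₃ : ∀ t h A B C E → (A + B * (½ * t)) * (E * (½ * h)) + (B * (½ * h)) * (C + E * (½ * t))
                          ≡ (A * E + B * C + t * (B * E)) * (½ * h)
      eq₃ = solve-∀ ℚ-ring
      cast₁ : ⟦ A ℤ.* C ℤ.+ n ℤ.* (B ℤ.* E) ⟧ ≡ ⟦ A ⟧ * ⟦ C ⟧ + ⟦ n ⟧ * (⟦ B ⟧ * ⟦ E ⟧)
      cast₁ = _⊹_ {i = A ℤ.* C} (⟦⟧-* A C) (_⊠_ {i = n} refl (⟦⟧-* B E))
      cast₂ : ⟦ A ℤ.* E ℤ.+ B ℤ.* C ℤ.+ t ℤ.* (B ℤ.* E) ⟧ ≡ ⟦ A ⟧ * ⟦ E ⟧ + ⟦ B ⟧ * ⟦ C ⟧ + ⟦ t ⟧ * (⟦ B ⟧ * ⟦ E ⟧)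
      cast₂ = _⊹_ {i = A ℤ.* E ℤ.+ B ℤ.* C} (_⊹_ {i = A ℤ.* E} (⟦⟧-* A E) (⟦⟧-* B C)) (_⊠_ {i = t} refl (⟦⟧-* B E))

    ι-conj : ∀ A B → conj (ι A B) ≡ ι (A ℤ.+ B ℤ.* t) (ℤ.- B)
    ι-conj A B = cong₂ _+√d_
      (trans (eq₁ ⟦ t ⟧ ⟦ A ⟧ ⟦ B ⟧) (cong₂ (λ x y → x + y * (½ * ⟦ t ⟧)) (sym (_⊹_ {i = A} refl (⟦⟧-* B t)))
        (sym (⟦⟧-neg B))))
      (trans (eq₂ ⟦ h ⟧ ⟦ B ⟧) (cong (_* (½ * ⟦ h ⟧)) (sym (⟦⟧-neg B))))
      where
      eq₁ : ∀ t A B → A + B * (½ * t) ≡ (A + B * t) + (- B) * (½ * t)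
      eq₁ = solve-∀ ℚ-ring
      eq₂ : ∀ h B → - (B * (½ * h)) ≡ (- B) * (½ * h)
      eq₂ = solve-∀ ℚ-ring

    ι-A0 : ∀ A → ι A 0ℤ ≡ fromℚ ⟦ A ⟧
    ι-A0 A = cong₂ _+√d_ (trans (cong (λ x → ⟦ A ⟧ + x * (½ * ⟦ t ⟧)) ⟦0⟧) (eq ⟦ A ⟧ (½ * ⟦ t ⟧)))
      (trans (cong (_* (½ * ⟦ h ⟧)) ⟦0⟧) (ℚ.*-zeroˡ (½ * ⟦ h ⟧)))
      where
      eq : ∀ A x → A + 0ℚ * x ≡ A
      eq = solve-∀ ℚ-ring

    ι-1 : ι 1ℤ 0ℤ ≡ 1ᴷ
    ι-1 = trans (ι-A0 1ℤ) (cong fromℚ ⟦1⟧)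

    norm : ℤ → ℤ → ℤ
    norm = normForm t n

    N-ι : ∀ A B → N (ι A B) ≡ ⟦ norm A B ⟧
    N-ι A B = cong re (begin
      fromℚ (N (ι A B))                      ≡⟨ x*conj-x≡N (ι A B) ⟨
      ι A B *ᴷ conj (ι A B)                  ≡⟨ cong (ι A B *ᴷ_) (ι-conj A B) ⟩
      ι A B *ᴷ ι (A ℤ.+ B ℤ.* t) (ℤ.- B)     ≡⟨ ι-* A B (A ℤ.+ B ℤ.* t) (ℤ.- B) ⟩
      _                                      ≡⟨ cong₂ ι (eq₁ t n A B) (eq₂ t A B) ⟩
      ι (norm A B) 0ℤ                        ≡⟨ ι-A0 (norm A B) ⟩
      fromℚ ⟦ norm A B ⟧                     ∎)
      where
      open ≡-Reasoning
      eq₁ : ∀ t n A B → A ℤ.* (A ℤ.+ B ℤ.* t) ℤ.+ n ℤ.* (B ℤ.* (ℤ.- B)) ≡ A ℤ.* A ℤ.+ t ℤ.* (A ℤ.* B) ℤ.- n ℤ.*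
        (B ℤ.* B)
      eq₁ = ℤ-Solver.solve-∀
      eq₂ : ∀ t A B → A ℤ.* (ℤ.- B) ℤ.+ B ℤ.* (A ℤ.+ B ℤ.* t) ℤ.+ t ℤ.* (B ℤ.* (ℤ.- B)) ≡ 0ℤ
      eq₂ = ℤ-Solver.solve-∀

    integral : ∀ A B → Integral (ι A B)
    -- The coefficients of the characteristic polynomial; it vanishes because `x - T = - conj x`.
    integral A B = norm A B ∷ ℤ.- T ∷ [] , (begin
      fromℚ (fromℤ (norm A B)) +ᴷ x *ᴷ (fromℚ (fromℤ (ℤ.- T)) +ᴷ x *ᴷ 1ᴷ)
        ≡⟨ cong₂ (λ p q → fromℚ p +ᴷ x *ᴷ (fromℚ q +ᴷ x *ᴷ 1ᴷ)) (trans (sym (⟦⟧≡fromℤ (norm A B))) (sym (N-ι A B)))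
          (trans (sym (⟦⟧≡fromℤ (ℤ.- T))) (⟦⟧-neg T)) ⟩
      fromℚ (N x) +ᴷ x *ᴷ (fromℚ (- ⟦ T ⟧) +ᴷ x *ᴷ 1ᴷ)
        ≡⟨ cong₂ (λ p q → p +ᴷ x *ᴷ q) (sym (x*conj-x≡N x))
          (trans (cong (fromℚ (- ⟦ T ⟧) +ᴷ_) (*ᴷ-identityʳ x)) x-T≡-conj-x) ⟩
      x *ᴷ conj x +ᴷ x *ᴷ -ᴷ conj x
        ≡⟨ distribˡᴷ x (conj x) (-ᴷ conj x) ⟨
      x *ᴷ (conj x +ᴷ -ᴷ conj x)
        ≡⟨ cong (x *ᴷ_) (+ᴷ-inverseʳ (conj x)) ⟩
      x *ᴷ 0ᴷ
        ≡⟨ *ᴷ-zeroʳ x ⟩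
      0ᴷ ∎)
      where
      open ≡-Reasoning
      x = ι A B
      T = (A ℤ.+ A) ℤ.+ B ℤ.* t
      cast : ⟦ T ⟧ ≡ (⟦ A ⟧ + ⟦ A ⟧) + ⟦ B ⟧ * ⟦ t ⟧
      cast = _⊹_ {i = A ℤ.+ A} (⟦⟧-+ A A) (⟦⟧-* B t)
      eq₁ : ∀ t A B → - ((A + A) + B * t) + (A + B * (½ * t)) ≡ - (A + B * (½ * t))
      eq₁ = solve-∀ ℚ-ring
      eq₂ : ∀ p → 0ℚ + p ≡ - (- p)
      eq₂ = solve-∀ ℚ-ring
      x-T≡-conj-x : fromℚ (- ⟦ T ⟧) +ᴷ x ≡ -ᴷ conj x
      x-T≡-conj-x = cong₂ _+√d_ (trans (cong (λ p → - p + re x) cast) (eq₁ ⟦ t ⟧ ⟦ A ⟧ ⟦ B ⟧)) (eq₂ (im x))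

    module _ {x : K} where

      -- `d (2 im x)² = (2 re x)² - 4 N x` is an integer, and a square-free `d` cannot absorb a
      -- denominator of `2 im x`.
      integer-2im : IsInteger (re x + re x) → IsInteger (N x) → IsInteger (im x + im x)
      integer-2im (T , T≡) (M , M≡) = squareFree⇒integer squareFree (im x + im x) (T ℤ.* T ℤ.- + 4 ℤ.* M ,
        trans (_⊟_ {i = T ℤ.* T} (_⊠_ {i = T} {j = T} T≡ T≡) (_⊠_ {i = + 4} {j = M} ⟦4⟧ M≡))
          (trans (eq dℚ (re x) (im x)) (cong (_* ((im x + im x) * (im x + im x))) dℚ≡D)))
        where
        eq : ∀ D a b → (a + a) * (a + a) - 4ℚ * (a * a - D * (b * b)) ≡ D * ((b + b) * (b + b))
        eq = solve-∀ ℚ-ring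

      coordinates-congruence : ∀ T M B → ⟦ T ⟧ ≡ re x + re x → ⟦ M ⟧ ≡ N x → ⟦ B ⟧ ≡ im x + im x →
                               T ℤ.* T ℤ.- + d ℤ.* (B ℤ.* B) ≡ + 4 ℤ.* M
      coordinates-congruence T M B T≡ M≡ B≡ = ⟦⟧-injective (
        trans (_⊟_ {i = T ℤ.* T} (_⊠_ {i = T} {j = T} T≡ T≡)
          (_⊠_ {i = + d} {j = B ℤ.* B} (sym dℚ≡D) (_⊠_ {i = B} {j = B} B≡ B≡)))
          (trans (eq dℚ (re x) (im x)) (sym (_⊠_ {i = + 4} {j = M} ⟦4⟧ M≡))))
        where
        eq : ∀ D a b → (a + a) * (a + a) - D * ((b + b) * (b + b)) ≡ 4ℚ * (a * a - D * (b * b))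
        eq = solve-∀ ℚ-ring

      coordinates′ : IsInteger (re x + re x) → IsInteger (N x) → IsInteger (im x + im x) → ∃₂ λ A B → x ≡ ι A B
      coordinates′ (T , T≡) (M , M≡) (B , B≡) = halve (complete T B M (coordinates-congruence T M B T≡ M≡ B≡))
        where
        half : ∀ p → p ≡ ½ * (p + p)
        half = solve-∀ ℚ-ring
        eq₁ : ∀ A t C → ½ * (2ℚ * A + t * C) ≡ A + C * (½ * t)
        eq₁ = solve-∀ ℚ-ring
        eq₂ : ∀ h C → ½ * (h * C) ≡ C * (½ * h)
        eq₂ = solve-∀ ℚ-ring
        halve : (∃₂ λ A C → T ≡ + 2 ℤ.* A ℤ.+ t ℤ.* C × B ≡ h ℤ.* C) → ∃₂ λ A C → x ≡ ι A C
        halve (A , C , T≡′ , B≡′) = A , C , cong₂ _+√d_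
          (begin
            re x                               ≡⟨ half (re x) ⟩
            ½ * (re x + re x)                  ≡⟨ cong (½ *_) T≡ ⟨
            ½ * ⟦ T ⟧                          ≡⟨ cong (λ i → ½ * ⟦ i ⟧) T≡′ ⟩
            ½ * ⟦ + 2 ℤ.* A ℤ.+ t ℤ.* C ⟧      ≡⟨ cong (½ *_)
              (_⊹_ {i = + 2 ℤ.* A} (_⊠_ {i = + 2} {j = A} ⟦2⟧ refl) (⟦⟧-* t C)) ⟩
            ½ * (2ℚ * ⟦ A ⟧ + ⟦ t ⟧ * ⟦ C ⟧)   ≡⟨ eq₁ ⟦ A ⟧ ⟦ t ⟧ ⟦ C ⟧ ⟩
            ⟦ A ⟧ + ⟦ C ⟧ * (½ * ⟦ t ⟧)        ∎)
          (begin
            im x                               ≡⟨ half (im x) ⟩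
            ½ * (im x + im x)                  ≡⟨ cong (½ *_) B≡ ⟨
            ½ * ⟦ B ⟧                          ≡⟨ cong (λ i → ½ * ⟦ i ⟧) B≡′ ⟩
            ½ * ⟦ h ℤ.* C ⟧                    ≡⟨ cong (½ *_) (⟦⟧-* h C) ⟩
            ½ * (⟦ h ⟧ * ⟦ C ⟧)                ≡⟨ eq₂ ⟦ h ⟧ ⟦ C ⟧ ⟩
            ⟦ C ⟧ * (½ * ⟦ h ⟧)                ∎)
          where open ≡-Reasoning

      coordinates : Integral x → ∃₂ λ A B → x ≡ ι A B
      coordinates int = coordinates′ (integral⇒integer-trace int) (integral⇒integer-norm int)
        (integer-2im (integral⇒integer-trace int) (integral⇒integer-norm int))

    -- Products are formed in coordinates, where no monic polynomials have to be combined.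
    integral-* : ∀ {x y} → Integral x → Integral y → Integral (x *ᴷ y)
    integral-* ix iy =
      let A , B , x≡ = coordinates ix
          C , E , y≡ = coordinates iy
      in subst Integral (sym (trans (cong₂ _*ᴷ_ x≡ y≡) (ι-* A B C E))) (integral _ _)

    integral-1 : Integral 1ᴷ
    integral-1 = subst Integral ι-1 (integral 1ℤ 0ℤ)

    integral-conj : ∀ {x} → Integral x → Integral (conj x)
    integral-conj ix =
      let A , B , x≡ = coordinates ix
      in subst Integral (sym (trans (cong conj x≡) (ι-conj A B))) (integral _ _)

    unit-1 : IsUnit 1ᴷ
    unit-1 = integral-1 , 1ᴷ , integral-1 , *ᴷ-identityˡ 1ᴷ

    unit-* : ∀ {u v} → IsUnit u → IsUnit v → IsUnit (u *ᴷ v)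
    unit-* {u} {v} (iu , u⁻¹ , iu⁻¹ , uu⁻¹≡1) (iv , v⁻¹ , iv⁻¹ , vv⁻¹≡1) =
      integral-* iu iv , u⁻¹ *ᴷ v⁻¹ , integral-* iu⁻¹ iv⁻¹ ,
      trans (interchange u v u⁻¹ v⁻¹) (trans (cong₂ _*ᴷ_ uu⁻¹≡1 vv⁻¹≡1) (*ᴷ-identityˡ 1ᴷ))
      where
      interchange : ∀ x y X Y → (x *ᴷ y) *ᴷ (X *ᴷ Y) ≡ (x *ᴷ X) *ᴷ (y *ᴷ Y)
      interchange = K-Solver.solve 4 (λ x y X Y → (x K-Solver.:* y) K-Solver.:* (X K-Solver.:* Y) K-Solver.:=
        (x K-Solver.:* X) K-Solver.:* (y K-Solver.:* Y)) refl

    integral-norm : ∀ {x} → Integral x → ∃ λ z → ⟦ z ⟧ ≡ N x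
    integral-norm ix = let A , B , x≡ = coordinates ix in norm A B , sym (trans (cong N x≡) (N-ι A B))

    N-1 : N 1ᴷ ≡ 1ℚ
    N-1 = trans (cong N (sym ι-1)) (trans (N-ι 1ℤ 0ℤ) (trans (cong ⟦_⟧ (eq t n)) ⟦1⟧))
      where
      eq : ∀ t n → 1ℤ ℤ.* 1ℤ ℤ.+ t ℤ.* (1ℤ ℤ.* 0ℤ) ℤ.- n ℤ.* (0ℤ ℤ.* 0ℤ) ≡ 1ℤ
      eq = ℤ-Solver.solve-∀

    unit⇒norm≡±1 : ∀ A B → IsUnit (ι A B) → norm A B ≡ 1ℤ ⊎ norm A B ≡ ℤ.- 1ℤ
    unit⇒norm≡±1 A B (_ , v , iv , uv≡1) =
      let z , z≡Nv = integral-norm iv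
          Nu*Nv≡1 = trans (sym (N-* (ι A B) v)) (trans (cong N uv≡1) N-1)
          Nu*z≡1 = ⟦⟧-injective (trans (_⊠_ {i = norm A B} {j = z} (sym (N-ι A B)) z≡Nv) (trans Nu*Nv≡1 (sym ⟦1⟧)))
      in ∣i∣≡1 (ℕₚ.m*n≡1⇒m≡1 ℤ.∣ norm A B ∣ ℤ.∣ z ∣ (trans (sym (ℤₚ.abs-* (norm A B) z)) (cong ℤ.∣_∣ Nu*z≡1)))
      where
      ∣i∣≡1 : ∀ {i} → ℤ.∣ i ∣ ≡ 1 → i ≡ 1ℤ ⊎ i ≡ ℤ.- 1ℤ
      ∣i∣≡1 {+ _}      refl = inj₁ refl
      ∣i∣≡1 { -[1+ _ ]} refl = inj₂ refl

    -- For the norm `e = ±1` one has `x (e · conj x) = e² = 1`.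
    norm≡±1⇒unit : ∀ A B → norm A B ℤ.* norm A B ≡ 1ℤ → IsUnit (ι A B)
    norm≡±1⇒unit A B e²≡1 = integral A B , ι e 0ℤ *ᴷ conj x ,
      integral-* (integral e 0ℤ) (integral-conj (integral A B)) , (begin
      x *ᴷ (ι e 0ℤ *ᴷ conj x)        ≡⟨ swap x (ι e 0ℤ) (conj x) ⟩
      ι e 0ℤ *ᴷ (x *ᴷ conj x)        ≡⟨ cong₂ _*ᴷ_ (ι-A0 e) (trans (x*conj-x≡N x) (cong fromℚ (N-ι A B))) ⟩
      fromℚ ⟦ e ⟧ *ᴷ fromℚ ⟦ e ⟧     ≡⟨ fromℚ-* ⟦ e ⟧ ⟦ e ⟧ ⟩
      fromℚ (⟦ e ⟧ * ⟦ e ⟧)          ≡⟨ cong fromℚ (⟦⟧-* e e) ⟨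
      fromℚ ⟦ e ℤ.* e ⟧              ≡⟨ cong fromℚ (trans (cong ⟦_⟧ e²≡1) ⟦1⟧) ⟩
      1ᴷ                             ∎)
      where
      open ≡-Reasoning
      x = ι A B
      e = norm A B
      swap : ∀ x y z → x *ᴷ (y *ᴷ z) ≡ y *ᴷ (x *ᴷ z)
      swap = K-Solver.solve 3 (λ x y z → x K-Solver.:* (y K-Solver.:* z) K-Solver.:= y K-Solver.:* (x K-Solver.:* z))
        refl

  -- Total positivity as positivity of real part and norm.

  0<½ : 0ℚ < ½
  0<½ = ℚ.positive⁻¹ ½

  0<1 : 0ℚ < 1ℚ
  0<1 = ℚ.positive⁻¹ 1ℚ

  module Positivity {d : ℕ} (0<d : 0 ℕ.< d) where
    open Field d

    0<dℚ : 0ℚ < dℚ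
    0<dℚ = subst₂ _<_ ⟦0⟧ (sym dℚ≡D) (⟦⟧-mono-< (ℤ.+<+ 0<d))

    -- `a² - d b² = (a - b u)(a + b u) + b² (u² - d)`.
    0<N-from-bound : ∀ {a b u} → 0ℚ ≤ b → √d< u → 0ℚ < a - b * u → 0ℚ < a × 0ℚ < a * a - dℚ * (b * b)
    0<N-from-bound {a} {b} {u} 0≤b (0<u , d<u²) 0<a-bu = 0<a , subst (0ℚ <_) (eq₂ dℚ a b u)
        (0<p+q′ (0<p*q 0<a-bu (0<p+q′ 0<a 0≤bu)) (0≤p*q (0≤p² b) (ℚ.<⇒≤ (p<q⇒0<q-p d<u²))))
      where
      0≤bu = 0≤p*q 0≤b (ℚ.<⇒≤ 0<u)
      eq₁ : ∀ a b u → a - b * u + b * u ≡ a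
      eq₁ = solve-∀ ℚ-ring
      eq₂ : ∀ D a b u → (a - b * u) * (a + b * u) + b * b * (u * u - D) ≡ a * a - D * (b * b)
      eq₂ = solve-∀ ℚ-ring
      0<a = subst (0ℚ <_) (eq₁ a b u) (0<p+q′ 0<a-bu 0≤bu)

    -- Only the smaller conjugate matters: `conj x` if `im x ≥ 0`, otherwise `x`. It is positive
    -- even with √d replaced by an upper approximation `u`.
    totallyPositive⇒ : ∀ {x} → TotallyPositive x → 0ℚ < re x × 0ℚ < N x
    totallyPositive⇒ {x} ((_ , u , _ , √d<u , _ , 0<x) , (_ , u′ , _ , √d<u′ , _ , 0<conj-x)) =
      cases (ℚ.≤-total 0ℚ (im x))
      where
      eq₁ : ∀ a b u → a + (- b) * u ≡ a - b * u
      eq₁ = solve-∀ ℚ-ring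
      eq₂ : ∀ a b u → a + b * u ≡ a - (- b) * u
      eq₂ = solve-∀ ℚ-ring
      cases : 0ℚ ≤ im x ⊎ im x ≤ 0ℚ → 0ℚ < re x × 0ℚ < N x
      cases (inj₁ 0≤im) = 0<N-from-bound 0≤im √d<u′ (subst (0ℚ <_) (eq₁ (re x) (im x) u′) 0<conj-x)
      cases (inj₂ im≤0) =
        let 0<re , 0<N = 0<N-from-bound (ℚ.neg-antimono-≤ im≤0) √d<u (subst (0ℚ <_) (eq₂ (re x) (im x) u) 0<x)
        in 0<re , subst (0ℚ <_) (N-conj x) 0<N

    -- When im x < 0, the number u is the mean of ρ = re x / (- im x) and d / ρ, hence √d < u < ρ.
    0<N⇒positive : ∀ {x} → 0ℚ < re x → 0ℚ < N x → Positive x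
    0<N⇒positive {x} 0<re 0<N = cases (0ℚ ℚ.≤? im x)
      where
      a = re x
      b = im x
      eq₀ : ∀ a b → a ≡ a + b * 0ℚ
      eq₀ = solve-∀ ℚ-ring
      0<√d : 0ℚ <√d
      0<√d = inj₂ (subst (_< dℚ) (sym (ℚ.*-zeroˡ 0ℚ)) 0<dℚ)
      cases : Dec (0ℚ ≤ b) → Positive x
      -- At `l = 0` the value is `re x`; for `im x ≥ 0` any upper bound of √d serves as `u`, for
      -- instance `d + 1`.
      cases (yes 0≤b) = 0ℚ , dℚ + 1ℚ , 0<√d , (0<d+1 , <-by (0<p+q (0<p+q′ 0<dℚ (0≤p² dℚ)) 0<1) (eq₁ dℚ)) ,
        subst (0ℚ <_) (eq₀ a b) 0<re , 0<p+q′ 0<re (0≤p*q 0≤b (ℚ.<⇒≤ 0<d+1))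
        where
        0<d+1 = 0<p+q 0<dℚ 0<1
        eq₁ : ∀ D → (D + 1ℚ) * (D + 1ℚ) - D ≡ D + D * D + 1ℚ
        eq₁ = solve-∀ ℚ-ring
      cases (no 0≰b) = 0ℚ , u , 0<√d , (0<u , 0<q-p⇒p<q 0<u²-d) , subst (0ℚ <_) (eq₀ a b) 0<re ,
        subst (0ℚ <_) (cong (_+ b * u) (trans (eq₉ ρ b) ρ-b≡a)) 0<a+bu
        where
        eq₉ : ∀ ρ b → - (ρ * b) ≡ ρ * (- b)
        eq₉ = solve-∀ ℚ-ring
        0<-b = ℚ.neg-antimono-< (ℚ.≰⇒> 0≰b)
        ρ = proj₁ (quotient a (0<⇒≢0 0<-b))
        ρ-b≡a : ρ * (- b) ≡ a
        ρ-b≡a = proj₂ (quotient a (0<⇒≢0 0<-b))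
        0<ρ : 0ℚ < ρ
        0<ρ = 0<p*q⇒0<q (ℚ.<⇒≤ 0<-b) (subst (0ℚ <_) (trans (sym ρ-b≡a) (ℚ.*-comm ρ (- b))) 0<re)
        eq₂ : ∀ D ρ b → (ρ * (- b)) * (ρ * (- b)) - D * (b * b) ≡ b * b * (ρ * ρ - D)
        eq₂ = solve-∀ ℚ-ring
        0<ρ²-d : 0ℚ < ρ * ρ - dℚ
        0<ρ²-d = 0<p*q⇒0<q (0≤p² b) (subst (0ℚ <_)
          (trans (cong (λ a → a * a - dℚ * (b * b)) (sym ρ-b≡a)) (eq₂ dℚ ρ b)) 0<N)
        u = proj₁ (quotient (½ * (ρ * ρ + dℚ)) (0<⇒≢0 0<ρ))
        uρ≡ : u * ρ ≡ ½ * (ρ * ρ + dℚ)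
        uρ≡ = proj₂ (quotient (½ * (ρ * ρ + dℚ)) (0<⇒≢0 0<ρ))
        0<u : 0ℚ < u
        0<u = 0<p*q⇒0<q (ℚ.<⇒≤ 0<ρ) (subst (0ℚ <_) (trans (sym uρ≡) (ℚ.*-comm u ρ))
          (0<p*q 0<½ (0<p+q (0<p*q 0<ρ 0<ρ) 0<dℚ)))
        eq₃ : ∀ D ρ → ½ * (ρ * ρ + D) * (½ * (ρ * ρ + D)) - ρ * ρ * D ≡ ½ * (ρ * ρ - D) * (½ * (ρ * ρ - D))
        eq₃ = solve-∀ ℚ-ring
        eq₄ : ∀ D ρ u → ρ * ρ * (u * u - D) ≡ u * ρ * (u * ρ) - ρ * ρ * D
        eq₄ = solve-∀ ℚ-ring
        0<½[ρ²-d] = 0<p*q 0<½ 0<ρ²-d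
        0<u²-d : 0ℚ < u * u - dℚ
        0<u²-d = 0<p*q⇒0<q (0≤p² ρ) (subst (0ℚ <_)
          (sym (trans (eq₄ dℚ ρ u) (trans (cong (λ w → w * w - ρ * ρ * dℚ) uρ≡) (eq₃ dℚ ρ))))
          (0<p*q 0<½[ρ²-d] 0<½[ρ²-d]))
        eq₅ : ∀ ρ b u → - (ρ * b) + b * u ≡ (- b) * (ρ - u)
        eq₅ = solve-∀ ℚ-ring
        eq₆ : ∀ ρ u → ρ * (ρ - u) ≡ ρ * ρ - u * ρ
        eq₆ = solve-∀ ℚ-ring
        eq₇ : ∀ D ρ → ρ * ρ - ½ * (ρ * ρ + D) ≡ ½ * (ρ * ρ - D)
        eq₇ = solve-∀ ℚ-ring
        0<ρ-u : 0ℚ < ρ - u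
        0<ρ-u = 0<p*q⇒0<q (ℚ.<⇒≤ 0<ρ) (subst (0ℚ <_)
          (sym (trans (eq₆ ρ u) (trans (cong (λ w → ρ * ρ - w) uρ≡) (eq₇ dℚ ρ)))) 0<½[ρ²-d])
        0<a+bu : 0ℚ < - (ρ * b) + b * u
        0<a+bu = subst (0ℚ <_) (sym (eq₅ ρ b u)) (0<p*q 0<-b 0<ρ-u)

    ⇒totallyPositive : ∀ {x} → 0ℚ < re x → 0ℚ < N x → TotallyPositive x
    ⇒totallyPositive {x} 0<re 0<N = 0<N⇒positive {x} 0<re 0<N ,
      0<N⇒positive {conj x} 0<re (subst (0ℚ <_) (sym (N-conj x)) 0<N)

    -- With `x = a + b √d` and `y = p + q √d`, `(a p)² - (d b q)² = N x · p² + d b² · N y >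
    -- 0`, so `a p` dominates the other summand of the real part.
    totallyPositive-* : ∀ {x y} → TotallyPositive x → TotallyPositive y → TotallyPositive (x *ᴷ y)
    totallyPositive-* {x} {y} x≫0 y≫0 = ⇒totallyPositive {x *ᴷ y}
        (p²<q²⇒0<q+p (ℚ.<⇒≤ (0<p*q 0<a 0<p)) (<-by
          (0<p+q′ (0<p*q 0<Nx (0<p*q 0<p 0<p)) (0≤p*q (0≤p*q (ℚ.<⇒≤ 0<dℚ) (0≤p² (im x))) (ℚ.<⇒≤ 0<Ny)))
          (eq dℚ (re x) (im x) (re y) (im y))))
        (subst (0ℚ <_) (sym (N-* x y)) (0<p*q 0<Nx 0<Ny))
      where
      0<a = proj₁ (totallyPositive⇒ {x} x≫0)
      0<p = proj₁ (totallyPositive⇒ {y} y≫0)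
      0<Nx = proj₂ (totallyPositive⇒ {x} x≫0)
      0<Ny = proj₂ (totallyPositive⇒ {y} y≫0)
      eq : ∀ D a b p q → (a * p) * (a * p) - (D * (b * q)) * (D * (b * q)) ≡ (a * a - D * (b * b)) * (p * p) + D *
        (b * b) * (p * p - D * (q * q))
      eq = solve-∀ ℚ-ring

    totallyPositive-square : ∀ {u} → N u ≢ 0ℚ → TotallyPositive (u *ᴷ u)
    totallyPositive-square {u} Nu≢0 = ⇒totallyPositive {u *ᴷ u} (0<p*q⇒0<q 0≤re 0<re²) 0<Nu²
      where
      0<Nu² = subst (0ℚ <_) (sym (N-* u u)) (≢0⇒0<p² Nu≢0)
      0≤re : 0ℚ ≤ re (u *ᴷ u)
      0≤re = 0≤p+q (0≤p² (re u)) (0≤p*q (ℚ.<⇒≤ 0<dℚ) (0≤p² (im u)))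
      eq : ∀ D a b → (a * a - D * (b * b)) + D * (b * b) ≡ a * a
      eq = solve-∀ ℚ-ring
      0<re² : 0ℚ < re (u *ᴷ u) * re (u *ᴷ u)
      0<re² = subst (0ℚ <_) (eq dℚ (re (u *ᴷ u)) (im (u *ᴷ u)))
        (0<p+q′ 0<Nu² (0≤p*q (ℚ.<⇒≤ 0<dℚ) (0≤p² (im (u *ᴷ u)))))

    totallyPositive-conj : ∀ {x} → TotallyPositive x → TotallyPositive (conj x)
    totallyPositive-conj {x} (p , q) = q , subst Positive (sym (conj-involutive x)) p

    totallyPositive-fromℚ* : ∀ {r x} → 0ℚ < r → TotallyPositive x → TotallyPositive (fromℚ r *ᴷ x)
    totallyPositive-fromℚ* {r} {x} 0<r = totallyPositive-* {fromℚ r} {x}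
      (⇒totallyPositive {fromℚ r} 0<r (subst (0ℚ <_) (eq dℚ r) (0<p*q 0<r 0<r)))
      where
      eq : ∀ D r → r * r ≡ r * r - D * (0ℚ * 0ℚ)
      eq = solve-∀ ℚ-ring

  -- Units and conjugation acting on perfect forms.

  module PerfectForms {d : ℕ} (0<d : 0 ℕ.< d) (squareFree : SquareFree d) (basis : IntegralBasis d) where
    open Order squareFree basis public
    open Positivity 0<d public

    N-unit≢0 : ∀ u v → u *ᴷ v ≡ 1ᴷ → N u ≢ 0ℚ
    N-unit≢0 u v uv≡1 Nu≡0 = contradiction (trans (sym N-1)
      (trans (cong N (sym uv≡1)) (trans (N-* u v) (trans (cong (_* N v) Nu≡0) (ℚ.*-zeroˡ (N v)))))) λ ()

    cancel-inverse : ∀ u v x → u *ᴷ v ≡ 1ᴷ → u *ᴷ (v *ᴷ x) ≡ x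
    cancel-inverse u v x uv≡1 = trans (sym (*ᴷ-assoc u v x)) (trans (cong (_*ᴷ x) uv≡1) (*ᴷ-identityˡ x))

    unit*≢0 : ∀ u v {x} → u *ᴷ v ≡ 1ᴷ → x ≢ 0ᴷ → v *ᴷ x ≢ 0ᴷ
    unit*≢0 u v {x} uv≡1 x≢0 vx≡0 = x≢0 (trans (sym (cancel-inverse u v x uv≡1))
      (trans (cong (u *ᴷ_) vx≡0) (*ᴷ-zeroʳ u)))

    -- Multiplication by the inverse `v` carries the minimal vectors of `a` to those of `a u²`, and
    -- `b ↦ b v²` carries a competitor of `a u²` back to a competitor of `a`.
    perfect-* : ∀ {a u} → Perfect a → IsUnit u → Perfect (a *ᴷ (u *ᴷ u))
    perfect-* {a} {u} (a≫0 , m , ((x , ix , x≢0 , ax≡m) , min) , unique) (iu , v , iv , uv≡1) =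
        totallyPositive-* {a} {u *ᴷ u} a≫0 (totallyPositive-square {u} (N-unit≢0 u v uv≡1)) , m ,
        ((v *ᴷ x , integral-* iv ix , unit*≢0 u v uv≡1 x≢0 , trans (value x) ax≡m) ,
         λ y iy y≢0 → subst (m ≤_) (sym (trForm-* a u y)) (min (u *ᴷ y) (integral-* iu iy) (unit*≢0 v u vu≡1 y≢0))) ,
        λ b b≫0 agree → restore b (unique (b *ᴷ (v *ᴷ v))
          (totallyPositive-* {b} {v *ᴷ v} b≫0 (totallyPositive-square {v} (N-unit≢0 v u vu≡1)))
          λ w (iw , aw≡m) → trans (trForm-* b v w) (agree (v *ᴷ w) (integral-* iv iw , trans (value w) aw≡m)))
      where
      vu≡1 = trans (*ᴷ-comm v u) uv≡1
      value : ∀ w → trForm (a *ᴷ (u *ᴷ u)) (v *ᴷ w) ≡ trForm a w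
      value w = trans (trForm-* a u (v *ᴷ w)) (cong (trForm a) (cancel-inverse u v w uv≡1))
      regroup : ∀ b u v → (b *ᴷ (v *ᴷ v)) *ᴷ (u *ᴷ u) ≡ (u *ᴷ v) *ᴷ ((u *ᴷ v) *ᴷ b)
      regroup = K-Solver.solve 3 (λ b u v → (b K-Solver.:* (v K-Solver.:* v)) K-Solver.:* (u K-Solver.:* u)
        K-Solver.:= (u K-Solver.:* v) K-Solver.:* ((u K-Solver.:* v) K-Solver.:* b)) refl
      restore : ∀ b → b *ᴷ (v *ᴷ v) ≡ a → b ≡ a *ᴷ (u *ᴷ u)
      restore b eq = sym (trans (cong (_*ᴷ (u *ᴷ u)) (sym eq)) (trans (regroup b u v)
        (trans (cong (λ w → w *ᴷ (w *ᴷ b)) uv≡1) (trans (*ᴷ-identityˡ (1ᴷ *ᴷ b)) (*ᴷ-identityˡ b)))))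

    trForm-conjˡ : ∀ a x → trForm (conj a) x ≡ trForm a (conj x)
    trForm-conjˡ a x = trans (cong (trForm (conj a)) (sym (conj-involutive x))) (trForm-conj a (conj x))

    conj≢0 : ∀ {x} → x ≢ 0ᴷ → conj x ≢ 0ᴷ
    conj≢0 {x} x≢0 eq = x≢0 (trans (sym (conj-involutive x)) (cong conj eq))

    perfect-conj : ∀ {a} → Perfect a → Perfect (conj a)
    perfect-conj {a} (a≫0 , m , ((x , ix , x≢0 , ax≡m) , min) , unique) =
        totallyPositive-conj {a} a≫0 , m ,
        ((conj x , integral-conj ix , conj≢0 x≢0 , trans (trForm-conj a x) ax≡m) ,
         λ y iy y≢0 → subst (m ≤_) (sym (trForm-conjˡ a y)) (min (conj y) (integral-conj iy) (conj≢0 y≢0))) ,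
        λ b b≫0 agree → trans (sym (conj-involutive b)) (cong conj (unique (conj b) (totallyPositive-conj {b} b≫0)
          λ w (iw , aw≡m) → trans (trForm-conjˡ b w)
            (agree (conj w) (integral-conj iw , trans (trForm-conj a w) aw≡m))))

  -- Minima of reduced binary quadratic forms.

  0≤i*j : 0ℤ ℤ.≤ i → 0ℤ ℤ.≤ j → 0ℤ ℤ.≤ i ℤ.* j
  0≤i*j {i} {j} 0≤i 0≤j = subst (ℤ._≤ i ℤ.* j) (ℤₚ.*-zeroʳ i) (ℤₚ.*-monoˡ-≤-nonNeg i {{ℤ.nonNegative 0≤i}} 0≤j)

  0<i*j : 0ℤ ℤ.< i → 0ℤ ℤ.< j → 0ℤ ℤ.< i ℤ.* j
  0<i*j {i} {j} 0<i 0<j = subst (ℤ._< i ℤ.* j) (ℤₚ.*-zeroʳ i) (ℤₚ.*-monoˡ-<-pos i {{ℤ.positive 0<i}} 0<j)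

  0≤i*j⇒0≤j : 0ℤ ℤ.< i → 0ℤ ℤ.≤ i ℤ.* j → 0ℤ ℤ.≤ j
  0≤i*j⇒0≤j {i} {j} 0<i 0≤ij = ℤₚ.*-cancelˡ-≤-pos 0ℤ j i {{ℤ.positive 0<i}}
    (subst (ℤ._≤ i ℤ.* j) (sym (ℤₚ.*-zeroʳ i)) 0≤ij)

  0<i*j⇒0<j : 0ℤ ℤ.< i → 0ℤ ℤ.< i ℤ.* j → 0ℤ ℤ.< j
  0<i*j⇒0<j {i} {j} 0<i 0<ij = ℤₚ.*-cancelˡ-<-nonNeg i {{ℤ.nonNegative (ℤₚ.<⇒≤ 0<i)}}
    (subst (ℤ._< i ℤ.* j) (sym (ℤₚ.*-zeroʳ i)) 0<ij)

  0≤i+j : 0ℤ ℤ.≤ i → 0ℤ ℤ.≤ j → 0ℤ ℤ.≤ i ℤ.+ j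
  0≤i+j = ℤₚ.+-mono-≤

  0≤i² : ∀ i → 0ℤ ℤ.≤ i ℤ.* i
  0≤i² i = subst (0ℤ ℤ.≤_) (trans (ℤₚ.pos-* ℤ.∣ i ∣ ℤ.∣ i ∣) (sq i)) (ℤ.+≤+ z≤n)
    where
    sq : ∀ i → + ℤ.∣ i ∣ ℤ.* + ℤ.∣ i ∣ ≡ i ℤ.* i
    sq (+ _)    = refl
    sq -[1+ _ ] = refl

  0<i² : i ≢ 0ℤ → 0ℤ ℤ.< i ℤ.* i
  0<i² {+ zero}   i≢0 = contradiction refl i≢0
  0<i² {+ suc n}  _   = ℤ.+<+ (s≤s z≤n)
  0<i² { -[1+ n ]} _   = ℤ.+<+ (s≤s z≤n)

  0<i⇒1≤i : 0ℤ ℤ.< i → 1ℤ ℤ.≤ i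
  0<i⇒1≤i = ℤₚ.i<j⇒suc[i]≤j

  4≤i² : ∀ i → (i ≡ 0ℤ ⊎ i ≡ 1ℤ ⊎ i ≡ -1ℤ) ⊎ + 4 ℤ.≤ i ℤ.* i
  4≤i² (+ 0)             = inj₁ (inj₁ refl)
  4≤i² (+ 1)             = inj₁ (inj₂ (inj₁ refl))
  4≤i² (+ (suc (suc n))) = inj₂ (subst (+ 4 ℤ.≤_) (ℤₚ.pos-* (2 ℕ.+ n) (2 ℕ.+ n))
    (ℤ.+≤+ (ℕₚ.*-mono-≤ {2} {2 ℕ.+ n} {2} {2 ℕ.+ n} (s≤s (s≤s z≤n)) (s≤s (s≤s z≤n)))))
  4≤i² -[1+ 0 ]          = inj₁ (inj₂ (inj₂ refl))
  4≤i² -[1+ suc n ]      = inj₂ (ℤ.+≤+ (ℕₚ.*-mono-≤ {2} {2 ℕ.+ n} {2} {2 ℕ.+ n} (s≤s (s≤s z≤n)) (s≤s (s≤s z≤n))))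

  hexagonal : ℤ → ℤ → ℤ
  hexagonal x y = x ℤ.* x ℤ.+ x ℤ.* y ℤ.+ y ℤ.* y

  -- `4 (x² + x y + y²) = (2 x + y)² + 3 y²` is positive for `y ≠ 0`; for `y = 0` the form is `x²`.
  1≤hexagonal : ∀ x y → ¬ (x ≡ 0ℤ × y ≡ 0ℤ) → 1ℤ ℤ.≤ hexagonal x y
  1≤hexagonal x y ≢0 with y ℤₚ.≟ 0ℤ
  ... | yes refl = 0<i⇒1≤i (subst (0ℤ ℤ.<_) (eq x) (0<i² λ x≡0 → ≢0 (x≡0 , refl)))
    where
    eq : ∀ x → x ℤ.* x ≡ x ℤ.* x ℤ.+ x ℤ.* 0ℤ ℤ.+ 0ℤ ℤ.* 0ℤ
    eq = ℤ-Solver.solve-∀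
  ... | no y≢0 = 0<i⇒1≤i (0<i*j⇒0<j {+ 4} (ℤ.+<+ (s≤s z≤n))
    (subst (0ℤ ℤ.<_) (eq x y) (ℤₚ.+-mono-≤-< (0≤i² (+ 2 ℤ.* x ℤ.+ y)) (0<i*j {+ 3} (ℤ.+<+ (s≤s z≤n)) (0<i² y≢0)))))
    where
    eq : ∀ x y → (+ 2 ℤ.* x ℤ.+ y) ℤ.* (+ 2 ℤ.* x ℤ.+ y) ℤ.+ + 3 ℤ.* (y ℤ.* y) ≡ + 4 ℤ.*
      (x ℤ.* x ℤ.+ x ℤ.* y ℤ.+ y ℤ.* y)
    eq = ℤ-Solver.solve-∀

  3≤hexagonal : ∀ x y → + 4 ℤ.≤ y ℤ.* y → + 3 ℤ.≤ hexagonal x y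
  3≤hexagonal x y 4≤y² = ℤₚ.0≤i-j⇒j≤i (0≤i*j⇒0≤j {+ 4} (ℤ.+<+ (s≤s z≤n)) (subst (0ℤ ℤ.≤_) (eq x y)
      (0≤i+j (0≤i² (+ 2 ℤ.* x ℤ.+ y)) (0≤i*j {+ 3} (ℤ.+≤+ z≤n) (ℤₚ.i≤j⇒0≤j-i 4≤y²)))))
    where
    eq : ∀ x y → (+ 2 ℤ.* x ℤ.+ y) ℤ.* (+ 2 ℤ.* x ℤ.+ y) ℤ.+ + 3 ℤ.* (y ℤ.* y ℤ.- + 4) ≡ + 4 ℤ.*
      (x ℤ.* x ℤ.+ x ℤ.* y ℤ.+ y ℤ.* y ℤ.- + 3)
    eq = ℤ-Solver.solve-∀

  -- P x² + 2 c x y + P y² is a nonnegative combination of x² + x y + y² and x² - x y + y².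
  module ReducedForm {P c : ℤ} (0<P : 0ℤ ℤ.< P) (0≤P+2c : 0ℤ ℤ.≤ P ℤ.+ + 2 ℤ.* c) (0≤P-2c : 0ℤ ℤ.≤ P ℤ.- + 2 ℤ.* c)
    where

    Q : ℤ → ℤ → ℤ
    Q x y = P ℤ.* (x ℤ.* x) ℤ.+ + 2 ℤ.* c ℤ.* (x ℤ.* y) ℤ.+ P ℤ.* (y ℤ.* y)

    -- The two weights sum to `2 P`, and 1 is the minimum of either hexagonal form; subtracting it
    -- makes both summands nonnegative off the origin.
    decompose : ∀ x y → (P ℤ.+ + 2 ℤ.* c) ℤ.* (hexagonal x y ℤ.- 1ℤ) ℤ.+ (P ℤ.- + 2 ℤ.* c) ℤ.*
      (hexagonal x (ℤ.- y) ℤ.- 1ℤ) ≡ + 2 ℤ.* (Q x y ℤ.- P)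
    decompose x y = eq P c x y
      where
      eq : ∀ P c x y → (P ℤ.+ + 2 ℤ.* c) ℤ.* ((x ℤ.* x ℤ.+ x ℤ.* y ℤ.+ y ℤ.* y) ℤ.- 1ℤ) ℤ.+ (P ℤ.- + 2 ℤ.* c) ℤ.*
        ((x ℤ.* x ℤ.+ x ℤ.* (ℤ.- y) ℤ.+ (ℤ.- y) ℤ.* (ℤ.- y)) ℤ.- 1ℤ)
                     ≡ + 2 ℤ.* ((P ℤ.* (x ℤ.* x) ℤ.+ + 2 ℤ.* c ℤ.* (x ℤ.* y) ℤ.+ P ℤ.* (y ℤ.* y)) ℤ.- P)
      eq = ℤ-Solver.solve-∀

    P≤Q : ∀ x y → ¬ (x ≡ 0ℤ × y ≡ 0ℤ) → P ℤ.≤ Q x y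
    P≤Q x y ≢0 = ℤₚ.0≤i-j⇒j≤i (0≤i*j⇒0≤j {+ 2} (ℤ.+<+ (s≤s z≤n)) (subst (0ℤ ℤ.≤_) (decompose x y)
      (0≤i+j (0≤i*j 0≤P+2c (ℤₚ.i≤j⇒0≤j-i (1≤hexagonal x y ≢0)))
             (0≤i*j 0≤P-2c (ℤₚ.i≤j⇒0≤j-i (1≤hexagonal x (ℤ.- y) λ (x≡0 , -y≡0) →
               ≢0 (x≡0 , ℤₚ.neg-injective -y≡0)))))))

    -- For `|y| ≥ 2` both hexagonal values are at least 3, so `2 (Q x y - P) ≥ 4 P > 0`.
    Q≡P⇒∣y∣≤1 : ∀ x y → Q x y ≡ P → y ≡ 0ℤ ⊎ y ≡ 1ℤ ⊎ y ≡ -1ℤ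
    Q≡P⇒∣y∣≤1 x y Q≡P with 4≤i² y
    ... | inj₁ ∣y∣≤1 = ∣y∣≤1
    ... | inj₂ 4≤y²  = contradiction 0<0 (ℤₚ.<-irrefl refl)
      where
      1≤E-1 : ∀ {i} → + 3 ℤ.≤ i → 0ℤ ℤ.≤ i ℤ.- + 3
      1≤E-1 = ℤₚ.i≤j⇒0≤j-i
      4≤-y² : + 4 ℤ.≤ (ℤ.- y) ℤ.* (ℤ.- y)
      4≤-y² = subst (+ 4 ℤ.≤_) (eq y) 4≤y²
        where
        eq : ∀ y → y ℤ.* y ≡ (ℤ.- y) ℤ.* (ℤ.- y)
        eq = ℤ-Solver.solve-∀
      split : ∀ P c E F → + 4 ℤ.* P ℤ.+ ((P ℤ.+ + 2 ℤ.* c) ℤ.* (E ℤ.- + 3) ℤ.+ (P ℤ.- + 2 ℤ.* c) ℤ.* (F ℤ.- + 3)) ≡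
        (P ℤ.+ + 2 ℤ.* c) ℤ.* (E ℤ.- 1ℤ) ℤ.+ (P ℤ.- + 2 ℤ.* c) ℤ.* (F ℤ.- 1ℤ)
      split = ℤ-Solver.solve-∀
      0<0 : 0ℤ ℤ.< 0ℤ
      0<0 = subst (0ℤ ℤ.<_)
        (trans (split P c (hexagonal x y) (hexagonal x (ℤ.- y)))
          (trans (decompose x y) (trans (cong (λ q → + 2 ℤ.* (q ℤ.- P)) Q≡P) (cong (+ 2 ℤ.*_) (ℤₚ.+-inverseʳ P)))))
        (ℤₚ.+-mono-<-≤ (0<i*j {+ 4} (ℤ.+<+ (s≤s z≤n)) 0<P)
          (0≤i+j (0≤i*j 0≤P+2c (1≤E-1 (3≤hexagonal x y 4≤y²))) (0≤i*j 0≤P-2c (1≤E-1 (3≤hexagonal x (ℤ.- y) 4≤-y²)))))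

  -- c = N (k + ω) + 1, hence c = 0 or c = 2 if k + ω is a unit.
  record Reduced (t n k : ℤ) : Set where
    field
      0≤k : 0ℤ ℤ.≤ k
      0<k+t : 0ℤ ℤ.< k ℤ.+ t
      c≤k : k ℤ.* k ℤ.+ t ℤ.* k ℤ.- n ℤ.+ 1ℤ ℤ.≤ k
      -k≤c : ℤ.- k ℤ.≤ k ℤ.* k ℤ.+ t ℤ.* k ℤ.- n ℤ.+ 1ℤ

  -- The perfect form `a₀` attached to `k`.

  module MinimalForm {d : ℕ} (0<d : 0 ℕ.< d) (squareFree : SquareFree d) (basis : IntegralBasis d)
                     {k : ℤ} (reduced : Reduced (IntegralBasis.t basis) (IntegralBasis.n basis) k) where
    open PerfectForms 0<d squareFree basis public
    open Reduced reduced public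

    -- `P` is the trace of `ε = k + ω` and `c - 1` its norm; `R = c - k P` is the value of Tr (a ω)
    -- when Tr a = P and Tr (a ε) = c.
    P c R : ℤ
    P = + 2 ℤ.* k ℤ.+ t
    c = k ℤ.* k ℤ.+ t ℤ.* k ℤ.- n ℤ.+ 1ℤ
    R = 1ℤ ℤ.- (k ℤ.* k ℤ.+ n)

    0≤t : 0ℤ ℤ.≤ t
    0≤t with t,h
    ... | inj₁ (refl , _) = ℤ.+≤+ z≤n
    ... | inj₂ (refl , _) = ℤ.+≤+ z≤n

    0<h : 0ℤ ℤ.< h
    0<h with t,h
    ... | inj₁ (_ , refl) = ℤ.+<+ (s≤s z≤n)
    ... | inj₂ (_ , refl) = ℤ.+<+ (s≤s z≤n)

    0<P : 0ℤ ℤ.< P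
    0<P = subst (0ℤ ℤ.<_) (eq k t) (ℤₚ.+-mono-<-≤ 0<k+t 0≤k)
      where
      eq : ∀ k t → k ℤ.+ t ℤ.+ k ≡ + 2 ℤ.* k ℤ.+ t
      eq = ℤ-Solver.solve-∀

    0≤k-c : 0ℤ ℤ.≤ k ℤ.- c
    0≤k-c = ℤₚ.i≤j⇒0≤j-i c≤k

    0≤c+k : 0ℤ ℤ.≤ c ℤ.- (ℤ.- k)
    0≤c+k = ℤₚ.i≤j⇒0≤j-i -k≤c

    0≤P-2c : 0ℤ ℤ.≤ P ℤ.- + 2 ℤ.* c
    0≤P-2c = subst (0ℤ ℤ.≤_) (eq k t c) (0≤i+j (0≤i*j {+ 2} (ℤ.+≤+ z≤n) 0≤k-c) 0≤t)
      where
      eq : ∀ k t c → + 2 ℤ.* (k ℤ.- c) ℤ.+ t ≡ + 2 ℤ.* k ℤ.+ t ℤ.- + 2 ℤ.* c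
      eq = ℤ-Solver.solve-∀

    0≤P+2c : 0ℤ ℤ.≤ P ℤ.+ + 2 ℤ.* c
    0≤P+2c = subst (0ℤ ℤ.≤_) (eq k t c) (0≤i+j (0≤i*j {+ 2} (ℤ.+≤+ z≤n) 0≤c+k) 0≤t)
      where
      eq : ∀ k t c → + 2 ℤ.* (c ℤ.- (ℤ.- k)) ℤ.+ t ≡ + 2 ℤ.* k ℤ.+ t ℤ.+ + 2 ℤ.* c
      eq = ℤ-Solver.solve-∀

    open ReducedForm 0<P 0≤P+2c 0≤P-2c public

    -- Solving Tr a = P, Tr (a ω) = R for the coordinates of `a` produces the denominator `2 h d`.
    M : ℤ
    M = + 2 ℤ.* (h ℤ.* + d)

    0<hd : 0ℤ ℤ.< h ℤ.* + d
    0<hd = 0<i*j 0<h (ℤ.+<+ 0<d)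

    0<M : 0ℤ ℤ.< M
    0<M = 0<i*j {+ 2} (ℤ.+<+ (s≤s z≤n)) 0<hd

    -- The form with Tr a₀ = M P and Tr (a₀ ω) = M R; its values on ι (x + k y) y are M Q x y.
    a₀ : K
    a₀ = ⟦ h ℤ.* + d ℤ.* P ⟧ +√d ⟦ + 2 ℤ.* R ℤ.- t ℤ.* P ⟧

    Tr-*ι : ∀ a A B → Tr (a *ᴷ ι A B) ≡ ⟦ A ⟧ * Tr a + ⟦ B ⟧ * Tr (a *ᴷ ω)
    Tr-*ι a A B = begin
      Tr (a *ᴷ ι A B)                                    ≡⟨ Tr≡2re (a *ᴷ ι A B) ⟩
      _                                                  ≡⟨ eq dℚ (re a) (im a) ⟦ A ⟧ ⟦ B ⟧ (½ * ⟦ t ⟧) (½ * ⟦ h ⟧) ⟩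
      _
        ≡⟨ cong₂ (λ x y → ⟦ A ⟧ * x + ⟦ B ⟧ * y) (Tr≡2re a) (Tr≡2re (a *ᴷ ω)) ⟨
      ⟦ A ⟧ * Tr a + ⟦ B ⟧ * Tr (a *ᴷ ω)                 ∎
      where
      open ≡-Reasoning
      eq : ∀ D a b A B t h → (a * (A + B * t) + D * (b * (B * h))) + (a * (A + B * t) + D * (b * (B * h)))
                           ≡ A * (a + a) + B * ((a * t + D * (b * h)) + (a * t + D * (b * h)))
      eq = solve-∀ ℚ-ring

    trForm-ι : ∀ a A B → trForm a (ι A B) ≡ ⟦ A ℤ.* A ℤ.+ n ℤ.* (B ℤ.* B) ⟧ * Tr a + ⟦ A ℤ.* B ℤ.+ B ℤ.* A ℤ.+ t ℤ.*
      (B ℤ.* B) ⟧ * Tr (a *ᴷ ω)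
    trForm-ι a A B = trans (cong (λ y → Tr (a *ᴷ y)) (ι-* A B A B)) (Tr-*ι a _ _)

    Tr-a₀ : Tr a₀ ≡ ⟦ M ℤ.* P ⟧
    Tr-a₀ = trans (Tr≡2re a₀) (trans (sym (⟦⟧-+ (h ℤ.* + d ℤ.* P) (h ℤ.* + d ℤ.* P))) (cong ⟦_⟧ (eq (h ℤ.* + d) P)))
      where
      eq : ∀ h P → h ℤ.* P ℤ.+ h ℤ.* P ≡ + 2 ℤ.* h ℤ.* P
      eq = ℤ-Solver.solve-∀

    Tr-*ω : ∀ a → Tr (a *ᴷ ω) ≡ re a * ⟦ t ⟧ + dℚ * ⟦ h ⟧ * im a
    Tr-*ω a = trans (Tr≡2re (a *ᴷ ω)) (eq dℚ (re a) (im a) ⟦ t ⟧ ⟦ h ⟧)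
      where
      eq : ∀ D a b t h → (a * (½ * t) + D * (b * (½ * h))) + (a * (½ * t) + D * (b * (½ * h))) ≡ a * t + D * h * b
      eq = solve-∀ ℚ-ring

    Tr-a₀ω : Tr (a₀ *ᴷ ω) ≡ ⟦ M ℤ.* R ⟧
    Tr-a₀ω = begin
      Tr (a₀ *ᴷ ω)                     ≡⟨ Tr-*ω a₀ ⟩
      re a₀ * ⟦ t ⟧ + dℚ * ⟦ h ⟧ * im a₀
        ≡⟨ _⊹_ {i = h ℤ.* + d ℤ.* P ℤ.* t} (⟦⟧-* (h ℤ.* + d ℤ.* P) t)
          (_⊠_ {i = + d ℤ.* h} {j = + 2 ℤ.* R ℤ.- t ℤ.* P} (_⊠_ {i = + d} {j = h} (sym dℚ≡D) refl) refl) ⟨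
      ⟦ h ℤ.* + d ℤ.* P ℤ.* t ℤ.+ + d ℤ.* h ℤ.* (+ 2 ℤ.* R ℤ.- t ℤ.* P) ⟧
        ≡⟨ cong ⟦_⟧ (eq h (+ d) P t R) ⟩
      ⟦ M ℤ.* R ⟧                      ∎
      where
      open ≡-Reasoning
      eq : ∀ h d P t R → h ℤ.* d ℤ.* P ℤ.* t ℤ.+ d ℤ.* h ℤ.* (+ 2 ℤ.* R ℤ.- t ℤ.* P) ≡ + 2 ℤ.* (h ℤ.* d) ℤ.* R
      eq = ℤ-Solver.solve-∀

    -- In the basis 1, `ε`, the element `A + B ω` is `(A - k B) + B ε`.
    trForm-a₀ : ∀ A B → trForm a₀ (ι A B) ≡ ⟦ M ℤ.* Q (A ℤ.- k ℤ.* B) B ⟧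
    trForm-a₀ A B = begin
      trForm a₀ (ι A B)                             ≡⟨ trForm-ι a₀ A B ⟩
      ⟦ X ⟧ * Tr a₀ + ⟦ Y ⟧ * Tr (a₀ *ᴷ ω)          ≡⟨ cong₂ (λ x y → ⟦ X ⟧ * x + ⟦ Y ⟧ * y) Tr-a₀ Tr-a₀ω ⟩
      ⟦ X ⟧ * ⟦ M ℤ.* P ⟧ + ⟦ Y ⟧ * ⟦ M ℤ.* R ⟧
        ≡⟨ _⊹_ {i = X ℤ.* (M ℤ.* P)} {j = Y ℤ.* (M ℤ.* R)} (⟦⟧-* X (M ℤ.* P)) (⟦⟧-* Y (M ℤ.* R)) ⟨
      ⟦ X ℤ.* (M ℤ.* P) ℤ.+ Y ℤ.* (M ℤ.* R) ⟧       ≡⟨ cong ⟦_⟧ (eq M t n k A B) ⟩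
      ⟦ M ℤ.* Q (A ℤ.- k ℤ.* B) B ⟧                 ∎
      where
      open ≡-Reasoning
      X = A ℤ.* A ℤ.+ n ℤ.* (B ℤ.* B)
      Y = A ℤ.* B ℤ.+ B ℤ.* A ℤ.+ t ℤ.* (B ℤ.* B)
      eq : ∀ M t n k A B → (A ℤ.* A ℤ.+ n ℤ.* (B ℤ.* B)) ℤ.* (M ℤ.* (+ 2 ℤ.* k ℤ.+ t)) ℤ.+
        (A ℤ.* B ℤ.+ B ℤ.* A ℤ.+ t ℤ.* (B ℤ.* B)) ℤ.* (M ℤ.* (1ℤ ℤ.- (k ℤ.* k ℤ.+ n)))
         ≡ M ℤ.* ((+ 2 ℤ.* k ℤ.+ t) ℤ.* ((A ℤ.- k ℤ.* B) ℤ.* (A ℤ.- k ℤ.* B)) ℤ.+ + 2 ℤ.*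
           (k ℤ.* k ℤ.+ t ℤ.* k ℤ.- n ℤ.+ 1ℤ) ℤ.* ((A ℤ.- k ℤ.* B) ℤ.* B) ℤ.+ (+ 2 ℤ.* k ℤ.+ t) ℤ.* (B ℤ.* B))
      eq = ℤ-Solver.solve-∀

    m : ℚ
    m = ⟦ M ℤ.* P ⟧

    0<⟦⟧ : ∀ {i} → 0ℤ ℤ.< i → 0ℚ < ⟦ i ⟧
    0<⟦⟧ {i} 0<i = subst (_< ⟦ i ⟧) ⟦0⟧ (⟦⟧-mono-< 0<i)

    0<re-a₀ : 0ℚ < re a₀
    0<re-a₀ = 0<⟦⟧ (0<i*j 0<hd 0<P)

    -- The norm is `4 d (P - c)(P + c)`, and `|c| ≤ k < P`.
    0<N-a₀ : 0ℚ < N a₀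
    0<N-a₀ = subst (0ℚ <_) (sym (begin
        N a₀
          ≡⟨ _⊟_ {i = X ℤ.* X} {j = + d ℤ.* (Y ℤ.* Y)} (⟦⟧-* X X) (_⊠_ {i = + d} {j = Y ℤ.* Y} (sym dℚ≡D) (⟦⟧-* Y Y))
            ⟨
        ⟦ X ℤ.* X ℤ.- + d ℤ.* (Y ℤ.* Y) ⟧
          ≡⟨ cong ⟦_⟧ (trans (eq₁ h (+ d) P Y) (trans
            (cong (λ w → w ℤ.* + d ℤ.* (P ℤ.* P) ℤ.- + d ℤ.* (Y ℤ.* Y)) h²d≡t²+4n) (eq₂ (+ d) t n k))) ⟩
        ⟦ + 4 ℤ.* + d ℤ.* ((P ℤ.- c) ℤ.* (P ℤ.+ c)) ⟧ ∎))
        (0<⟦⟧ (0<i*j {+ 4 ℤ.* + d} (0<i*j {+ 4} (ℤ.+<+ (s≤s z≤n)) (ℤ.+<+ 0<d)) (0<i*j 0<P-c 0<P+c)))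
      where
      open ≡-Reasoning
      X = h ℤ.* + d ℤ.* P
      Y = + 2 ℤ.* R ℤ.- t ℤ.* P
      eq₁ : ∀ h d P Y → h ℤ.* d ℤ.* P ℤ.* (h ℤ.* d ℤ.* P) ℤ.- d ℤ.* (Y ℤ.* Y) ≡ h ℤ.* h ℤ.* d ℤ.* d ℤ.* (P ℤ.* P) ℤ.-
        d ℤ.* (Y ℤ.* Y)
      eq₁ = ℤ-Solver.solve-∀
      eq₂ : ∀ d t n k → (t ℤ.* t ℤ.+ + 4 ℤ.* n) ℤ.* d ℤ.* ((+ 2 ℤ.* k ℤ.+ t) ℤ.* (+ 2 ℤ.* k ℤ.+ t))
                        ℤ.- d ℤ.* ((+ 2 ℤ.* (1ℤ ℤ.- (k ℤ.* k ℤ.+ n)) ℤ.- t ℤ.* (+ 2 ℤ.* k ℤ.+ t)) ℤ.*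
                          (+ 2 ℤ.* (1ℤ ℤ.- (k ℤ.* k ℤ.+ n)) ℤ.- t ℤ.* (+ 2 ℤ.* k ℤ.+ t)))
        ≡ + 4 ℤ.* d ℤ.* (((+ 2 ℤ.* k ℤ.+ t) ℤ.- (k ℤ.* k ℤ.+ t ℤ.* k ℤ.- n ℤ.+ 1ℤ)) ℤ.*
          ((+ 2 ℤ.* k ℤ.+ t) ℤ.+ (k ℤ.* k ℤ.+ t ℤ.* k ℤ.- n ℤ.+ 1ℤ)))
      eq₂ = ℤ-Solver.solve-∀
      eq₃ : ∀ k t c → k ℤ.- c ℤ.+ (k ℤ.+ t) ≡ + 2 ℤ.* k ℤ.+ t ℤ.- c
      eq₃ = ℤ-Solver.solve-∀
      eq₄ : ∀ k t c → c ℤ.- (ℤ.- k) ℤ.+ (k ℤ.+ t) ≡ + 2 ℤ.* k ℤ.+ t ℤ.+ c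
      eq₄ = ℤ-Solver.solve-∀
      0<P-c = subst (0ℤ ℤ.<_) (eq₃ k t c) (ℤₚ.+-mono-≤-< 0≤k-c 0<k+t)
      0<P+c = subst (0ℤ ℤ.<_) (eq₄ k t c) (ℤₚ.+-mono-≤-< 0≤c+k 0<k+t)

    a₀≫0 : TotallyPositive a₀
    a₀≫0 = ⇒totallyPositive {a₀} 0<re-a₀ 0<N-a₀

    ε : K
    ε = ι k 1ℤ

    trForm-1 : ∀ a → trForm a 1ᴷ ≡ Tr a
    trForm-1 a = cong Tr (trans (cong (a *ᴷ_) (*ᴷ-identityˡ 1ᴷ)) (*ᴷ-identityʳ a))

    trForm-a₀-ε : trForm a₀ ε ≡ m
    trForm-a₀-ε = trans (trForm-a₀ k 1ℤ) (cong (λ q → ⟦ M ℤ.* q ⟧) (eq P c k))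
      where
      eq : ∀ P c k → P ℤ.* ((k ℤ.- k ℤ.* 1ℤ) ℤ.* (k ℤ.- k ℤ.* 1ℤ)) ℤ.+ + 2 ℤ.* c ℤ.* ((k ℤ.- k ℤ.* 1ℤ) ℤ.* 1ℤ) ℤ.+ P
        ℤ.* (1ℤ ℤ.* 1ℤ) ≡ P
      eq = ℤ-Solver.solve-∀

    a₀-minimum : ∀ x → Integral x → x ≢ 0ᴷ → m ≤ trForm a₀ x
    a₀-minimum x ix x≢0 = bound (coordinates ix)
      where
      bound : (∃₂ λ A B → x ≡ ι A B) → m ≤ trForm a₀ x
      bound (A , B , x≡) = subst (m ≤_) (sym (trans (cong (trForm a₀) x≡) (trForm-a₀ A B)))
        (⟦⟧-mono-≤ (ℤₚ.*-monoˡ-≤-nonNeg M {{ℤ.nonNegative (ℤₚ.<⇒≤ 0<M)}} (P≤Q (A ℤ.- k ℤ.* B) B ≢0)))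
        where
        eq : ∀ k A → A ≡ A ℤ.- k ℤ.* 0ℤ
        eq = ℤ-Solver.solve-∀
        ≢0 : ¬ (A ℤ.- k ℤ.* B ≡ 0ℤ × B ≡ 0ℤ)
        ≢0 (A-kB≡0 , refl) = x≢0 (trans x≡ (trans (cong (λ z → ι z 0ℤ) (trans (eq k A) A-kB≡0))
          (trans (ι-A0 0ℤ) (cong fromℚ ⟦0⟧))))

    -- The value at 1 gives `re b`. Since `ε² = (k² + n) + P ω` with `P ≠ 0`, the value at `ε` then
    -- gives Tr (b ω), and with it `im b`.
    a₀-determined : ∀ b → Tr b ≡ m → trForm b ε ≡ m → b ≡ a₀
    a₀-determined b Tr-b≡m bε≡m = cong₂ _+√d_ re≡ (*-cancelˡ dh≢0 (begin
        dℚ * ⟦ h ⟧ * im b                                   ≡⟨ isolate (re b * ⟦ t ⟧) (dℚ * ⟦ h ⟧ * im b) ⟩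
        re b * ⟦ t ⟧ + dℚ * ⟦ h ⟧ * im b - re b * ⟦ t ⟧
          ≡⟨ cong₂ (λ x y → x - y * ⟦ t ⟧) (trans (sym (Tr-*ω b)) (trans Tr-bω≡ (Tr-*ω a₀))) re≡ ⟩
        re a₀ * ⟦ t ⟧ + dℚ * ⟦ h ⟧ * im a₀ - re a₀ * ⟦ t ⟧  ≡⟨ isolate (re a₀ * ⟦ t ⟧) (dℚ * ⟦ h ⟧ * im a₀) ⟨
        dℚ * ⟦ h ⟧ * im a₀                                  ∎))
      where
      open ≡-Reasoning
      isolate : ∀ p q → q ≡ p + q - p
      isolate = solve-∀ ℚ-ring
      half : ∀ p → p ≡ ½ * (p + p)
      half = solve-∀ ℚ-ring
      dh≢0 : dℚ * ⟦ h ⟧ ≢ 0ℚ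
      dh≢0 = 0<⇒≢0 (0<p*q 0<dℚ (0<⟦⟧ 0<h))
      re≡ : re b ≡ re a₀
      re≡ = trans (half (re b)) (trans (cong (½ *_)
        (trans (sym (Tr≡2re b)) (trans Tr-b≡m (trans (sym Tr-a₀) (Tr≡2re a₀))))) (sym (half (re a₀))))
      X = k ℤ.* k ℤ.+ n ℤ.* (1ℤ ℤ.* 1ℤ)
      Y = k ℤ.* 1ℤ ℤ.+ 1ℤ ℤ.* k ℤ.+ t ℤ.* (1ℤ ℤ.* 1ℤ)
      Y≡P : ∀ k t → k ℤ.* 1ℤ ℤ.+ 1ℤ ℤ.* k ℤ.+ t ℤ.* (1ℤ ℤ.* 1ℤ) ≡ + 2 ℤ.* k ℤ.+ t
      Y≡P = ℤ-Solver.solve-∀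
      Tr-bω≡ : Tr (b *ᴷ ω) ≡ Tr (a₀ *ᴷ ω)
      Tr-bω≡ = *-cancelˡ (0<⇒≢0 (0<⟦⟧ (subst (0ℤ ℤ.<_) (sym (Y≡P k t)) 0<P))) (begin
        ⟦ Y ⟧ * Tr (b *ᴷ ω)                                    ≡⟨ isolate (⟦ X ⟧ * Tr b) (⟦ Y ⟧ * Tr (b *ᴷ ω)) ⟩
        ⟦ X ⟧ * Tr b + ⟦ Y ⟧ * Tr (b *ᴷ ω) - ⟦ X ⟧ * Tr b
          ≡⟨ cong₂ (λ x y → x - ⟦ X ⟧ * y) (trans (sym (trForm-ι b k 1ℤ))
          (trans bε≡m (trans (sym trForm-a₀-ε) (trForm-ι a₀ k 1ℤ)))) (trans Tr-b≡m (sym Tr-a₀)) ⟩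
        ⟦ X ⟧ * Tr a₀ + ⟦ Y ⟧ * Tr (a₀ *ᴷ ω) - ⟦ X ⟧ * Tr a₀   ≡⟨ isolate (⟦ X ⟧ * Tr a₀) (⟦ Y ⟧ * Tr (a₀ *ᴷ ω)) ⟨
        ⟦ Y ⟧ * Tr (a₀ *ᴷ ω)                                   ∎)

    1≢0 : 1ᴷ ≢ 0ᴷ
    1≢0 eq = contradiction (cong re eq) λ ()

    a₀-isTraceMinimum : IsTraceMinimum a₀ m
    a₀-isTraceMinimum = (1ᴷ , integral-1 , 1≢0 , trans (trForm-1 a₀) Tr-a₀) , a₀-minimum

    a₀-perfect : Perfect a₀
    a₀-perfect = a₀≫0 , m , a₀-isTraceMinimum , λ b _ agree → a₀-determined b
      (trans (sym (trForm-1 b)) (agree 1ᴷ (integral-1 , trans (trForm-1 a₀) Tr-a₀)))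
      (agree ε (integral k 1ℤ , trForm-a₀-ε))

    -- `- im a₀ = t P + 2 k² + 2 (n - 1)`. Being nonzero, it makes `a₀` and `conj a₀` linearly
    -- independent over ℚ.
    im-a₀<0 : im a₀ < 0ℚ
    im-a₀<0 = subst (im a₀ <_) ⟦0⟧ (⟦⟧-mono-< (ℤₚ.neg-cancel-< (subst (0ℤ ℤ.<_) (eq t n k) (positive t,h))))
      where
      eq : ∀ t n k → t ℤ.* (+ 2 ℤ.* k ℤ.+ t) ℤ.+ + 2 ℤ.* (k ℤ.* k) ℤ.+ + 2 ℤ.* (n ℤ.- 1ℤ) ≡ ℤ.-
        (+ 2 ℤ.* (1ℤ ℤ.- (k ℤ.* k ℤ.+ n)) ℤ.- t ℤ.* (+ 2 ℤ.* k ℤ.+ t))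
      eq = ℤ-Solver.solve-∀
      0≤n-1 : 0ℤ ℤ.≤ + 2 ℤ.* (n ℤ.- 1ℤ)
      0≤n-1 = 0≤i*j {+ 2} (ℤ.+≤+ z≤n) (ℤₚ.i≤j⇒0≤j-i (0<i⇒1≤i 0<n))
      positive : (t ≡ 0ℤ × h ≡ + 2) ⊎ (t ≡ 1ℤ × h ≡ 1ℤ) → 0ℤ ℤ.< t ℤ.* P ℤ.+ + 2 ℤ.* (k ℤ.* k) ℤ.+ + 2 ℤ.* (n ℤ.- 1ℤ)
      positive (inj₁ (t≡0 , _)) = ℤₚ.+-mono-<-≤ (ℤₚ.+-mono-≤-< (0≤i*j 0≤t (ℤₚ.<⇒≤ 0<P))
        (0<i*j {+ 2} (ℤ.+<+ (s≤s z≤n)) (0<i*j 0<k 0<k))) 0≤n-1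
        where 0<k = subst (0ℤ ℤ.<_) (trans (cong (λ z → k ℤ.+ z) t≡0) (ℤₚ.+-identityʳ k)) 0<k+t
      positive (inj₂ (t≡1 , _)) = ℤₚ.+-mono-<-≤ (ℤₚ.+-mono-<-≤ (0<i*j 0<t 0<P) (0≤i*j {+ 2} (ℤ.+≤+ z≤n) (0≤i² k)))
        0≤n-1
        where 0<t = subst (0ℤ ℤ.<_) (sym t≡1) (ℤ.+<+ (s≤s z≤n))

  -- Classes of perfect forms, and the unit obtained from a single class.

  p²≡1⇒p≡1 : ∀ {p} → 0ℚ < p → p * p ≡ 1ℚ → p ≡ 1ℚ
  p²≡1⇒p≡1 {p} 0<p p²≡1 = *-cancelˡ (0<⇒≢0 (0<p+q 0<p 0<1)) (trans (eq p) (trans (cong (_+ p) p²≡1) (eq′ p)))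
    where
    eq : ∀ p → (p + 1ℚ) * p ≡ p * p + p
    eq = solve-∀ ℚ-ring
    eq′ : ∀ p → 1ℚ + p ≡ (p + 1ℚ) * 1ℚ
    eq′ = solve-∀ ℚ-ring

  module Classes {d : ℕ} (0<d : 0 ℕ.< d) (squareFree : SquareFree d) (basis : IntegralBasis d)
                 {k : ℤ} (reduced : Reduced (IntegralBasis.t basis) (IntegralBasis.n basis) k) where
    open MinimalForm 0<d squareFree basis reduced public
    open Setoid PerfectClasses using () renaming (_≈_ to _≈ᶠ_; sym to symᶠ; trans to transᶠ)

    -- A closed form for chains of equivalences and homotheties: scalings and squares of units
    -- commute, so one of each suffices, and `r` and `u` can be compared with `a₀`.
    _∼_ : K → K → Set
    a ∼ b = ∃₂ λ r u → 0ℚ < r × IsUnit u × b ≡ fromℚ r *ᴷ (a *ᴷ (u *ᴷ u))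

    ∼-isEquivalence : IsEquivalence _∼_
    ∼-isEquivalence = record { refl = ∼-refl ; sym = ∼-sym ; trans = λ {a} {b} {c} → ∼-trans {a} {b} {c} }
      where
      ∼-refl : ∀ {a} → a ∼ a
      ∼-refl {a} = 1ℚ , 1ᴷ , 0<1 , unit-1 , sym (trans (*ᴷ-identityˡ (a *ᴷ (1ᴷ *ᴷ 1ᴷ)))
        (trans (cong (a *ᴷ_) (*ᴷ-identityˡ 1ᴷ)) (*ᴷ-identityʳ a)))

      regroup : ∀ r s a u v → s *ᴷ ((r *ᴷ (a *ᴷ (u *ᴷ u))) *ᴷ (v *ᴷ v)) ≡ (s *ᴷ r) *ᴷ (a *ᴷ ((u *ᴷ v) *ᴷ (u *ᴷ v)))
      regroup = K-Solver.solve 5 (λ r s a u v → s :* ((r :* (a :* (u :* u))) :* (v :* v)) := (s :* r) :*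
        (a :* ((u :* v) :* (u :* v)))) refl
        where open K-Solver using (_:*_; _:=_)

      ∼-trans : ∀ {a b c} → a ∼ b → b ∼ c → a ∼ c
      ∼-trans {a} {b} {c} (r , u , 0<r , unit-u , b≡) (s , v , 0<s , unit-v , c≡) = s * r , u *ᴷ v , 0<p*q 0<s 0<r ,
        unit-* unit-u unit-v ,
        trans c≡ (trans (cong (λ x → fromℚ s *ᴷ (x *ᴷ (v *ᴷ v))) b≡)
          (trans (regroup (fromℚ r) (fromℚ s) a u v) (cong (_*ᴷ (a *ᴷ ((u *ᴷ v) *ᴷ (u *ᴷ v)))) (fromℚ-* s r))))

      ∼-sym : ∀ {a b} → a ∼ b → b ∼ a
      ∼-sym {a} {b} (r , u , 0<r , (iu , v , iv , uv≡1) , b≡) = s , v , 0<s ,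
        (iv , u , iu , trans (*ᴷ-comm v u) uv≡1) , sym (begin
        fromℚ s *ᴷ (b *ᴷ (v *ᴷ v))                              ≡⟨ cong (λ x → fromℚ s *ᴷ (x *ᴷ (v *ᴷ v))) b≡ ⟩
        fromℚ s *ᴷ ((fromℚ r *ᴷ (a *ᴷ (u *ᴷ u))) *ᴷ (v *ᴷ v))   ≡⟨ regroup (fromℚ r) (fromℚ s) a u v ⟩
        (fromℚ s *ᴷ fromℚ r) *ᴷ (a *ᴷ ((u *ᴷ v) *ᴷ (u *ᴷ v)))
          ≡⟨ cong₂ (λ x y → x *ᴷ (a *ᴷ (y *ᴷ y))) (trans (fromℚ-* s r) (cong fromℚ sr≡1)) uv≡1 ⟩
        1ᴷ *ᴷ (a *ᴷ (1ᴷ *ᴷ 1ᴷ))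
          ≡⟨ trans (*ᴷ-identityˡ (a *ᴷ (1ᴷ *ᴷ 1ᴷ))) (trans (cong (a *ᴷ_) (*ᴷ-identityˡ 1ᴷ)) (*ᴷ-identityʳ a)) ⟩
        a                                                       ∎)
        where
        open ≡-Reasoning
        s = proj₁ (quotient 1ℚ (0<⇒≢0 0<r))
        sr≡1 : s * r ≡ 1ℚ
        sr≡1 = proj₂ (quotient 1ℚ (0<⇒≢0 0<r))
        0<s : 0ℚ < s
        0<s = 0<p*q⇒0<q (ℚ.<⇒≤ 0<r) (subst (0ℚ <_) (sym (trans (ℚ.*-comm r s) sr≡1)) 0<1)

    ≈ᶠ⇒∼ : ∀ {f g} → f ≈ᶠ g → proj₁ f ∼ proj₁ g
    ≈ᶠ⇒∼ = Closure.gfold ∼-isEquivalence proj₁ λ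
      { {a , _} (inj₁ (u , unit , b≡)) → 1ℚ , u , 0<1 , unit , trans b≡ (sym (*ᴷ-identityˡ (a *ᴷ (u *ᴷ u))))
      ; {a , _} (inj₂ (r , 0<r , b≡)) → r , 1ᴷ , 0<r , unit-1 ,
          trans b≡ (cong (fromℚ r *ᴷ_) (sym (trans (cong (a *ᴷ_) (*ᴷ-identityˡ 1ᴷ)) (*ᴷ-identityʳ a)))) }

    one-class⇒∼ : NumberOfPerfectClasses 1 → ∀ (f g : PerfectForm) → proj₁ f ∼ proj₁ g
    one-class⇒∼ bijection f g = ≈ᶠ⇒∼ {f} {g} (transᶠ {f} {to Fin.zero} {g} (symᶠ {to Fin.zero} {f} (hits f)) (hits g))
      where
      open Bijection bijection using (to; surjective)
      hits : ∀ f → to Fin.zero ≈ᶠ f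
      hits f with surjective f
      ... | Fin.zero , to-f = to-f refl

    unit-norm² : ∀ {u} → IsUnit u → N u * N u ≡ 1ℚ
    unit-norm² {u} unit = helper (coordinates (proj₁ unit))
      where
      square : ∀ {i} → i ≡ 1ℤ ⊎ i ≡ -1ℤ → i ℤ.* i ≡ 1ℤ
      square (inj₁ refl) = refl
      square (inj₂ refl) = refl
      helper : (∃₂ λ A B → u ≡ ι A B) → N u * N u ≡ 1ℚ
      helper (A , B , u≡) = trans (cong (λ x → x * x) (trans (cong N u≡) (N-ι A B)))
        (trans (sym (⟦⟧-* (norm A B) (norm A B)))
        (trans (cong ⟦_⟧ (square (unit⇒norm≡±1 A B (subst IsUnit u≡ unit)))) ⟦1⟧))

    conj-a₀∼a₀⇒unit : a₀ ∼ conj a₀ → ∃ λ A → norm A 1ℤ ≡ 1ℤ ⊎ norm A 1ℤ ≡ -1ℤ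
    conj-a₀∼a₀⇒unit (r , u , 0<r , unit , conj-a₀≡) = helper (coordinates (proj₁ unit))
      where
      open ≡-Reasoning
      r²≡1 : r * r ≡ 1ℚ
      r²≡1 = *-cancelˡ (0<⇒≢0 0<N-a₀) (begin
        N a₀ * (r * r)                              ≡⟨ eq₁ (N a₀) r ⟩
        r * r * (N a₀ * 1ℚ)                         ≡⟨ cong (λ x → r * r * (N a₀ * x)) (unit-norm² unit) ⟨
        r * r * (N a₀ * (N u * N u))                ≡⟨ cong (λ x → r * r * (N a₀ * x)) (N-* u u) ⟨
        r * r * (N a₀ * N (u *ᴷ u))                 ≡⟨ cong₂ _*_ (eq₂ dℚ r) (N-* a₀ (u *ᴷ u)) ⟨
        N (fromℚ r) * N (a₀ *ᴷ (u *ᴷ u))            ≡⟨ N-* (fromℚ r) (a₀ *ᴷ (u *ᴷ u)) ⟨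
        N (fromℚ r *ᴷ (a₀ *ᴷ (u *ᴷ u)))             ≡⟨ cong N conj-a₀≡ ⟨
        N (conj a₀)                                 ≡⟨ N-conj a₀ ⟩
        N a₀                                        ≡⟨ ℚ.*-identityʳ (N a₀) ⟨
        N a₀ * 1ℚ                                   ∎)
        where
        eq₁ : ∀ n r → n * (r * r) ≡ r * r * (n * 1ℚ)
        eq₁ = solve-∀ ℚ-ring
        eq₂ : ∀ D r → r * r - D * (0ℚ * 0ℚ) ≡ r * r
        eq₂ = solve-∀ ℚ-ring
      a₀u²≡ : a₀ *ᴷ (u *ᴷ u) ≡ conj a₀
      a₀u²≡ = sym (trans conj-a₀≡ (trans (cong (λ s → fromℚ s *ᴷ (a₀ *ᴷ (u *ᴷ u))) (p²≡1⇒p≡1 0<r r²≡1))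
        (*ᴷ-identityˡ (a₀ *ᴷ (u *ᴷ u)))))
      -- Conjugation preserves the trace, so `u` takes the same value as 1.
      a₀u≡m : trForm a₀ u ≡ m
      a₀u≡m = trans (cong Tr a₀u²≡) (trans (Tr≡2re (conj a₀)) (trans (sym (Tr≡2re a₀)) Tr-a₀))
      helper : (∃₂ λ A B → u ≡ ι A B) → ∃ λ A → norm A 1ℤ ≡ 1ℤ ⊎ norm A 1ℤ ≡ -1ℤ
      helper (A , B , u≡) = cases B u≡ (unit⇒norm≡±1 A B (subst IsUnit u≡ unit)) (Q≡P⇒∣y∣≤1 (A ℤ.- k ℤ.* B) B Q≡P)
        where
        Q≡P : Q (A ℤ.- k ℤ.* B) B ≡ P
        Q≡P = ℤₚ.*-cancelˡ-≡ M _ _ {{ℤ.≢-nonZero (λ M≡0 → ℤₚ.<-irrefl (sym M≡0) 0<M)}}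
          (⟦⟧-injective (trans (sym (trForm-a₀ A B)) (trans (cong (trForm a₀) (sym u≡)) a₀u≡m)))
        cases : ∀ B → u ≡ ι A B → norm A B ≡ 1ℤ ⊎ norm A B ≡ -1ℤ → B ≡ 0ℤ ⊎ B ≡ 1ℤ ⊎ B ≡ -1ℤ → ∃ λ A →
          norm A 1ℤ ≡ 1ℤ ⊎ norm A 1ℤ ≡ -1ℤ
        cases B u≡ ±1 (inj₂ (inj₁ refl)) = A , ±1
        -- Replacing `u` by `- u` keeps the norm and makes the coefficient of `ω` equal to 1.
        cases B u≡ ±1 (inj₂ (inj₂ refl)) = ℤ.- A , subst (λ z → z ≡ 1ℤ ⊎ z ≡ -1ℤ) (eq t n A) ±1
          where
          eq : ∀ t n A → A ℤ.* A ℤ.+ t ℤ.* (A ℤ.* -1ℤ) ℤ.- n ℤ.* (-1ℤ ℤ.* -1ℤ) ≡ (ℤ.- A) ℤ.* (ℤ.- A) ℤ.+ t ℤ.*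
            ((ℤ.- A) ℤ.* 1ℤ) ℤ.- n ℤ.* (1ℤ ℤ.* 1ℤ)
          eq = ℤ-Solver.solve-∀
        -- Comparing coefficients of √d in `conj a₀ = A² a₀` gives `- im a₀ = A² im a₀`, positive on
        -- the left and at most 0 on the right.
        cases B u≡ ±1 (inj₁ refl) = contradiction 0≤A²[-im] (<⇒≱ A²[-im]<0)
          where
          u²≡ : u *ᴷ u ≡ fromℚ (⟦ A ⟧ * ⟦ A ⟧)
          u²≡ = trans (cong (λ x → x *ᴷ x) (trans u≡ (ι-A0 A))) (fromℚ-* ⟦ A ⟧ ⟦ A ⟧)
          -im≡ : - im a₀ ≡ ⟦ A ⟧ * ⟦ A ⟧ * im a₀
          -im≡ = cong im (trans (sym a₀u²≡) (trans (cong (a₀ *ᴷ_) u²≡)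
            (trans (*ᴷ-comm a₀ (fromℚ (⟦ A ⟧ * ⟦ A ⟧))) (fromℚ*≡ (⟦ A ⟧ * ⟦ A ⟧) a₀))))
          0≤A²[-im] : 0ℚ ≤ ⟦ A ⟧ * ⟦ A ⟧ * (- im a₀)
          0≤A²[-im] = 0≤p*q (0≤p² ⟦ A ⟧) (ℚ.neg-antimono-≤ (ℚ.<⇒≤ im-a₀<0))
          A²[-im]<0 : ⟦ A ⟧ * ⟦ A ⟧ * (- im a₀) < 0ℚ
          A²[-im]<0 = subst (_< 0ℚ) (trans (double-neg (im a₀))
            (trans (cong -_ -im≡) (ℚ.neg-distribʳ-* (⟦ A ⟧ * ⟦ A ⟧) (im a₀)))) im-a₀<0
            where
            double-neg : ∀ p → p ≡ - (- p)
            double-neg = solve-∀ ℚ-ring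

    one-class⇒unit : NumberOfPerfectClasses 1 → ∃ λ A → norm A 1ℤ ≡ 1ℤ ⊎ norm A 1ℤ ≡ -1ℤ
    one-class⇒unit one = conj-a₀∼a₀⇒unit (one-class⇒∼ one (a₀ , a₀-perfect) (conj a₀ , perfect-conj a₀-perfect))

    -- Reduction of perfect forms when `ε` is a unit.

    module _ (ε-norm² : norm k 1ℤ ℤ.* norm k 1ℤ ≡ 1ℤ) where

      unit-ε : IsUnit ε
      unit-ε = norm≡±1⇒unit k 1ℤ ε-norm²

      unit-conj : ∀ {u} → IsUnit u → IsUnit (conj u)
      unit-conj {u} (iu , v , iv , uv≡1) = integral-conj iu , conj v , integral-conj iv ,
        trans (sym (conj-* u v)) (cong conj uv≡1)

      -- As `conj ε` is `ε⁻¹` up to sign, these are the two steps along the powers of `ε`. For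
      -- `a y²` they compare the value at 1 with those at `ε` and `conj ε`.
      NoShorterNeighbour : K → K → Set
      NoShorterNeighbour a y = trForm a y ≤ trForm a (y *ᴷ ε) × trForm a y ≤ trForm a (y *ᴷ conj ε)

      module _ (a : K) (a≫0 : TotallyPositive a) where

        -- On integral elements the trace form is an integer combination of Tr a and Tr (a ω), hence
        -- of `re a` and `im a`, whose denominators `s` clears.
        integer-trForm : ∀ s → κ s *ᴷ a ∈ℤ[√d] → ∀ {y} → Integral y → IsInteger (⟦ + s ⟧ * trForm a y)
        integer-trForm s sa∈ {y} iy = helper (coordinates iy)
          where
          int-re : IsInteger (⟦ + s ⟧ * re a)
          int-re = subst IsInteger (cong re (fromℚ*≡ ⟦ + s ⟧ a)) (proj₁ sa∈)
          int-im : IsInteger (⟦ + s ⟧ * im a)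
          int-im = subst IsInteger (cong im (fromℚ*≡ ⟦ + s ⟧ a)) (proj₂ sa∈)
          eq : ∀ s a b X Y t D h → X * (s * a + s * a) + Y * (s * a * t + D * h * (s * b)) ≡ s *
            (X * (a + a) + Y * (a * t + D * h * b))
          eq = solve-∀ ℚ-ring
          helper : (∃₂ λ A B → y ≡ ι A B) → IsInteger (⟦ + s ⟧ * trForm a y)
          helper (A , B , y≡) = subst IsInteger
            (trans (eq ⟦ + s ⟧ (re a) (im a) ⟦ X ⟧ ⟦ Y ⟧ ⟦ t ⟧ dℚ ⟦ h ⟧)
              (cong (⟦ + s ⟧ *_) (sym (trans (cong (trForm a) y≡)
                (trans (trForm-ι a A B) (cong₂ (λ x z → ⟦ X ⟧ * x + ⟦ Y ⟧ * z) (Tr≡2re a) (Tr-*ω a)))))))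
            (integer-+ (integer-* (integer X) (integer-+ int-re int-re))
                       (integer-* (integer Y) (integer-+ (integer-* int-re (integer t))
                         (integer-* (integer-* (integer-fromℤ (+ d)) (integer h)) int-im))))
            where
            X = A ℤ.* A ℤ.+ n ℤ.* (B ℤ.* B)
            Y = A ℤ.* B ℤ.+ B ℤ.* A ℤ.+ t ℤ.* (B ℤ.* B)

        0<trForm : ∀ {y} → IsUnit y → 0ℚ < trForm a y
        0<trForm {y} (_ , v , _ , yv≡1) = subst (0ℚ <_) (sym (Tr≡2re (a *ᴷ (y *ᴷ y)))) (0<p+q 0<re 0<re)
          where 0<re = proj₁ (totallyPositive⇒ {a *ᴷ (y *ᴷ y)}
                  (totallyPositive-* {a} {y *ᴷ y} a≫0 (totallyPositive-square {y} (N-unit≢0 y v yv≡1))))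

        -- The values s Tr (a y²) are positive integers, so that passing to a shorter neighbour terminates.
        module Descent (s : ℕ) (s≢0 : s ≢ 0) (sa∈ : κ s *ᴷ a ∈ℤ[√d]) where

          0<s : 0ℚ < ⟦ + s ⟧
          0<s = 0<⟦⟧ (ℤ.+<+ (ℕₚ.n≢0⇒n>0 s≢0))

          Bounded : ℕ → K → Set
          Bounded fuel y = ⟦ + s ⟧ * trForm a y ≤ ⟦ + fuel ⟧

          shorter-bounded : ∀ {fuel y z} → IsUnit y → IsUnit z → trForm a z < trForm a y → Bounded (suc fuel) y →
            Bounded fuel z
          shorter-bounded {fuel} {y} {z} uy uz az<ay bounded = helper (integer-trForm s sa∈ (proj₁ uz))
            where
            saz< : ⟦ + s ⟧ * trForm a z < ⟦ + suc fuel ⟧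
            saz< = ℚ.<-≤-trans (ℚ.*-monoʳ-<-pos ⟦ + s ⟧ {{ℚ.positive 0<s}} az<ay) bounded
            helper : IsInteger (⟦ + s ⟧ * trForm a z) → Bounded fuel z
            helper (i , i≡) = subst (_≤ ⟦ + fuel ⟧) i≡
              -- Integrality turns the strict decrease into the loss of a whole unit of fuel.
              (⟦⟧-mono-≤ (ℤₚ.i<j⇒i≤pred[j] (⟦⟧-cancel-< (subst (_< ⟦ + suc fuel ⟧) (sym i≡) saz<))))

          descend : ∀ fuel y → IsUnit y → Bounded fuel y → ∃ λ z → IsUnit z × NoShorterNeighbour a z
          compare : ∀ fuel y → IsUnit y → Bounded (suc fuel) y → Dec (trForm a (y *ᴷ ε) < trForm a y) →
            Dec (trForm a (y *ᴷ conj ε) < trForm a y) →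
                    ∃ λ z → IsUnit z × NoShorterNeighbour a z

          descend zero       y uy bounded = contradiction (subst (⟦ + s ⟧ * trForm a y ≤_) ⟦0⟧ bounded)
            (<⇒≱ (0<p*q 0<s (0<trForm uy)))
          descend (suc fuel) y uy bounded = compare fuel y uy bounded (trForm a (y *ᴷ ε) ℚ.<? trForm a y)
            (trForm a (y *ᴷ conj ε) ℚ.<? trForm a y)

          compare fuel y uy bounded (yes shorter) _ =
            descend fuel (y *ᴷ ε) (unit-* uy unit-ε)
              (shorter-bounded {y = y} {z = y *ᴷ ε} uy (unit-* uy unit-ε) shorter bounded)
          compare fuel y uy bounded (no _) (yes shorter) =
            descend fuel (y *ᴷ conj ε) (unit-* uy (unit-conj unit-ε))
              (shorter-bounded {y = y} {z = y *ᴷ conj ε} uy (unit-* uy (unit-conj unit-ε)) shorter bounded)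
          compare fuel y uy bounded (no ≮ε) (no ≮ε̄) = y , uy , ℚ.≮⇒≥ ≮ε , ℚ.≮⇒≥ ≮ε̄

          shortest : ∃ λ z → IsUnit z × NoShorterNeighbour a z
          shortest = helper (integer-trForm s sa∈ integral-1)
            where
            helper : IsInteger (⟦ + s ⟧ * trForm a 1ᴷ) → ∃ λ z → IsUnit z × NoShorterNeighbour a z
            helper (i , i≡) = descend ℤ.∣ i ∣ 1ᴷ unit-1 (subst (_≤ ⟦ + ℤ.∣ i ∣ ⟧) i≡ (⟦⟧-mono-≤ (i≤∣i∣ i)))
              where
              i≤∣i∣ : ∀ i → i ℤ.≤ + ℤ.∣ i ∣
              i≤∣i∣ (+ _)    = ℤₚ.≤-refl
              i≤∣i∣ -[1+ _ ] = ℤ.-≤+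

        shortest : ∃ λ z → IsUnit z × NoShorterNeighbour a z
        shortest = helper (denominator a)
          where
          helper : (∃ λ s → s ≢ 0 × κ s *ᴷ a ∈ℤ[√d]) → ∃ λ z → IsUnit z × NoShorterNeighbour a z
          helper (s , s≢0 , sa∈) = Descent.shortest s s≢0 sa∈

      m≤trForm-conj-a₀ : ∀ x → Integral x → x ≢ 0ᴷ → m ≤ trForm (conj a₀) x
      m≤trForm-conj-a₀ x ix x≢0 = subst (m ≤_) (sym (trForm-conjˡ a₀ x))
        (a₀-minimum (conj x) (integral-conj ix) (conj≢0 x≢0))

      -- The two forms differ in the sign of `im`, so their values at `ε` differ by
      -- `8 d (- im a₀) re ε im ε`, a product of positive factors.
      m<trForm-conj-a₀-ε : m < trForm (conj a₀) ε
      m<trForm-conj-a₀-ε = <-by (0<p*q (0<p*q (0<p*q 0<8 0<dℚ) (ℚ.neg-antimono-< im-a₀<0)) (0<p*q 0<re-ε 0<im-ε))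
        (trans (cong (λ y → trForm (conj a₀) ε - y) (sym trForm-a₀-ε))
          (trans (cong₂ _-_ (trForm≡ (conj a₀) ε) (trForm≡ a₀ ε)) (eq dℚ (re a₀) (im a₀) (re ε) (im ε))))
        where
        0<8 : 0ℚ < 2ℚ * 4ℚ
        0<8 = ℚ.positive⁻¹ (2ℚ * 4ℚ)
        0<im-ε : 0ℚ < im ε
        0<im-ε = 0<p*q (0<⟦⟧ (ℤ.+<+ (s≤s z≤n))) (0<p*q 0<½ (0<⟦⟧ 0<h))
        0<re-ε : 0ℚ < re ε
        0<re-ε = subst (0ℚ <_) (trans (cong (½ *_) (_⊹_ {i = + 2 ℤ.* k} (_⊠_ {i = + 2} {j = k} ⟦2⟧ refl) refl))
          (trans (eq′ ⟦ k ⟧ ⟦ t ⟧) (cong (λ x → ⟦ k ⟧ + x * (½ * ⟦ t ⟧)) (sym ⟦1⟧)))) (0<p*q 0<½ (0<⟦⟧ 0<P))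
          where
          eq′ : ∀ k t → ½ * (2ℚ * k + t) ≡ k + 1ℚ * (½ * t)
          eq′ = solve-∀ ℚ-ring
        eq : ∀ D a b p q → 2ℚ * (a * (p * p + D * (q * q)) + D * ((- b) * (2ℚ * (p * q)))) - 2ℚ *
          (a * (p * p + D * (q * q)) + D * (b * (2ℚ * (p * q))))
                         ≡ 2ℚ * 4ℚ * D * (- b) * (p * q)
        eq = solve-∀ ℚ-ring

      -- At 1 the left side takes the value Tr (conj (a₀ ε²)) = `m`, and at `ε` the value N(ε)² Tr
      -- (conj a₀) = `m`; these two values determine `a₀`.
      conj-a₀*conj-ε²≡a₀ : conj a₀ *ᴷ (conj ε *ᴷ conj ε) ≡ a₀
      conj-a₀*conj-ε²≡a₀ = a₀-determined _ (trans (trForm-conj a₀ ε) trForm-a₀-ε) (begin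
          trForm (conj a₀ *ᴷ (conj ε *ᴷ conj ε)) ε  ≡⟨ trForm-* (conj a₀) (conj ε) ε ⟩
          trForm (conj a₀) (conj ε *ᴷ ε)            ≡⟨ cong (λ y → Tr (conj a₀ *ᴷ y)) square ⟩
          Tr (conj a₀ *ᴷ 1ᴷ)                        ≡⟨ cong Tr (*ᴷ-identityʳ (conj a₀)) ⟩
          Tr (conj a₀)                              ≡⟨ trans (Tr≡2re (conj a₀)) (trans (sym (Tr≡2re a₀)) Tr-a₀) ⟩
          m                                         ∎)
        where
        open ≡-Reasoning
        square : (conj ε *ᴷ ε) *ᴷ (conj ε *ᴷ ε) ≡ 1ᴷ
        square = trans (cong (λ y → y *ᴷ y) (trans (*ᴷ-comm (conj ε) ε) (x*conj-x≡N ε)))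
          (trans (fromℚ-* (N ε) (N ε)) (cong fromℚ (unit-norm² unit-ε)))

      Tr-fromℚ* : ∀ r a → Tr (fromℚ r *ᴷ a) ≡ r * Tr a
      Tr-fromℚ* r a = trans (Tr≡2re (fromℚ r *ᴷ a))
        (trans (cong (λ x → re x + re x) (fromℚ*≡ r a)) (trans (eq r (re a)) (cong (r *_) (sym (Tr≡2re a)))))
        where
        eq : ∀ r a → r * a + r * a ≡ r * (a + a)
        eq = solve-∀ ℚ-ring

      trForm-fromℚ* : ∀ r a x → trForm (fromℚ r *ᴷ a) x ≡ r * trForm a x
      trForm-fromℚ* r a x = trans (cong Tr (*ᴷ-assoc (fromℚ r) a (x *ᴷ x))) (Tr-fromℚ* r (a *ᴷ (x *ᴷ x)))

      -- b lies between the multiples λ a₀ and λ conj a₀ of the two perfect forms with minimal vector 1.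
      module Reduction (b : K) (b≫0 : TotallyPositive b) (b≤bε : trForm b 1ᴷ ≤ trForm b ε)
        (b≤bε̄ : trForm b 1ᴷ ≤ trForm b (conj ε)) where

        lam mu : ℚ
        lam = proj₁ (quotient (re b) (0<⇒≢0 0<re-a₀))
        mu  = proj₁ (quotient (im b) (ℚ.<⇒≢ im-a₀<0))

        lam≡ : lam * re a₀ ≡ re b
        lam≡ = proj₂ (quotient (re b) (0<⇒≢0 0<re-a₀))

        mu≡ : mu * im a₀ ≡ im b
        mu≡ = proj₂ (quotient (im b) (ℚ.<⇒≢ im-a₀<0))

        0<lam : 0ℚ < lam
        0<lam = 0<p*q⇒0<q (ℚ.<⇒≤ 0<re-a₀) (subst (0ℚ <_) (trans (sym lam≡) (ℚ.*-comm lam (re a₀)))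
          (proj₁ (totallyPositive⇒ {b} b≫0)))

        -- `2 b = (lam + mu) a₀ + (lam - mu) conj a₀`, with the common minimum `m` subtracted; the
        -- weights add up to `2 lam`.
        decomposition : ∀ x → 2ℚ * (trForm b x - lam * m) ≡ (lam + mu) * (trForm a₀ x - m) + (lam - mu) *
          (trForm (conj a₀) x - m)
        decomposition x = begin
          2ℚ * (trForm b x - lam * m)
            ≡⟨ cong (λ y → 2ℚ * (y - lam * m)) (trans (trForm≡ b x)
              (cong₂ (λ p q → 2ℚ * (p * X + dℚ * (q * Y))) (sym lam≡) (sym mu≡))) ⟩
          2ℚ * (2ℚ * (lam * re a₀ * X + dℚ * (mu * im a₀ * Y)) - lam * m)
            ≡⟨ eq dℚ lam mu (re a₀) (im a₀) X Y m ⟩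
          (lam + mu) * (2ℚ * (re a₀ * X + dℚ * (im a₀ * Y)) - m) + (lam - mu) *
            (2ℚ * (re a₀ * X + dℚ * (- im a₀ * Y)) - m)
            ≡⟨ cong₂ (λ p q → (lam + mu) * (p - m) + (lam - mu) * (q - m)) (trForm≡ a₀ x) (trForm≡ (conj a₀) x) ⟨
          (lam + mu) * (trForm a₀ x - m) + (lam - mu) * (trForm (conj a₀) x - m) ∎
          where
          open ≡-Reasoning
          X = re x * re x + dℚ * (im x * im x)
          Y = 2ℚ * (re x * im x)
          eq : ∀ D l u e f X Y m → 2ℚ * (2ℚ * (l * e * X + D * (u * f * Y)) - l * m) ≡ (l + u) *
            (2ℚ * (e * X + D * (f * Y)) - m) + (l - u) * (2ℚ * (e * X + D * (- f * Y)) - m)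
          eq = solve-∀ ℚ-ring

        trForm-b-1 : trForm b 1ᴷ ≡ lam * m
        trForm-b-1 = begin
          trForm b 1ᴷ                    ≡⟨ trForm-1 b ⟩
          Tr b                           ≡⟨ Tr≡2re b ⟩
          re b + re b                    ≡⟨ cong (λ x → x + x) lam≡ ⟨
          lam * re a₀ + lam * re a₀      ≡⟨ ℚ.*-distribˡ-+ lam (re a₀) (re a₀) ⟨
          lam * (re a₀ + re a₀)          ≡⟨ cong (lam *_) (trans (sym (Tr≡2re a₀)) Tr-a₀) ⟩
          lam * m                        ∎
          where open ≡-Reasoning

        0<2 : 0ℚ < 2ℚ
        0<2 = ℚ.positive⁻¹ 2ℚ

        excess≥0 : ∀ x → trForm b 1ᴷ ≤ trForm b x → 0ℚ ≤ 2ℚ * (trForm b x - lam * m)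
        excess≥0 x b1≤bx = 0≤p*q (ℚ.<⇒≤ 0<2) (p≤q⇒0≤q-p (subst (_≤ trForm b x) trForm-b-1 b1≤bx))

        m-m : ∀ p q x → p * (m - m) + q * x ≡ x * q
        m-m p q x = eq p q x m
          where
          eq : ∀ p q x m → p * (m - m) + q * x ≡ x * q
          eq = solve-∀ ℚ-ring

        m-m′ : ∀ p q x → p * x + q * (m - m) ≡ x * p
        m-m′ p q x = eq p q x m
          where
          eq : ∀ p q x m → p * x + q * (m - m) ≡ x * p
          eq = solve-∀ ℚ-ring

        -- At `ε` the `a₀` term of the decomposition vanishes and the other term has a positive
        -- factor, so its weight has the sign of the excess of `b` at `ε` over its value at 1.
        0≤lam-mu : 0ℚ ≤ lam - mu
        0≤lam-mu = 0≤p*q⇒0≤q (p<q⇒0<q-p m<trForm-conj-a₀-ε) (subst (0ℚ ≤_)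
          (trans (decomposition ε) (trans (cong (λ y → (lam + mu) * (y - m) + (lam - mu) * (trForm (conj a₀) ε - m))
            trForm-a₀-ε) (m-m (lam + mu) (lam - mu) (trForm (conj a₀) ε - m))))
          (excess≥0 ε b≤bε))

        0≤lam+mu : 0ℚ ≤ lam + mu
        0≤lam+mu = 0≤p*q⇒0≤q (p<q⇒0<q-p (subst (m <_) (trForm-conjˡ a₀ ε) m<trForm-conj-a₀-ε)) (subst (0ℚ ≤_)
          (trans (decomposition (conj ε)) (trans (cong
            (λ y → (lam + mu) * (trForm a₀ (conj ε) - m) + (lam - mu) * (y - m))
            (trans (trForm-conj a₀ ε) trForm-a₀-ε)) (m-m′ (lam + mu) (lam - mu) (trForm a₀ (conj ε) - m))))
          (excess≥0 (conj ε) b≤bε̄))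

        lam*m≤ : ∀ x → Integral x → x ≢ 0ᴷ → lam * m ≤ trForm b x
        lam*m≤ x ix x≢0 = 0≤q-p⇒p≤q (0≤p*q⇒0≤q 0<2 (subst (0ℚ ≤_) (sym (decomposition x))
          (0≤p+q (0≤p*q 0≤lam+mu (p≤q⇒0≤q-p (a₀-minimum x ix x≢0)))
            (0≤p*q 0≤lam-mu (p≤q⇒0≤q-p (m≤trForm-conj-a₀ x ix x≢0))))))

        minimum≡lam*m : ∀ {μ} → IsTraceMinimum b μ → μ ≡ lam * m
        minimum≡lam*m {μ} ((x , ix , x≢0 , bx≡μ) , min) =
          ℚ.≤-antisym (subst (μ ≤_) trForm-b-1 (min 1ᴷ integral-1 1≢0)) (subst (lam * m ≤_) bx≡μ (lam*m≤ x ix x≢0))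

        -- Two nonnegative summands of the decomposition add up to 0, so the one with positive
        -- weight vanishes.
        minimal⇒minimal-a₀ : 0ℚ < lam + mu → ∀ x → Integral x → trForm b x ≡ lam * m → trForm a₀ x ≡ m
        minimal⇒minimal-a₀ 0<lam+mu x ix bx≡ = ℚ.≤-antisym
          (0≤q-p⇒p≤q (0≤p*q⇒0≤q 0<lam+mu (subst (0ℚ ≤_) excess≡ (0≤p*q 0≤lam-mu 0≤V)))) (0≤q-p⇒p≤q 0≤U)
          where
          x≢0 : x ≢ 0ᴷ
          x≢0 refl = 0<⇒≢0 (0<p*q 0<lam (0<⟦⟧ (0<i*j 0<M 0<P)))
            (trans (sym bx≡) (trans (trForm≡ b 0ᴷ) (eq dℚ (re b) (im b))))
            where
            eq : ∀ D a b → 2ℚ * (a * (0ℚ * 0ℚ + D * (0ℚ * 0ℚ)) + D * (b * (2ℚ * (0ℚ * 0ℚ)))) ≡ 0ℚ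
            eq = solve-∀ ℚ-ring
          0≤U = p≤q⇒0≤q-p (a₀-minimum x ix x≢0)
          0≤V = p≤q⇒0≤q-p (m≤trForm-conj-a₀ x ix x≢0)
          eq₁ : ∀ p q U V → q * V ≡ (p * U + q * V) - p * U
          eq₁ = solve-∀ ℚ-ring
          eq₂ : ∀ p U lm → 2ℚ * (lm - lm) - p * U ≡ p * (- U)
          eq₂ = solve-∀ ℚ-ring
          eq₃ : ∀ a m → - (a - m) ≡ m - a
          eq₃ = solve-∀ ℚ-ring
          open ≡-Reasoning
          U = trForm a₀ x - m
          V = trForm (conj a₀) x - m
          excess≡ : (lam - mu) * V ≡ (lam + mu) * (m - trForm a₀ x)
          excess≡ = begin
            (lam - mu) * V                                           ≡⟨ eq₁ (lam + mu) (lam - mu) U V ⟩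
            ((lam + mu) * U + (lam - mu) * V) - (lam + mu) * U       ≡⟨ cong (_- (lam + mu) * U) (decomposition x) ⟨
            2ℚ * (trForm b x - lam * m) - (lam + mu) * U
              ≡⟨ cong (λ y → 2ℚ * (y - lam * m) - (lam + mu) * U) bx≡ ⟩
            2ℚ * (lam * m - lam * m) - (lam + mu) * U                ≡⟨ eq₂ (lam + mu) U (lam * m) ⟩
            (lam + mu) * (- U)                                       ≡⟨ cong ((lam + mu) *_) (eq₃ (trForm a₀ x) m) ⟩
            (lam + mu) * (m - trForm a₀ x)                           ∎

        homothetic : Perfect b → ∃₂ λ r u → 0ℚ < r × IsUnit u × b *ᴷ (u *ᴷ u) ≡ fromℚ r *ᴷ a₀
        homothetic (_ , μ , min , unique) = cases (ℚ.<-cmp 0ℚ (lam + mu))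
          where
          cases : _ → ∃₂ λ r u → 0ℚ < r × IsUnit u × b *ᴷ (u *ᴷ u) ≡ fromℚ r *ᴷ a₀
          -- `lam a₀` agrees with `b` at every minimal vector of `b`, so perfection of `b` forces
          -- equality.
          cases (tri< 0<lam+mu _ _) = lam , 1ᴷ , 0<lam , unit-1 ,
            trans (cong (b *ᴷ_) (*ᴷ-identityˡ 1ᴷ)) (trans (*ᴷ-identityʳ b)
            (sym (unique (fromℚ lam *ᴷ a₀) (totallyPositive-fromℚ* {lam} {a₀} 0<lam a₀≫0) λ w (iw , bw≡μ) →
              trans (trForm-fromℚ* lam a₀ w) (trans
                (cong (lam *_) (minimal⇒minimal-a₀ 0<lam+mu w iw (trans bw≡μ (minimum≡lam*m min))))
                (sym (minimum≡lam*m min))))))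
          cases (tri≈ _ 0≡lam+mu _) = lam , conj ε , 0<lam , unit-conj unit-ε , (begin
            b *ᴷ (conj ε *ᴷ conj ε)                                 ≡⟨ cong (_*ᴷ (conj ε *ᴷ conj ε)) b≡ ⟩
            (fromℚ lam *ᴷ conj a₀) *ᴷ (conj ε *ᴷ conj ε)
              ≡⟨ *ᴷ-assoc (fromℚ lam) (conj a₀) (conj ε *ᴷ conj ε) ⟩
            fromℚ lam *ᴷ (conj a₀ *ᴷ (conj ε *ᴷ conj ε))            ≡⟨ cong (fromℚ lam *ᴷ_) conj-a₀*conj-ε²≡a₀ ⟩
            fromℚ lam *ᴷ a₀                                         ∎)
            where
            open ≡-Reasoning
            eq : ∀ l u f → l * (- f) ≡ u * f - (l + u) * f
            eq = solve-∀ ℚ-ring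
            eq′ : ∀ u f → u * f - 0ℚ * f ≡ u * f
            eq′ = solve-∀ ℚ-ring
            b≡ : b ≡ fromℚ lam *ᴷ conj a₀
            b≡ = sym (trans (fromℚ*≡ lam (conj a₀))
              (cong₂ _+√d_ lam≡ (trans (eq lam mu (im a₀))
              (trans (cong (λ z → mu * im a₀ - z * im a₀) (sym 0≡lam+mu)) (trans (eq′ mu (im a₀)) mu≡)))))
          cases (tri> _ _ lam+mu<0) = contradiction 0≤lam+mu (<⇒≱ lam+mu<0)

      perfect⇒homothetic : ∀ {a} → Perfect a → ∃₂ λ r u → 0ℚ < r × IsUnit u × a *ᴷ (u *ᴷ u) ≡ fromℚ r *ᴷ a₀
      perfect⇒homothetic {a} pa = helper (shortest a (proj₁ pa))
        where
        helper : (∃ λ y → IsUnit y × NoShorterNeighbour a y) → ∃₂ λ r u →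
          0ℚ < r × IsUnit u × a *ᴷ (u *ᴷ u) ≡ fromℚ r *ᴷ a₀
        helper (y , uy , ≤ε , ≤ε̄) = combine (Reduction.homothetic b (proj₁ pb) (neighbour ε ≤ε)
          (neighbour (conj ε) ≤ε̄) pb)
          where
          b = a *ᴷ (y *ᴷ y)
          pb = perfect-* pa uy
          neighbour : ∀ e → trForm a y ≤ trForm a (y *ᴷ e) → trForm b 1ᴷ ≤ trForm b e
          neighbour e = subst₂ _≤_ (sym (trans (trForm-* a y 1ᴷ) (cong (trForm a) (*ᴷ-identityʳ y))))
            (sym (trForm-* a y e))
          regroup : ∀ a y u → a *ᴷ ((y *ᴷ u) *ᴷ (y *ᴷ u)) ≡ (a *ᴷ (y *ᴷ y)) *ᴷ (u *ᴷ u)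
          regroup = K-Solver.solve 3 (λ a y u → a :* ((y :* u) :* (y :* u)) := (a :* (y :* y)) :* (u :* u)) refl
            where open K-Solver using (_:*_; _:=_)
          combine : (∃₂ λ r u → 0ℚ < r × IsUnit u × b *ᴷ (u *ᴷ u) ≡ fromℚ r *ᴷ a₀) → ∃₂ λ r u →
            0ℚ < r × IsUnit u × a *ᴷ (u *ᴷ u) ≡ fromℚ r *ᴷ a₀
          combine (r , u , 0<r , uu , eq) = r , y *ᴷ u , 0<r , unit-* uy uu , trans (regroup a y u) eq

      unit⇒one-class : NumberOfPerfectClasses 1
      unit⇒one-class = record
        { to = λ _ → f₀
        ; cong = λ _ → Setoid.refl PerfectClasses
        ; bijective = (λ { {Fin.zero} {Fin.zero} _ → refl }) , λ f → Fin.zero , λ _ →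
          connect f (perfect⇒homothetic (proj₂ f))
        }
        where
        f₀ : PerfectForm
        f₀ = a₀ , a₀-perfect
        connect : ∀ f → (∃₂ λ r u → 0ℚ < r × IsUnit u × proj₁ f *ᴷ (u *ᴷ u) ≡ fromℚ r *ᴷ a₀) → f₀ ≈ᶠ f
        connect f@(a , pa) (r , u , 0<r , uu , eq) =
          transᶠ {f₀} {g} {f} (Closure.return (inj₂ (r , 0<r , eq)))
          (symᶠ {f} {g} (Closure.return (inj₁ (u , uu , refl))))
          where
          -- A chain in `PerfectClasses` runs through perfect forms only, so the form between the
          -- homothety and the unit must be shown perfect too.
          g : PerfectForm
          g = a *ᴷ (u *ᴷ u) , perfect-* pa uu

  -- Integral bases by residues modulo 4.

  parity : ∀ i → ∃ λ a → i ≡ + 2 ℤ.* a ⊎ i ≡ + 2 ℤ.* a ℤ.+ 1ℤ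
  parity i = i ℤ./ℕ 2 , cases (i ℤ.%ℕ 2) (ℤ.n%ℕd<d i 2) (ℤ.a≡a%ℕn+[a/ℕn]*n i 2)
    where
    even : ∀ q → + 0 ℤ.+ q ℤ.* + 2 ≡ + 2 ℤ.* q
    even = ℤ-Solver.solve-∀
    odd : ∀ q → + 1 ℤ.+ q ℤ.* + 2 ≡ + 2 ℤ.* q ℤ.+ 1ℤ
    odd = ℤ-Solver.solve-∀
    cases : ∀ r {q} → r ℕ.< 2 → i ≡ + r ℤ.+ q ℤ.* + 2 → i ≡ + 2 ℤ.* q ⊎ i ≡ + 2 ℤ.* q ℤ.+ 1ℤ
    cases 0 {q} _ eq = inj₁ (trans eq (even q))
    cases 1 {q} _ eq = inj₂ (trans eq (odd q))
    cases (suc (suc _)) (s≤s (s≤s ())) _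

  4∣⇒≡0 : ∀ {z i} → ℤ.∣ i ∣ ℕ.< 4 → + 4 ℤ.* z ≡ i → i ≡ 0ℤ
  4∣⇒≡0 {z} {i} ∣i∣<4 4z≡i = ℤₚ.∣i∣≡0⇒i≡0 (multiple {ℤ.∣ z ∣} (trans (sym (ℤₚ.abs-* (+ 4) z)) (cong ℤ.∣_∣ 4z≡i))
    ∣i∣<4)
    where
    multiple : ∀ {n r} → 4 ℕ.* n ≡ r → r ℕ.< 4 → r ≡ 0
    multiple {zero}  refl _   = refl
    multiple {suc n} refl r<4 = contradiction r<4 (ℕₚ.≤⇒≯ (ℕₚ.m≤m*n 4 (suc n)))

  -- T = 2 a + i and B = 2 b + j satisfy T² - d B² ≡ i² - r j² modulo 4.
  module Congruence {d : ℕ} {q r : ℤ} (d≡ : + d ≡ + 4 ℤ.* q ℤ.+ r) where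

    residue : ∀ a i b j M → (+ 2 ℤ.* a ℤ.+ i) ℤ.* (+ 2 ℤ.* a ℤ.+ i) ℤ.- + d ℤ.*
      ((+ 2 ℤ.* b ℤ.+ j) ℤ.* (+ 2 ℤ.* b ℤ.+ j)) ≡ + 4 ℤ.* M →
              ∃ λ z → + 4 ℤ.* z ≡ i ℤ.* i ℤ.- r ℤ.* (j ℤ.* j)
    residue a i b j M eq = z , trans (eq₂ q r a i b j M)
      (trans (cong (λ w → w ℤ.- (+ 2 ℤ.* a ℤ.+ i) ℤ.* (+ 2 ℤ.* a ℤ.+ i) ℤ.+ (+ 4 ℤ.* q ℤ.+ r) ℤ.*
      ((+ 2 ℤ.* b ℤ.+ j) ℤ.* (+ 2 ℤ.* b ℤ.+ j)) ℤ.+ i ℤ.* i ℤ.- r ℤ.* (j ℤ.* j))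
        (trans (sym eq) (cong (λ d → (+ 2 ℤ.* a ℤ.+ i) ℤ.* (+ 2 ℤ.* a ℤ.+ i) ℤ.- d ℤ.*
          ((+ 2 ℤ.* b ℤ.+ j) ℤ.* (+ 2 ℤ.* b ℤ.+ j))) d≡)))
          (eq₃ ((+ 2 ℤ.* a ℤ.+ i) ℤ.* (+ 2 ℤ.* a ℤ.+ i))
          ((+ 4 ℤ.* q ℤ.+ r) ℤ.* ((+ 2 ℤ.* b ℤ.+ j) ℤ.* (+ 2 ℤ.* b ℤ.+ j))) (i ℤ.* i) (r ℤ.* (j ℤ.* j))))
      where
      z = M ℤ.- a ℤ.* a ℤ.- a ℤ.* i ℤ.+ q ℤ.* ((+ 2 ℤ.* b ℤ.+ j) ℤ.* (+ 2 ℤ.* b ℤ.+ j)) ℤ.+ r ℤ.*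
        (b ℤ.* b ℤ.+ b ℤ.* j)
      eq₂ : ∀ q r a i b j M → + 4 ℤ.* (M ℤ.- a ℤ.* a ℤ.- a ℤ.* i ℤ.+ q ℤ.* ((+ 2 ℤ.* b ℤ.+ j) ℤ.* (+ 2 ℤ.* b ℤ.+ j))
        ℤ.+ r ℤ.* (b ℤ.* b ℤ.+ b ℤ.* j))
           ≡ + 4 ℤ.* M ℤ.- (+ 2 ℤ.* a ℤ.+ i) ℤ.* (+ 2 ℤ.* a ℤ.+ i) ℤ.+ (+ 4 ℤ.* q ℤ.+ r) ℤ.*
             ((+ 2 ℤ.* b ℤ.+ j) ℤ.* (+ 2 ℤ.* b ℤ.+ j)) ℤ.+ i ℤ.* i ℤ.- r ℤ.* (j ℤ.* j)
      eq₂ = ℤ-Solver.solve-∀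
      eq₃ : ∀ X Y I J → X ℤ.- Y ℤ.- X ℤ.+ Y ℤ.+ I ℤ.- J ≡ I ℤ.- J
      eq₃ = ℤ-Solver.solve-∀

    residue≡0 : ∀ {T B} a i b j M → T ≡ + 2 ℤ.* a ℤ.+ i → B ≡ + 2 ℤ.* b ℤ.+ j →
      T ℤ.* T ℤ.- + d ℤ.* (B ℤ.* B) ≡ + 4 ℤ.* M →
                ℤ.∣ i ℤ.* i ℤ.- r ℤ.* (j ℤ.* j) ∣ ℕ.< 4 → i ℤ.* i ℤ.- r ℤ.* (j ℤ.* j) ≡ 0ℤ
    residue≡0 a i b j M refl refl eq small = 4∣⇒≡0 {proj₁ (residue a i b j M eq)} small (proj₂ (residue a i b j M eq))

  even-form : ∀ {i a} → i ≡ + 2 ℤ.* a → i ≡ + 2 ℤ.* a ℤ.+ 0ℤ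
  even-form {a = a} eq = trans eq (sym (ℤₚ.+-identityʳ (+ 2 ℤ.* a)))

  -- For parities `i`, `j` not both 0, `i² - r j²` is not divisible by 4; so `T` and `B` are even
  -- and `ω` is √d.
  basis₂₃ : ∀ {d} → 0 ℕ.< d → ∀ q r → r ≡ + 2 ⊎ r ≡ + 3 → + d ≡ + 4 ℤ.* q ℤ.+ r → IntegralBasis d
  basis₂₃ {d} 0<d q r r≡ d≡ = record
    { t = 0ℤ ; h = + 2 ; n = + d
    ; t,h = inj₁ (refl , refl)
    ; h²d≡t²+4n = sym (ℤₚ.+-identityˡ (+ 4 ℤ.* + d))
    ; 0<n = ℤ.+<+ 0<d
    ; complete = λ T B M eq → halves r≡ T B M eq (parity T) (parity B)
    }
    where
    open Congruence {d} {q} {r} d≡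
    eq₁ : ∀ a b → + 2 ℤ.* a ≡ + 2 ℤ.* a ℤ.+ 0ℤ ℤ.* b
    eq₁ = ℤ-Solver.solve-∀
    halves : r ≡ + 2 ⊎ r ≡ + 3 → ∀ T B M → T ℤ.* T ℤ.- + d ℤ.* (B ℤ.* B) ≡ + 4 ℤ.* M →
             (∃ λ a → T ≡ + 2 ℤ.* a ⊎ T ≡ + 2 ℤ.* a ℤ.+ 1ℤ) → (∃ λ b → B ≡ + 2 ℤ.* b ⊎ B ≡ + 2 ℤ.* b ℤ.+ 1ℤ) →
             ∃₂ λ A C → T ≡ + 2 ℤ.* A ℤ.+ 0ℤ ℤ.* C × B ≡ + 2 ℤ.* C
    halves _ T B M eq (a , inj₁ T≡) (b , inj₁ B≡) = a , b , trans T≡ (eq₁ a b) , B≡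
    halves (inj₁ refl) T B M eq (a , inj₁ T≡) (b , inj₂ B≡) =
      contradiction (residue≡0 a 0ℤ b 1ℤ M (even-form {a = a} T≡) B≡ eq (s≤s (s≤s (s≤s z≤n)))) λ ()
    halves (inj₂ refl) T B M eq (a , inj₁ T≡) (b , inj₂ B≡) =
      contradiction (residue≡0 a 0ℤ b 1ℤ M (even-form {a = a} T≡) B≡ eq (s≤s (s≤s (s≤s (s≤s z≤n))))) λ ()
    halves (inj₁ refl) T B M eq (a , inj₂ T≡) (b , inj₁ B≡) =
      contradiction (residue≡0 a 1ℤ b 0ℤ M T≡ (even-form {a = b} B≡) eq (s≤s (s≤s z≤n))) λ ()
    halves (inj₂ refl) T B M eq (a , inj₂ T≡) (b , inj₁ B≡) =
      contradiction (residue≡0 a 1ℤ b 0ℤ M T≡ (even-form {a = b} B≡) eq (s≤s (s≤s z≤n))) λ ()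
    halves (inj₁ refl) T B M eq (a , inj₂ T≡) (b , inj₂ B≡) =
      contradiction (residue≡0 a 1ℤ b 1ℤ M T≡ B≡ eq (s≤s (s≤s z≤n))) λ ()
    halves (inj₂ refl) T B M eq (a , inj₂ T≡) (b , inj₂ B≡) =
      contradiction (residue≡0 a 1ℤ b 1ℤ M T≡ B≡ eq (s≤s (s≤s (s≤s z≤n)))) λ ()

  -- Here `i² - j²` only rules out different parities, so `T - B` is even, which is the condition
  -- for the basis with `ω = (1 + √d) / 2`.
  basis₁ : ∀ {d} q → 0ℤ ℤ.< q → + d ≡ + 4 ℤ.* q ℤ.+ 1ℤ → IntegralBasis d
  basis₁ {d} q 0<q d≡ = record
    { t = 1ℤ ; h = 1ℤ ; n = q
    ; t,h = inj₂ (refl , refl)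
    ; h²d≡t²+4n = trans (ℤₚ.*-identityˡ (+ d)) (trans d≡ (ℤₚ.+-comm (+ 4 ℤ.* q) 1ℤ))
    ; 0<n = 0<q
    ; complete = λ T B M eq → halves T B M eq (parity T) (parity B)
    }
    where
    open Congruence {d} {q} {1ℤ} d≡
    eq₀ : ∀ a b → + 2 ℤ.* a ≡ + 2 ℤ.* (a ℤ.- b) ℤ.+ 1ℤ ℤ.* (+ 2 ℤ.* b)
    eq₀ = ℤ-Solver.solve-∀
    eq₁ : ∀ a b → + 2 ℤ.* a ℤ.+ 1ℤ ≡ + 2 ℤ.* (a ℤ.- b) ℤ.+ 1ℤ ℤ.* (+ 2 ℤ.* b ℤ.+ 1ℤ)
    eq₁ = ℤ-Solver.solve-∀
    halves : ∀ T B M → T ℤ.* T ℤ.- + d ℤ.* (B ℤ.* B) ≡ + 4 ℤ.* M →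
             (∃ λ a → T ≡ + 2 ℤ.* a ⊎ T ≡ + 2 ℤ.* a ℤ.+ 1ℤ) → (∃ λ b → B ≡ + 2 ℤ.* b ⊎ B ≡ + 2 ℤ.* b ℤ.+ 1ℤ) →
             ∃₂ λ A C → T ≡ + 2 ℤ.* A ℤ.+ 1ℤ ℤ.* C × B ≡ 1ℤ ℤ.* C
    halves T B M eq (a , inj₁ refl) (b , inj₁ refl) = a ℤ.- b , B , eq₀ a b , sym (ℤₚ.*-identityˡ B)
    halves T B M eq (a , inj₂ refl) (b , inj₂ refl) = a ℤ.- b , B , eq₁ a b , sym (ℤₚ.*-identityˡ B)
    halves T B M eq (a , inj₁ T≡) (b , inj₂ B≡) = contradiction
      (residue≡0 a 0ℤ b 1ℤ M (even-form {a = a} T≡) B≡ eq (s≤s (s≤s z≤n))) λ ()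
    halves T B M eq (a , inj₂ T≡) (b , inj₁ B≡) = contradiction
      (residue≡0 a 1ℤ b 0ℤ M T≡ (even-form {a = b} B≡) eq (s≤s (s≤s z≤n))) λ ()

  -- Existence of a suitable `k` for every `n`.

  reduced-suc : ∀ {t n} → 0ℤ ℤ.≤ t → t ℤ.≤ 1ℤ → (∃ λ k → Reduced t n k) → ∃ λ k → Reduced t (n ℤ.+ 1ℤ) k
  reduced-suc {t} {n} 0≤t t≤1 (k , reduced) = cases (ℤ.- k ℤₚ.≤? c ℤ.- 1ℤ)
    where
    open Reduced reduced
    c = k ℤ.* k ℤ.+ t ℤ.* k ℤ.- n ℤ.+ 1ℤ
    eq₁ : ∀ t n k → k ℤ.* k ℤ.+ t ℤ.* k ℤ.- n ℤ.+ 1ℤ ℤ.- 1ℤ ≡ k ℤ.* k ℤ.+ t ℤ.* k ℤ.- (n ℤ.+ 1ℤ) ℤ.+ 1ℤ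
    eq₁ = ℤ-Solver.solve-∀
    eq₂ : ∀ t n k → (k ℤ.+ 1ℤ) ℤ.* (k ℤ.+ 1ℤ) ℤ.+ t ℤ.* (k ℤ.+ 1ℤ) ℤ.- (n ℤ.+ 1ℤ) ℤ.+ 1ℤ ≡ k ℤ.* k ℤ.+ t ℤ.* k ℤ.- n
      ℤ.+ 1ℤ ℤ.+ (+ 2 ℤ.* k ℤ.+ t)
    eq₂ = ℤ-Solver.solve-∀
    eq₃ : ∀ t k → ℤ.- k ℤ.+ (+ 2 ℤ.* k ℤ.+ t) ≡ k ℤ.+ t
    eq₃ = ℤ-Solver.solve-∀
    eq₄ : ∀ t k → k ℤ.+ t ℤ.+ 1ℤ ≡ k ℤ.+ 1ℤ ℤ.+ t
    eq₄ = ℤ-Solver.solve-∀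
    0≤k+1 = 0≤i+j 0≤k (ℤ.+≤+ {0} {1} z≤n)
    cases : Dec (ℤ.- k ℤ.≤ c ℤ.- 1ℤ) → ∃ λ k → Reduced t (n ℤ.+ 1ℤ) k
    cases (yes -k≤c-1) = k , record
      { 0≤k = 0≤k ; 0<k+t = 0<k+t
      ; c≤k = subst (ℤ._≤ k) (eq₁ t n k) (ℤₚ.≤-trans (ℤₚ.i-j≤i c 1ℤ) c≤k)
      ; -k≤c = subst (ℤ.- k ℤ.≤_) (eq₁ t n k) -k≤c-1 }
    -- Now `c = - k`. The step to `k + 1` adds `2 k + t + 1` to the norm and the step to `n + 1`
    -- subtracts 1, so the new `c` is `k + t ≤ k + 1`.
    cases (no -k≰c-1) = k ℤ.+ 1ℤ , record
      { 0≤k = 0≤k+1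
      ; 0<k+t = subst (0ℤ ℤ.<_) (eq₄ t k) (ℤₚ.+-mono-<-≤ 0<k+t (ℤ.+≤+ {0} {1} z≤n))
      ; c≤k = subst (ℤ._≤ k ℤ.+ 1ℤ) (sym c′≡) (ℤₚ.+-monoʳ-≤ k t≤1)
      ; -k≤c = subst (ℤ.- (k ℤ.+ 1ℤ) ℤ.≤_) (sym c′≡) (ℤₚ.≤-trans (ℤₚ.neg-mono-≤ 0≤k+1) (ℤₚ.<⇒≤ 0<k+t)) }
      where
      eq₅ : ∀ c → 1ℤ ℤ.+ (c ℤ.- 1ℤ) ≡ c
      eq₅ = ℤ-Solver.solve-∀
      c≡-k : c ≡ ℤ.- k
      c≡-k = ℤₚ.≤-antisym (subst (ℤ._≤ ℤ.- k) (eq₅ c) (ℤₚ.i<j⇒suc[i]≤j (ℤₚ.≰⇒> -k≰c-1))) -k≤c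
      c′≡ : (k ℤ.+ 1ℤ) ℤ.* (k ℤ.+ 1ℤ) ℤ.+ t ℤ.* (k ℤ.+ 1ℤ) ℤ.- (n ℤ.+ 1ℤ) ℤ.+ 1ℤ ≡ k ℤ.+ t
      c′≡ = trans (eq₂ t n k) (trans (cong (λ x → x ℤ.+ (+ 2 ℤ.* k ℤ.+ t)) c≡-k) (eq₃ t k))

  reduced-exists : ∀ {t} → t ≡ 0ℤ ⊎ t ≡ 1ℤ → ∀ n → ∃ λ k → Reduced t (+ suc n) k
  -- For `t = 0` the condition `0 < k + t` excludes `k = 0`; `k = 1` gives `c = 1`. For `t = 1`,
  -- `k = 0` gives `c = 0`.
  reduced-exists (inj₁ refl) zero = 1ℤ , record { 0≤k = ℤ.+≤+ z≤n ; 0<k+t = ℤ.+<+ (s≤s z≤n) ; c≤k = ℤₚ.≤-refl ; -k≤c =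
    ℤ.-≤+ }
  reduced-exists (inj₂ refl) zero = 0ℤ , record { 0≤k = ℤ.+≤+ z≤n ; 0<k+t = ℤ.+<+ (s≤s z≤n) ; c≤k = ℤₚ.≤-refl ; -k≤c =
    ℤₚ.≤-refl }
  reduced-exists {t} t≡ (suc n) = subst (λ i → ∃ λ k → Reduced t i k) (cong +_ (ℕₚ.+-comm (suc n) 1))
    (reduced-suc (0≤ t≡) (≤1 t≡) (reduced-exists t≡ n))
    where
    0≤ : t ≡ 0ℤ ⊎ t ≡ 1ℤ → 0ℤ ℤ.≤ t
    0≤ (inj₁ refl) = ℤ.+≤+ z≤n
    0≤ (inj₂ refl) = ℤ.+≤+ z≤n
    ≤1 : t ≡ 0ℤ ⊎ t ≡ 1ℤ → t ℤ.≤ 1ℤ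
    ≤1 (inj₁ refl) = ℤ.+≤+ z≤n
    ≤1 (inj₂ refl) = ℤ.+≤+ (s≤s z≤n)

  -- The four types and the units of the form `A + ω`.

  OfType : ℕ → Set
  OfType d = (∃ λ m → 2 ℕᵈ.∤ m × d ≡ m ℕ.^ 2 ℕ.+ 1)
           ⊎ (∃ λ m → 2 ℕᵈ.∣ m × d ≡ m ℕ.^ 2 ℕ.∸ 1)
           ⊎ (∃ λ m → 2 ℕᵈ.∤ m × d ≡ m ℕ.^ 2 ℕ.+ 4)
           ⊎ (∃ λ m → 2 ℕᵈ.∤ m × 3 ℕ.< m × d ≡ m ℕ.^ 2 ℕ.∸ 4)

  odd : ∀ m → 2 ℕᵈ.∤ m → ∃ λ j → m ≡ 2 ℕ.* j ℕ.+ 1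
  odd m 2∤m = cases (m ℕ.% 2) (ℕ.m%n<n m 2) (ℕ.m≡m%n+[m/n]*n m 2)
    where
    eq : ∀ q → 1 ℕ.+ q ℕ.* 2 ≡ 2 ℕ.* q ℕ.+ 1
    eq = ℕ-Solver.solve-∀
    cases : ∀ r → r ℕ.< 2 → m ≡ r ℕ.+ m ℕ./ 2 ℕ.* 2 → ∃ λ j → m ≡ 2 ℕ.* j ℕ.+ 1
    cases 0 _ m≡ = contradiction (ℕᵈ.divides (m ℕ./ 2) m≡) 2∤m
    cases 1 _ m≡ = m ℕ./ 2 , trans m≡ (eq (m ℕ./ 2))
    cases (suc (suc _)) (s≤s (s≤s ())) _

  m^2≡m*m : ∀ m → m ℕ.^ 2 ≡ m ℕ.* m
  m^2≡m*m m = cong (m ℕ.*_) (ℕₚ.*-identityʳ m)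

  ∣i∣*∣i∣≡i*i : ∀ i → + (ℤ.∣ i ∣ ℕ.* ℤ.∣ i ∣) ≡ i ℤ.* i
  ∣i∣*∣i∣≡i*i (+ n)    = ℤₚ.pos-* n n
  ∣i∣*∣i∣≡i*i -[1+ n ] = refl

  module _ {d : ℕ} (1<d : 1 ℕ.< d) (squareFree : SquareFree d) where

    0<d : 0 ℕ.< d
    0<d = ℕₚ.<⇒≤ 1<d

    4∤d : ∀ q → d ≢ q ℕ.* 4
    4∤d q d≡ = contradiction (squareFree 2 (ℕᵈ.divides q d≡)) λ ()

    module _ (m : ℕ) where

      -- For odd `m = 2 j + 1` the number `m² - 1 = 4 (j² + j)` is not square-free.
      m*m≡d+1⇒ofType : m ℕ.* m ≡ d ℕ.+ 1 → OfType d
      m*m≡d+1⇒ofType m²≡ with 2 ℕᵈ.∣? m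
      ... | yes 2∣m = inj₂ (inj₁ (m , 2∣m , trans (sym (ℕₚ.m+n∸n≡m d 1))
        (cong (ℕ._∸ 1) (trans (sym m²≡) (sym (m^2≡m*m m))))))
      ... | no  2∤m with odd m 2∤m
      ...   | j , m≡ = contradiction (ℕₚ.+-cancelʳ-≡ 1 d _ (trans (sym m²≡) (trans (cong (λ m → m ℕ.* m) m≡) (eq j))))
        (4∤d (j ℕ.* j ℕ.+ j))
        where
        eq : ∀ j → (2 ℕ.* j ℕ.+ 1) ℕ.* (2 ℕ.* j ℕ.+ 1) ≡ (j ℕ.* j ℕ.+ j) ℕ.* 4 ℕ.+ 1
        eq = ℕ-Solver.solve-∀

      -- An even `m` would make `d` congruent to 1 modulo 4.
      d≡m*m+1⇒ofType : (∀ q → d ≢ 1 ℕ.+ q ℕ.* 4) → d ≡ m ℕ.* m ℕ.+ 1 → OfType d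
      d≡m*m+1⇒ofType d≢1 d≡ = inj₁ (m , 2∤m , trans d≡ (cong (ℕ._+ 1) (sym (m^2≡m*m m))))
        where
        eq : ∀ j → (j ℕ.* 2) ℕ.* (j ℕ.* 2) ℕ.+ 1 ≡ 1 ℕ.+ (j ℕ.* j) ℕ.* 4
        eq = ℕ-Solver.solve-∀
        2∤m : 2 ℕᵈ.∤ m
        2∤m (ℕᵈ.divides j m≡) = d≢1 (j ℕ.* j) (trans d≡ (trans (cong (λ m → m ℕ.* m ℕ.+ 1) m≡) (eq j)))

      d≡m*m+4⇒ofType : 2 ℕᵈ.∤ m → d ≡ m ℕ.* m ℕ.+ 4 → OfType d
      d≡m*m+4⇒ofType 2∤m d≡ = inj₂ (inj₂ (inj₁ (m , 2∤m , trans d≡ (cong (ℕ._+ 4) (sym (m^2≡m*m m))))))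

    -- The case m = 3, d = 5 = 1² + 4 is of type (T3).
    m*m≡d+4⇒ofType : ∀ m → 2 ℕᵈ.∤ m → m ℕ.* m ≡ d ℕ.+ 4 → OfType d
    m*m≡d+4⇒ofType 0 _ m²≡ = contradiction (trans m²≡ (ℕₚ.+-comm d 4)) λ ()
    m*m≡d+4⇒ofType 1 _ m²≡ = contradiction (trans m²≡ (ℕₚ.+-comm d 4)) λ ()
    m*m≡d+4⇒ofType 2 2∤m _ = contradiction ℕᵈ.∣-refl 2∤m
    m*m≡d+4⇒ofType 3 _ m²≡ = inj₂ (inj₂ (inj₁ (1 , (λ 2∣1 → contradiction (ℕᵈ.∣1⇒≡1 2∣1) λ ()) ,
      ℕₚ.+-cancelʳ-≡ 4 d 5 (sym m²≡))))
    m*m≡d+4⇒ofType m@(suc (suc (suc (suc _)))) 2∤m m²≡ = inj₂ (inj₂ (inj₂ (m , 2∤m , s≤s (s≤s (s≤s (s≤s z≤n))) ,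
      trans (sym (ℕₚ.m+n∸n≡m d 4)) (cong (ℕ._∸ 4) (trans (sym m²≡) (sym (m^2≡m*m m)))))))

    unit⇒ofType₂₃ : (∀ q → d ≢ 1 ℕ.+ q ℕ.* 4) → ∀ A → normForm 0ℤ (+ d) A 1ℤ ≡ 1ℤ ⊎ normForm 0ℤ (+ d) A 1ℤ ≡ -1ℤ →
      OfType d
    unit⇒ofType₂₃ d≢1 A (inj₁ norm≡1)  = m*m≡d+1⇒ofType ℤ.∣ A ∣
      (ℤₚ.+-injective (trans (∣i∣*∣i∣≡i*i A) (trans (eq A (+ d)) (cong (λ z → + d ℤ.+ z) norm≡1))))
      where
      eq : ∀ A d → A ℤ.* A ≡ d ℤ.+ (A ℤ.* A ℤ.+ 0ℤ ℤ.* (A ℤ.* 1ℤ) ℤ.- d ℤ.* (1ℤ ℤ.* 1ℤ))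
      eq = ℤ-Solver.solve-∀
    unit⇒ofType₂₃ d≢1 A (inj₂ norm≡-1) = d≡m*m+1⇒ofType ℤ.∣ A ∣ d≢1
      (ℤₚ.+-injective (trans (eq A (+ d)) (cong₂ (λ x z → x ℤ.- z) (sym (∣i∣*∣i∣≡i*i A)) norm≡-1)))
      where
      eq : ∀ A d → d ≡ A ℤ.* A ℤ.- (A ℤ.* A ℤ.+ 0ℤ ℤ.* (A ℤ.* 1ℤ) ℤ.- d ℤ.* (1ℤ ℤ.* 1ℤ))
      eq = ℤ-Solver.solve-∀

    -- `4 (A² + A - q) = (2 A + 1)² - d`, so a norm ±1 means `(2 A + 1)² = d ± 4`.
    unit⇒ofType₁ : ∀ q → + d ≡ + 4 ℤ.* q ℤ.+ 1ℤ → ∀ A → normForm 1ℤ q A 1ℤ ≡ 1ℤ ⊎ normForm 1ℤ q A 1ℤ ≡ -1ℤ → OfType d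
    unit⇒ofType₁ q d≡ A = cases
      where
      O = + 2 ℤ.* A ℤ.+ 1ℤ
      2∤O : 2 ℕᵈ.∤ ℤ.∣ O ∣
      2∤O (ℕᵈ.divides j ∣O∣≡) = contradiction (4∣⇒≡0 {+ j ℤ.* + j ℤ.- A ℤ.* A ℤ.- A} {1ℤ} (s≤s (s≤s z≤n)) (begin
        + 4 ℤ.* (+ j ℤ.* + j ℤ.- A ℤ.* A ℤ.- A)                             ≡⟨ eq₁ (+ j) A ⟩
        + j ℤ.* + 2 ℤ.* (+ j ℤ.* + 2) ℤ.- (O ℤ.* O ℤ.- 1ℤ)
          ≡⟨ cong (λ x → x ℤ.* x ℤ.- (O ℤ.* O ℤ.- 1ℤ)) (trans (sym (ℤₚ.pos-* j 2)) (cong +_ (sym ∣O∣≡))) ⟩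
        + ℤ.∣ O ∣ ℤ.* + ℤ.∣ O ∣ ℤ.- (O ℤ.* O ℤ.- 1ℤ)
          ≡⟨ cong (λ x → x ℤ.- (O ℤ.* O ℤ.- 1ℤ)) (trans (sym (ℤₚ.pos-* ℤ.∣ O ∣ ℤ.∣ O ∣)) (∣i∣*∣i∣≡i*i O)) ⟩
        O ℤ.* O ℤ.- (O ℤ.* O ℤ.- 1ℤ)                                        ≡⟨ eq₂ (O ℤ.* O) ⟩
        1ℤ                                                                  ∎)) λ ()
        where
        open ≡-Reasoning
        eq₁ : ∀ j A → + 4 ℤ.* (j ℤ.* j ℤ.- A ℤ.* A ℤ.- A) ≡ j ℤ.* + 2 ℤ.* (j ℤ.* + 2) ℤ.-
          ((+ 2 ℤ.* A ℤ.+ 1ℤ) ℤ.* (+ 2 ℤ.* A ℤ.+ 1ℤ) ℤ.- 1ℤ)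
        eq₁ = ℤ-Solver.solve-∀
        eq₂ : ∀ X → X ℤ.- (X ℤ.- 1ℤ) ≡ 1ℤ
        eq₂ = ℤ-Solver.solve-∀
      eq₃ : ∀ A q → (+ 2 ℤ.* A ℤ.+ 1ℤ) ℤ.* (+ 2 ℤ.* A ℤ.+ 1ℤ) ≡ + 4 ℤ.* q ℤ.+ 1ℤ ℤ.+ + 4 ℤ.*
        (A ℤ.* A ℤ.+ 1ℤ ℤ.* (A ℤ.* 1ℤ) ℤ.- q ℤ.* (1ℤ ℤ.* 1ℤ))
      eq₃ = ℤ-Solver.solve-∀
      eq₄ : ∀ A q → + 4 ℤ.* q ℤ.+ 1ℤ ≡ (+ 2 ℤ.* A ℤ.+ 1ℤ) ℤ.* (+ 2 ℤ.* A ℤ.+ 1ℤ) ℤ.- + 4 ℤ.*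
        (A ℤ.* A ℤ.+ 1ℤ ℤ.* (A ℤ.* 1ℤ) ℤ.- q ℤ.* (1ℤ ℤ.* 1ℤ))
      eq₄ = ℤ-Solver.solve-∀
      cases : _ → OfType d
      cases (inj₁ norm≡1)  = m*m≡d+4⇒ofType ℤ.∣ O ∣ 2∤O
        (ℤₚ.+-injective (trans (∣i∣*∣i∣≡i*i O) (trans (eq₃ A q) (cong₂ (λ x z → x ℤ.+ + 4 ℤ.* z) (sym d≡) norm≡1))))
      cases (inj₂ norm≡-1) = d≡m*m+4⇒ofType ℤ.∣ O ∣ 2∤O
        (ℤₚ.+-injective (trans d≡ (trans (eq₄ A q) (cong₂ (λ x z → x ℤ.- + 4 ℤ.* z) (sym (∣i∣*∣i∣≡i*i O)) norm≡-1))))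

    open RealQuadratic d using (NumberOfPerfectClasses)

    module _ (basis : IntegralBasis d) {k : ℤ} (reduced : Reduced (IntegralBasis.t basis) (IntegralBasis.n basis) k)
      where
      open IntegralBasis basis

      one-class⇒norm≡±1 : NumberOfPerfectClasses 1 → ∃ λ A → normForm t n A 1ℤ ≡ 1ℤ ⊎ normForm t n A 1ℤ ≡ -1ℤ
      one-class⇒norm≡±1 = Classes.one-class⇒unit 0<d squareFree basis reduced

      norm²≡1⇒one-class : normForm t n k 1ℤ ℤ.* normForm t n k 1ℤ ≡ 1ℤ → NumberOfPerfectClasses 1
      norm²≡1⇒one-class = Classes.unit⇒one-class 0<d squareFree basis reduced

    one-class⇒ofType : NumberOfPerfectClasses 1 → OfType d
    one-class⇒ofType one = cases (d ℕ.% 4) (ℕ.m%n<n d 4) (ℕ.m≡m%n+[m/n]*n d 4)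
      where
      d/4 = d ℕ./ 4
      d≢1 : ∀ {r} → r ℕ.< 4 → r ≢ 1 → d ≡ r ℕ.+ d/4 ℕ.* 4 → ∀ q′ → d ≢ 1 ℕ.+ q′ ℕ.* 4
      d≢1 {r} r<4 r≢1 d≡ q′ d≡′ = r≢1 (begin
        r                          ≡⟨ ℕ.m<n⇒m%n≡m r<4 ⟨
        r ℕ.% 4                    ≡⟨ ℕ.[m+kn]%n≡m%n r d/4 4 ⟨
        (r ℕ.+ d/4 ℕ.* 4) ℕ.% 4      ≡⟨ cong (ℕ._% 4) (trans (sym d≡) d≡′) ⟩
        (1 ℕ.+ q′ ℕ.* 4) ℕ.% 4     ≡⟨ ℕ.[m+kn]%n≡m%n 1 q′ 4 ⟩
        1                          ∎)
        where open ≡-Reasoning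
      cast : ∀ r → d ≡ r ℕ.+ d/4 ℕ.* 4 → + d ≡ + 4 ℤ.* + d/4 ℤ.+ + r
      cast r d≡ = trans (cong +_ (trans d≡ (trans (ℕₚ.+-comm r (d/4 ℕ.* 4)) (cong (ℕ._+ r) (ℕₚ.*-comm d/4 4)))))
        (cong (λ z → z ℤ.+ + r) (ℤₚ.pos-* 4 d/4))
      case₂₃ : ∀ r → (+ r ≡ + 2 ⊎ + r ≡ + 3) → r ℕ.< 4 → r ≢ 1 → d ≡ r ℕ.+ d/4 ℕ.* 4 → OfType d
      case₂₃ r r≡ r<4 r≢1 d≡ = helper (subst (λ n → ∃ λ k → Reduced 0ℤ (+ n) k) (ℕₚ.m+[n∸m]≡n 0<d)
        (reduced-exists (inj₁ refl) (d ℕ.∸ 1)))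
        where
        basis = basis₂₃ 0<d (+ d/4) (+ r) r≡ (cast r d≡)
        helper : (∃ λ k → Reduced 0ℤ (+ d) k) → OfType d
        helper (k , reduced) = unit⇒ofType₂₃ (d≢1 r<4 r≢1 d≡) (proj₁ unit) (proj₂ unit)
          where
          unit : ∃ λ A → normForm 0ℤ (+ d) A 1ℤ ≡ 1ℤ ⊎ normForm 0ℤ (+ d) A 1ℤ ≡ -1ℤ
          unit = one-class⇒norm≡±1 basis reduced one
      case₁ : ∀ q → d ≡ 1 ℕ.+ q ℕ.* 4 → + d ≡ + 4 ℤ.* + q ℤ.+ 1ℤ → OfType d
      case₁ zero    d≡ _  = contradiction (sym d≡) (ℕₚ.<⇒≢ 1<d)
      case₁ (suc q) _  d≡ = helper (reduced-exists (inj₂ refl) q)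
        where
        helper : (∃ λ k → Reduced 1ℤ (+ suc q) k) → OfType d
        helper (k , reduced) = unit⇒ofType₁ (+ suc q) d≡ (proj₁ unit) (proj₂ unit)
          where
          unit : ∃ λ A → normForm 1ℤ (+ suc q) A 1ℤ ≡ 1ℤ ⊎ normForm 1ℤ (+ suc q) A 1ℤ ≡ -1ℤ
          unit = one-class⇒norm≡±1 (basis₁ (+ suc q) (ℤ.+<+ (s≤s z≤n)) d≡) reduced one
      cases : ∀ r → r ℕ.< 4 → d ≡ r ℕ.+ d/4 ℕ.* 4 → OfType d
      cases 0 _   d≡ = contradiction d≡ (4∤d d/4)
      cases 1 _   d≡ = case₁ d/4 d≡ (cast 1 d≡)
      cases 2 r<4 d≡ = case₂₃ 2 (inj₁ refl) r<4 (λ ()) d≡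
      cases 3 r<4 d≡ = case₂₃ 3 (inj₂ refl) r<4 (λ ()) d≡
      cases (suc (suc (suc (suc _)))) (s≤s (s≤s (s≤s (s≤s ())))) _

    -- The case in which `k + ω` has norm `c - 1 = -1`, for (T1) and (T3).
    reduced-c≡0 : ∀ {t n k} → 0ℤ ℤ.≤ k → 0ℤ ℤ.< k ℤ.+ t → k ℤ.* k ℤ.+ t ℤ.* k ℤ.- n ℤ.+ 1ℤ ≡ 0ℤ → Reduced t n k
    reduced-c≡0 {k = k} 0≤k 0<k+t c≡0 = record { 0≤k = 0≤k ; 0<k+t = 0<k+t ; c≤k =
      subst (ℤ._≤ k) (sym c≡0) 0≤k ; -k≤c = subst (ℤ.- k ℤ.≤_) (sym c≡0) (ℤₚ.neg-mono-≤ 0≤k) }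

    -- The case of norm `c - 1 = 1`, for (T2) and (T4); here `c ≤ k` requires `k ≥ 2`.
    reduced-c≡2 : ∀ {t n k} → + 2 ℤ.≤ k → 0ℤ ℤ.≤ t → k ℤ.* k ℤ.+ t ℤ.* k ℤ.- n ℤ.+ 1ℤ ≡ + 2 → Reduced t n k
    reduced-c≡2 {k = k} 2≤k 0≤t c≡2 = record
      { 0≤k = 0≤k ; 0<k+t = ℤₚ.+-mono-<-≤ (ℤₚ.<-≤-trans (ℤ.+<+ {0} {2} (s≤s z≤n)) 2≤k) 0≤t
      ; c≤k = subst (ℤ._≤ k) (sym c≡2) 2≤k ; -k≤c =
        subst (ℤ.- k ℤ.≤_) (sym c≡2) (ℤₚ.≤-trans (ℤₚ.neg-mono-≤ 0≤k) (ℤ.+≤+ z≤n)) }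
      where 0≤k = ℤₚ.≤-trans (ℤ.+≤+ {0} {2} z≤n) 2≤k

    -- For odd `m`, `d` is 2 modulo 4, and `ε = m + √d` has norm -1.
    type₁ : ∀ m → 2 ℕᵈ.∤ m → d ≡ m ℕ.^ 2 ℕ.+ 1 → NumberOfPerfectClasses 1
    type₁ m 2∤m d≡ = helper (odd m 2∤m)
      where
      +d≡ : + d ≡ + m ℤ.* + m ℤ.+ 1ℤ
      +d≡ = trans (cong +_ (trans d≡ (cong (ℕ._+ 1) (m^2≡m*m m)))) (cong (λ z → z ℤ.+ 1ℤ) (ℤₚ.pos-* m m))
      eq₁ : ∀ j → (+ 2 ℤ.* j ℤ.+ 1ℤ) ℤ.* (+ 2 ℤ.* j ℤ.+ 1ℤ) ℤ.+ 1ℤ ≡ + 4 ℤ.* (j ℤ.* j ℤ.+ j) ℤ.+ + 2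
      eq₁ = ℤ-Solver.solve-∀
      eq₂ : ∀ k → k ℤ.* k ℤ.+ 0ℤ ℤ.* k ℤ.- (k ℤ.* k ℤ.+ 1ℤ) ℤ.+ 1ℤ ≡ 0ℤ
      eq₂ = ℤ-Solver.solve-∀
      eq₃ : ∀ k → k ℤ.* k ℤ.+ 0ℤ ℤ.* (k ℤ.* 1ℤ) ℤ.- (k ℤ.* k ℤ.+ 1ℤ) ℤ.* (1ℤ ℤ.* 1ℤ) ≡ -1ℤ
      eq₃ = ℤ-Solver.solve-∀
      norm≡ : ∀ k → normForm 0ℤ (k ℤ.* k ℤ.+ 1ℤ) k 1ℤ ≡ -1ℤ
      norm≡ = eq₃
      helper : (∃ λ j → m ≡ 2 ℕ.* j ℕ.+ 1) → NumberOfPerfectClasses 1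
      helper (j , m≡) = norm²≡1⇒one-class
        (basis₂₃ 0<d (+ j ℤ.* + j ℤ.+ + j) (+ 2) (inj₁ refl)
          (trans +d≡ (trans (cong (λ k → k ℤ.* k ℤ.+ 1ℤ) +m≡) (eq₁ (+ j)))))
        {+ m} (reduced-c≡0 (ℤ.+≤+ z≤n) (ℤ.+<+ 0<m+0)
          (trans (cong (λ n → + m ℤ.* + m ℤ.+ 0ℤ ℤ.* + m ℤ.- n ℤ.+ 1ℤ) +d≡) (eq₂ (+ m))))
        (cong (λ z → z ℤ.* z) (trans (cong (λ n → normForm 0ℤ n (+ m) 1ℤ) +d≡) (norm≡ (+ m))))
        where
        +m≡ : + m ≡ + 2 ℤ.* + j ℤ.+ 1ℤ
        +m≡ = trans (cong +_ m≡) (cong (λ z → z ℤ.+ 1ℤ) (ℤₚ.pos-* 2 j))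
        0<m+0 : 0 ℕ.< m ℕ.+ 0
        0<m+0 = subst (0 ℕ.<_) (sym (trans (ℕₚ.+-identityʳ m) (trans m≡ (ℕₚ.+-comm (2 ℕ.* j) 1)))) (s≤s z≤n)

    -- For even `m`, `d` is 3 modulo 4, and `ε = m + √d` has norm 1.
    type₂ : ∀ m → 2 ℕᵈ.∣ m → d ≡ m ℕ.^ 2 ℕ.∸ 1 → NumberOfPerfectClasses 1
    -- Truncated subtraction turns `m = 0` into `d = 0`.
    type₂ .0 (ℕᵈ.divides zero refl) d≡ = contradiction (sym d≡) (ℕₚ.<⇒≢ 0<d)
    type₂ m (ℕᵈ.divides (suc i) m≡) d≡ = norm²≡1⇒one-class
        (basis₂₃ 0<d (j⁺ ℤ.* j⁺ ℤ.- 1ℤ) (+ 3) (inj₂ refl)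
          (trans +d≡ (trans (cong (λ k → k ℤ.* k ℤ.- 1ℤ) +m≡) (eq₁ j⁺))))
        {+ m} (reduced-c≡2 (ℤ.+≤+ 2≤m) ℤₚ.≤-refl (trans (cong (λ n → + m ℤ.* + m ℤ.+ 0ℤ ℤ.* + m ℤ.- n ℤ.+ 1ℤ) +d≡)
          (eq₂ (+ m))))
        (cong (λ z → z ℤ.* z) (trans (cong (λ n → normForm 0ℤ n (+ m) 1ℤ) +d≡) (norm≡ (+ m))))
      where
      j⁺ = + suc i
      eq₁ : ∀ j → (j ℤ.* + 2) ℤ.* (j ℤ.* + 2) ℤ.- 1ℤ ≡ + 4 ℤ.* (j ℤ.* j ℤ.- 1ℤ) ℤ.+ + 3
      eq₁ = ℤ-Solver.solve-∀
      eq₂ : ∀ k → k ℤ.* k ℤ.+ 0ℤ ℤ.* k ℤ.- (k ℤ.* k ℤ.- 1ℤ) ℤ.+ 1ℤ ≡ + 2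
      eq₂ = ℤ-Solver.solve-∀
      eq₃ : ∀ k → k ℤ.* k ℤ.+ 0ℤ ℤ.* (k ℤ.* 1ℤ) ℤ.- (k ℤ.* k ℤ.- 1ℤ) ℤ.* (1ℤ ℤ.* 1ℤ) ≡ 1ℤ
      eq₃ = ℤ-Solver.solve-∀
      norm≡ : ∀ k → normForm 0ℤ (k ℤ.* k ℤ.- 1ℤ) k 1ℤ ≡ 1ℤ
      norm≡ = eq₃
      2≤m : 2 ℕ.≤ m
      2≤m = subst (2 ℕ.≤_) (sym m≡) (s≤s (s≤s z≤n))
      1≤m² : 1 ℕ.≤ m ℕ.* m
      1≤m² = ℕₚ.*-mono-≤ {1} {m} {1} {m} (ℕₚ.<⇒≤ 2≤m) (ℕₚ.<⇒≤ 2≤m)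
      +m≡ : + m ≡ j⁺ ℤ.* + 2
      +m≡ = trans (cong +_ m≡) (ℤₚ.pos-* (suc i) 2)
      +d≡ : + d ≡ + m ℤ.* + m ℤ.- 1ℤ
      +d≡ = trans (cong +_ (trans d≡ (cong (ℕ._∸ 1) (m^2≡m*m m))))
        (trans (sym (ℤₚ.≤-⊖ 1≤m²)) (trans (sym (ℤₚ.m-n≡m⊖n (m ℕ.* m) 1)) (cong (λ z → z ℤ.- 1ℤ) (ℤₚ.pos-* m m))))

    -- With `m = 2 j + 1` and `k = j`, `ε = (m + √d) / 2` has norm -1.
    type₃ : ∀ m → 2 ℕᵈ.∤ m → d ≡ m ℕ.^ 2 ℕ.+ 4 → NumberOfPerfectClasses 1
    type₃ m 2∤m d≡ = helper (odd m 2∤m)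
      where
      eq₁ : ∀ j → (+ 2 ℤ.* j ℤ.+ 1ℤ) ℤ.* (+ 2 ℤ.* j ℤ.+ 1ℤ) ℤ.+ + 4 ≡ + 4 ℤ.* (j ℤ.* j ℤ.+ j ℤ.+ 1ℤ) ℤ.+ 1ℤ
      eq₁ = ℤ-Solver.solve-∀
      eq₂ : ∀ k → k ℤ.* k ℤ.+ 1ℤ ℤ.* k ℤ.- (k ℤ.* k ℤ.+ k ℤ.+ 1ℤ) ℤ.+ 1ℤ ≡ 0ℤ
      eq₂ = ℤ-Solver.solve-∀
      eq₃ : ∀ k → k ℤ.* k ℤ.+ 1ℤ ℤ.* (k ℤ.* 1ℤ) ℤ.- (k ℤ.* k ℤ.+ k ℤ.+ 1ℤ) ℤ.* (1ℤ ℤ.* 1ℤ) ≡ -1ℤ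
      eq₃ = ℤ-Solver.solve-∀
      norm≡ : ∀ k → normForm 1ℤ (k ℤ.* k ℤ.+ k ℤ.+ 1ℤ) k 1ℤ ≡ -1ℤ
      norm≡ = eq₃
      helper : (∃ λ j → m ≡ 2 ℕ.* j ℕ.+ 1) → NumberOfPerfectClasses 1
      helper (j , m≡) = norm²≡1⇒one-class
        (basis₁ (+ j ℤ.* + j ℤ.+ + j ℤ.+ 1ℤ) (ℤₚ.+-mono-≤-< (0≤i+j (0≤i² (+ j)) (ℤ.+≤+ {0} {j} z≤n))
          (ℤ.+<+ {0} {1} (s≤s z≤n))) (trans +d≡ (trans (cong (λ k → k ℤ.* k ℤ.+ + 4) +m≡) (eq₁ (+ j)))))
        {+ j} (reduced-c≡0 (ℤ.+≤+ z≤n) (ℤₚ.+-mono-≤-< (ℤ.+≤+ {0} {j} z≤n) (ℤ.+<+ {0} {1} (s≤s z≤n))) (eq₂ (+ j)))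
        (cong (λ z → z ℤ.* z) (norm≡ (+ j)))
        where
        +m≡ : + m ≡ + 2 ℤ.* + j ℤ.+ 1ℤ
        +m≡ = trans (cong +_ m≡) (cong (λ z → z ℤ.+ 1ℤ) (ℤₚ.pos-* 2 j))
        +d≡ : + d ≡ + m ℤ.* + m ℤ.+ + 4
        +d≡ = trans (cong +_ (trans d≡ (cong (ℕ._+ 4) (m^2≡m*m m)))) (cong (λ z → z ℤ.+ + 4) (ℤₚ.pos-* m m))

    -- With `m = 2 j + 1` and `k = j`, `ε = (m + √d) / 2` has norm 1; `m > 3` is what gives `k ≥ 2`.
    type₄ : ∀ m → 2 ℕᵈ.∤ m → 3 ℕ.< m → d ≡ m ℕ.^ 2 ℕ.∸ 4 → NumberOfPerfectClasses 1
    type₄ m 2∤m 3<m d≡ = helper (odd m 2∤m)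
      where
      eq₁ : ∀ j → (+ 2 ℤ.* j ℤ.+ 1ℤ) ℤ.* (+ 2 ℤ.* j ℤ.+ 1ℤ) ℤ.- + 4 ≡ + 4 ℤ.* (j ℤ.* j ℤ.+ j ℤ.- 1ℤ) ℤ.+ 1ℤ
      eq₁ = ℤ-Solver.solve-∀
      eq₂ : ∀ k → k ℤ.* k ℤ.+ 1ℤ ℤ.* k ℤ.- (k ℤ.* k ℤ.+ k ℤ.- 1ℤ) ℤ.+ 1ℤ ≡ + 2
      eq₂ = ℤ-Solver.solve-∀
      eq₃ : ∀ k → k ℤ.* k ℤ.+ 1ℤ ℤ.* (k ℤ.* 1ℤ) ℤ.- (k ℤ.* k ℤ.+ k ℤ.- 1ℤ) ℤ.* (1ℤ ℤ.* 1ℤ) ≡ 1ℤ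
      eq₃ = ℤ-Solver.solve-∀
      norm≡ : ∀ k → normForm 1ℤ (k ℤ.* k ℤ.+ k ℤ.- 1ℤ) k 1ℤ ≡ 1ℤ
      norm≡ = eq₃
      eq₄ : ∀ j → j ℤ.* j ℤ.+ (j ℤ.- 1ℤ) ≡ j ℤ.* j ℤ.+ j ℤ.- 1ℤ
      eq₄ = ℤ-Solver.solve-∀
      helper : (∃ λ j → m ≡ 2 ℕ.* j ℕ.+ 1) → NumberOfPerfectClasses 1
      helper (j , m≡) = norm²≡1⇒one-class
        (basis₁ (+ j ℤ.* + j ℤ.+ + j ℤ.- 1ℤ) 0<q (trans +d≡ (trans (cong (λ k → k ℤ.* k ℤ.- + 4) +m≡) (eq₁ (+ j)))))
        {+ j} (reduced-c≡2 (ℤ.+≤+ 2≤j) (ℤ.+≤+ z≤n) (eq₂ (+ j)))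
        (cong (λ z → z ℤ.* z) (norm≡ (+ j)))
        where
        2≤j : 2 ℕ.≤ j
        2≤j = ℕₚ.*-cancelˡ-< 2 1 j (ℕₚ.+-cancelʳ-< 1 2 (2 ℕ.* j) (subst (3 ℕ.<_) m≡ 3<m))
        0<q : 0ℤ ℤ.< + j ℤ.* + j ℤ.+ + j ℤ.- 1ℤ
        0<q = subst (0ℤ ℤ.<_) (eq₄ (+ j)) (ℤₚ.+-mono-<-≤ (0<i*j 0<+j 0<+j) (ℤₚ.i≤j⇒0≤j-i (0<i⇒1≤i 0<+j)))
          where 0<+j = ℤ.+<+ (ℕₚ.<⇒≤ 2≤j)
        4≤m² : 4 ℕ.≤ m ℕ.* m
        4≤m² = ℕₚ.*-mono-≤ {4} {m} {1} {m} 3<m (ℕₚ.≤-trans (s≤s z≤n) 3<m)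
        +m≡ : + m ≡ + 2 ℤ.* + j ℤ.+ 1ℤ
        +m≡ = trans (cong +_ m≡) (cong (λ z → z ℤ.+ 1ℤ) (ℤₚ.pos-* 2 j))
        +d≡ : + d ≡ + m ℤ.* + m ℤ.- + 4
        +d≡ = trans (cong +_ (trans d≡ (cong (ℕ._∸ 4) (m^2≡m*m m))))
          (trans (sym (ℤₚ.≤-⊖ 4≤m²)) (trans (sym (ℤₚ.m-n≡m⊖n (m ℕ.* m) 4)) (cong (λ z → z ℤ.- + 4) (ℤₚ.pos-* m m))))

    one-class⇔ofType : NumberOfPerfectClasses 1 ⇔ OfType d
    one-class⇔ofType = mk⇔ one-class⇒ofType λ
      { (inj₁ (m , 2∤m , d≡))                      → type₁ m 2∤m d≡
      ; (inj₂ (inj₁ (m , 2∣m , d≡)))               → type₂ m 2∣m d≡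
      ; (inj₂ (inj₂ (inj₁ (m , 2∤m , d≡))))        → type₃ m 2∤m d≡
      ; (inj₂ (inj₂ (inj₂ (m , 2∤m , 3<m , d≡))))  → type₄ m 2∤m 3<m d≡
      }

open import Data.Nat using (ℕ; _+_; _∸_; _^_; _<_)
open import Data.Nat.Divisibility using (_∣_; _∤_)
open import Data.Product using (∃; _×_)
open import Data.Sum using (_⊎_)
open import Function.Bundles using (_⇔_)
open import Relation.Binary.PropositionalEquality using (_≡_)

theorem1 : ∀ (d : ℕ) → 1 < d → SquareFree d →
    RealQuadratic.NumberOfPerfectClasses d 1 ⇔
    ( (∃ λ (m : ℕ) → 2 ∤ m × d ≡ m ^ 2 + 1)
    ⊎ (∃ λ (m : ℕ) → 2 ∣ m × d ≡ m ^ 2 ∸ 1)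
    ⊎ (∃ λ (m : ℕ) → 2 ∤ m × d ≡ m ^ 2 + 4)
    ⊎ (∃ λ (m : ℕ) → 2 ∤ m × 3 < m × d ≡ m ^ 2 ∸ 4) )
theorem1 d = PerfectUnaryForms.one-class⇔ofType
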